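{- Let $\mathrm{D}$ and $\mathrm{D}'$ be the sets defined in the context. If there exists a p-optimal proof system for $\mathrm{D}$, then there exists a p-optimal proof system for $\overline{\mathrm{D}'} = \Sigma^*\setminus \mathrm{D}'$.
   Context: Let $\Sigma=\{0,1\}$; words in $\Sigma^*$ are identified with natural numbers via a polynomial-time computable and invertible bijection. Let $\langle\cdot\rangle$ be an injective, polynomial-time computable and invertible tupling function on finite sequences of naturals with $|\langle u_1,\dots,u_n\rangle| = 2(|u_1|+\dots+|u_n|+n)$. Let $p_i(x)=x^i+i$. Let $\{N_i\}_{i\in\mathbb{N}}$ be a standard enumeration of nondeterministic polynomial-time Turing machines such that the running time of $N_i$ is bounded by $p_i$, $N_0$ always rejects and $N_1$ always accepts. For $p\in\mathbb{N}$, $L^p(N_i)$ denotes the set of inputs accepted by $N_i$ within $p$ steps. Define $\mathrm{D} = \{\langle 0^i,0^j,x,0^p\rangle \mid i,j\in\mathbb{N}, x\in\Sigma^*, x\in L^p(N_i)\cap\overline{L^p(N_j)}\}$ and $\mathrm{D}' = \mathrm{D}\cup\{w \mid w \text{ is not of the form } \langle 0^i,0^j,x,0^p\rangle\}$. A proof system for a set $L$ is a total polynomial-time computable function $f$ with image $L$. A proof system $g$ is p-simulated by a proof system $f$ if there is a polynomial-time computable $\pi$ with $f(\pi(x))=g(x)$ for all $x$. A proof system $f$ is p-optimal for $L$ if it p-simulates every proof system $g$ with image $L$. -}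

module Defs where

open import Data.Bool using (Bool; true; false; T; if_then_else_; _∨_; _∧_)
open import Data.Nat using (ℕ; zero; suc; _+_; _^_; _⊓_; _≡ᵇ_)
open import Data.List using (List; []; _∷_; length; map; replicate; _++_)
open import Data.Product using (Σ; _×_; _,_; ∃)
open import Data.Sum using (_⊎_)
open import Data.Maybe using (Maybe; just; nothing)
open import Data.Empty using (⊥)
open import Data.Unit using (⊤)
open import Relation.Nullary using (¬_)
open import Relation.Binary.PropositionalEquality using (_≡_)

-- Words over Σ = {0,1}  (false = 0, true = 1)

Word : Set
Word = List Bool

zeros : ℕ → Word
zeros n = replicate n false

-- The bijection ℕ → Σ* (bijective base-2 numeration, little endian):
-- n ↦ the n-th word, obtained by iterating a successor on words.
sucW : Word → Word
sucW []          = false ∷ []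
sucW (false ∷ w) = true ∷ w
sucW (true ∷ w)  = false ∷ sucW w

natToWord : ℕ → Word
natToWord zero    = []
natToWord (suc n) = sucW (natToWord n)

-- Tupling:  ⟨u₁,…,uₙ⟩ = d(u₁)01 d(u₂)01 … d(uₙ)01 where d doubles bits.
-- Injective, polynomial-time computable/invertible, and
-- |⟨u₁,…,uₙ⟩| = 2(|u₁|+…+|uₙ|+n).

encComp : Word → Word
encComp []      = false ∷ true ∷ []
encComp (b ∷ w) = b ∷ b ∷ encComp w

tuple : List Word → Word
tuple []       = []
tuple (u ∷ us) = encComp u ++ tuple us

tuple4 : ℕ → ℕ → Word → ℕ → Word
tuple4 i j x p = tuple (zeros i ∷ zeros j ∷ x ∷ zeros p ∷ [])

-- Turing machines: single two-way-infinite tape, tape symbols are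
-- natural numbers (0,1 = input bits, 2 = blank, others = work symbols),
-- states are natural numbers (0 = start, 1 = accept).  A machine is a
-- finite list of transition rules  (q, a) ↦ (q', b, move).

data Move : Set where
  mL mR mS : Move

record Rule : Set where
  constructor rule
  field
    q  : ℕ
    a  : ℕ
    q' : ℕ
    b  : ℕ
    mv : Move

Machine : Set
Machine = List Rule

record Config : Set where
  constructor cfg
  field
    state : ℕ
    left  : List ℕ   -- cells to the left of the head, nearest first
    right : List ℕ   -- head cell followed by cells to the right

blank : ℕ
blank = 2

headSym : List ℕ → ℕ
headSym []      = blank
headSym (s ∷ _) = s

writeSym : ℕ → List ℕ → List ℕ
writeSym b []      = b ∷ []
writeSym b (_ ∷ r) = b ∷ r

moveHead : Move → List ℕ → List ℕ → Config
moveHead mS l r = cfg 0 l r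
moveHead mR l []      = cfg 0 (blank ∷ l) []
moveHead mR l (s ∷ r) = cfg 0 (s ∷ l) r
moveHead mL []      r = cfg 0 [] (blank ∷ r)
moveHead mL (s ∷ l) r = cfg 0 l (s ∷ r)

setState : ℕ → Config → Config
setState q (cfg _ l r) = cfg q l r

matches : Rule → Config → Bool
matches (rule q a _ _ _) (cfg s _ r) = (q ≡ᵇ s) ∧ (a ≡ᵇ headSym r)

applyRule : Rule → Config → Config
applyRule (rule _ _ q' b m) (cfg _ l r) = setState q' (moveHead m l (writeSym b r))

bitSym : Bool → ℕ
bitSym false = 0
bitSym true  = 1

initial : Word → Config
initial x = cfg 0 [] (map bitSym x)

successors : Machine → Config → List Config
successors []       c = []
successors (r ∷ rs) c =
  if matches r c then applyRule r c ∷ successors rs c else successors rs c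

mutual
  acceptsWithin : Machine → ℕ → Config → Bool
  acceptsWithin M n c with Config.state c ≡ᵇ 1
  ... | true  = true
  ... | false = anySucc M n (successors M c)

  anySucc : Machine → ℕ → List Config → Bool
  anySucc M zero    cs       = false
  anySucc M (suc n) []       = false
  anySucc M (suc n) (c ∷ cs) = acceptsWithin M n c ∨ anySucc M (suc n) cs

stepD : Machine → Config → Maybe Config
stepD []       c = nothing
stepD (r ∷ rs) c = if matches r c then just (applyRule r c) else stepD rs c

runD : Machine → ℕ → Config → Config
runD M zero    c = c
runD M (suc n) c with stepD M c
... | nothing = c
... | just c' = runD M n c'

outBits : List ℕ → Word
outBits []            = []
outBits (0 ∷ r)       = false ∷ outBits r
outBits (1 ∷ r)       = true ∷ outBits r
outBits (suc (suc _) ∷ r) = []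

output : Config → Word
output c = outBits (Config.right c)

PolyTime : (Word → Word) → Set
PolyTime f = Σ Machine λ M → Σ ℕ λ k → ∀ x →
  let c = runD M (length x ^ k + k) (initial x) in
  (stepD M c ≡ nothing) × (output c ≡ f x)

-- The standard enumeration {N_i} of nondeterministic polynomial-time
-- machines: N_i is the machine coded by (the word of) i, clocked by p_i;
-- N_0 always rejects and N_1 always accepts.

readU : Word → ℕ × Word
readU []          = 0 , []
readU (false ∷ w) = 0 , w
readU (true ∷ w)  with readU w
... | n , r = suc n , r

toMove : ℕ → Move
toMove zero          = mL
toMove (suc zero)    = mR
toMove (suc (suc _)) = mS

-- rules coded as 1^q 0 1^a 0 1^q' 0 1^b 0 1^m 0, concatenated
parseRules : ℕ → Word → List Rule
parseRules zero    w  = []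
parseRules (suc f) [] = []
parseRules (suc f) w@(_ ∷ _) with readU w
... | q , w1 with readU w1
... | a , w2 with readU w2
... | q' , w3 with readU w3
... | b , w4 with readU w4
... | m , w5 = rule q a q' b (toMove m) ∷ parseRules f w5

decodeMachine : ℕ → Machine
decodeMachine i = parseRules (length (natToWord i)) (natToWord i)

p : ℕ → ℕ → ℕ
p i n = n ^ i + i

InL : ℕ → ℕ → Word → Set
InL zero          t x = ⊥
InL (suc zero)    t x = ⊤
InL i@(suc (suc _)) t x =
  T (acceptsWithin (decodeMachine i) (t ⊓ p i (length x)) (initial x))

D : Word → Set
D w = Σ ℕ λ i → Σ ℕ λ j → Σ Word λ x → Σ ℕ λ t →
      (w ≡ tuple4 i j x t) × InL i t x × ¬ InL j t x

WellFormed : Word → Set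
WellFormed w = Σ ℕ λ i → Σ ℕ λ j → Σ Word λ x → Σ ℕ λ t → w ≡ tuple4 i j x t

D' : Word → Set
D' w = D w ⊎ ¬ WellFormed w

coD' : Word → Set
coD' w = ¬ D' w

IsProofSystem : (Word → Set) → (Word → Word) → Set
IsProofSystem L f = PolyTime f × (∀ x → L (f x)) × (∀ y → L y → ∃ λ x → f x ≡ y)

PSimulates : (Word → Word) → (Word → Word) → Set
PSimulates f g = Σ (Word → Word) λ π → PolyTime π × (∀ x → f (π x) ≡ g x)

IsPOptimal : (Word → Set) → (Word → Word) → Set
IsPOptimal L f = IsProofSystem L f ×
  (∀ g → IsProofSystem L g → PSimulates f g)

{-# OPTIONS --safe #-}
module Submission where

-- Let f be p-optimal for D.  A proof of ⟨0^i,0^j,x,0^t⟩ ∉ D is an f-proof of one coNP statement: for all choice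
-- words u leading N_i to accept x within t steps, a given machine, run on u for a given time, outputs an f-proof of
-- x ∈ L^t(N_j).  This statement is an instance of D, because the search for a counterexample u is some N_c.
-- Soundness is clear.  If g is any proof system for the complement of D', then mapping (y , u) to x ∈ L^t(N_j)
-- whenever u is accepting for g y = ⟨0^i,0^j,x,0^t⟩ extends f to a proof system for D.  The simulation of the latter by f is
-- the machine to be used for g, and since the resulting statements are true for all y, p-optimality of f also
-- yields their f-proofs in polynomial time.  For completeness on a single word a constant machine suffices.
--
-- Polynomial-time functions are implemented by programs on three stacks whose main stack holds a sequence of
-- words; such a program touches only the topmost word, so the functions compose freely.  A tape whose symbols
-- are triples of stack symbols, tops next to the head, turns a stack program into a Turing machine.

open import Defs
open import Data.Bool using (Bool; true; false; T; if_then_else_; _∨_; _∧_; not)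
open import Data.Bool.Properties using (T-≡; T?)
open import Data.Nat hiding (_/_; _%_)
open import Data.Nat.Properties
open import Data.Fin using (Fin; toℕ; fromℕ<; combine; remQuot; _↑ʳ_) renaming (zero to fzero; suc to fsuc)
open import Data.Fin.Properties using (toℕ-combine; remQuot-combine; toℕ-injective; toℕ-fromℕ<; toℕ<n)
open import Data.List using (List; []; _∷_; length; map; replicate; _++_; allFin; cartesianProduct; foldl; drop; _ʳ++_)
open import Data.List.Properties using (++-assoc; ++-identityʳ; length-++; length-map; length-replicate; map-++; length-ʳ++; length-tabulate; map-ʳ++)
open import Data.List.Membership.Propositional using (_∈_)
open import Data.List.Membership.Propositional.Properties using (∈-cartesianProduct⁺; ∈-allFin)
open import Data.List.Relation.Unary.Any using (here; there)
open import Data.List.Relation.Unary.All using (All; []; _∷_)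
open import Data.List.Relation.Unary.AllPairs using ([]; _∷_)
open import Data.List.Relation.Unary.Unique.Propositional using (Unique)
open import Data.List.Relation.Unary.Unique.Propositional.Properties using (cartesianProduct⁺; allFin⁺)
open import Data.Product using (Σ; _×_; _,_; ∃; ∃₂; proj₁; proj₂)
open import Data.Sum using (_⊎_; inj₁; inj₂)
open import Data.Maybe using (just; nothing)
open import Data.Empty using (⊥; ⊥-elim)
open import Data.Unit using (tt)
open import Function using (_∘_; id; case_of_; Equivalence)
open import Relation.Nullary using (¬_; Dec; yes; no; contradiction)
open import Relation.Binary.PropositionalEquality hiding (J)
open import Data.Nat.Solver using (module +-*-Solver)

-- Structured programs compiled to rule tables

-- A tuple lies outside `D'` when acceptance by N_i implies acceptance by N_j. This is a disjunction
-- of a coNP and an NP statement, and no polynomial-time map from `y` can be expected to tell which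
-- half holds for `g y`. The decision is therefore left to the word `u`: once `u` shows that the
-- premise holds, the NP half must be true. Both halves are instances of `D`, because index 1 makes
-- its accepting condition trivial and index 0 its rejecting one. The other obstacle is uniformity.
-- The index `c` is part of the new proof system and has to be fixed before any `g` is known, so the
-- machine for `g` reaches N_c only as data, together with a clock in unary. Hence the interpreter
-- of coded machines has to be polynomial-time itself. Moreover N_c is cut off by p_c, whose
-- exponent is the code of the machine; the code must be large compared with the running time of the
-- very machine that it describes.

data Prog (I C : Set) : Set where
  act   : I → Prog I C
  _⨾_   : Prog I C → Prog I C → Prog I C
  ifp   : C → Prog I C → Prog I C → Prog I C
  while : C → Prog I C → Prog I C

infixr 5 _⨾_

record Lang : Set₁ where
  constructor lang
  field
    {I C S} : Set
    ex : I → S → S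
    ts : C → S → Bool

open Lang using (ex; ts)

-- The number is only an upper bound on the time: `slack` lets branches and rounds of unequal length
-- share one bound.
data Run (𝓛 : Lang) : Prog (Lang.I 𝓛) (Lang.C 𝓛) → Lang.S 𝓛 → Lang.S 𝓛 → ℕ → Set where
  act   : ∀ {i s} → Run 𝓛 (act i) s (ex 𝓛 i s) 1
  _⨾_   : ∀ {P Q s s' s'' n m} → Run 𝓛 P s s' n → Run 𝓛 Q s' s'' m → Run 𝓛 (P ⨾ Q) s s'' (n + m)
  ifT   : ∀ {c P Q s s' n} → ts 𝓛 c s ≡ true → Run 𝓛 P s s' n → Run 𝓛 (ifp c P Q) s s' (suc n)
  ifF   : ∀ {c P Q s s' n} → ts 𝓛 c s ≡ false → Run 𝓛 Q s s' n → Run 𝓛 (ifp c P Q) s s' (suc n)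
  whF   : ∀ {c P s} → ts 𝓛 c s ≡ false → Run 𝓛 (while c P) s s 1
  whT   : ∀ {c P s s' s'' n m} → ts 𝓛 c s ≡ true → Run 𝓛 P s s' n → Run 𝓛 (while c P) s' s'' m →
          Run 𝓛 (while c P) s s'' (suc (n + m))
  slack : ∀ {P s s' n m} → n ≤ m → Run 𝓛 P s s' n → Run 𝓛 P s s' m

progSize : ∀ {I C} → Prog I C → ℕ
progSize (act _)     = 1
progSize (P ⨾ Q)     = progSize P + progSize Q
progSize (ifp _ P Q) = suc (progSize P + progSize Q)
progSize (while _ P) = suc (progSize P)

-- Every step is forced and starts outside the accepting state. Such a run therefore determines
-- `runD`, and it carries both acceptance and rejection of its last configuration back to its first.
data Reach (M : Machine) : ℕ → Config → Config → Set where
  done : ∀ {k c} → Reach M k c c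
  step : ∀ {k c c₁ c₂} → ¬ (Config.state c ≡ 1) → successors M c ≡ c₁ ∷ [] →
         Reach M k c₁ c₂ → Reach M (suc k) c c₂

reach-mono : ∀ {M k m c c'} → k ≤ m → Reach M k c c' → Reach M m c c'
reach-mono _         done         = done
reach-mono (s≤s k≤m) (step a s r) = step a s (reach-mono k≤m r)

reach-trans : ∀ {M k m c c' c''} → Reach M k c c' → Reach M m c' c'' → Reach M (k + m) c c''
reach-trans {k = k} {m} done r' = reach-mono (m≤n+m m k) r'
reach-trans (step a s r) r' = step a s (reach-trans r r')

successors-++ : ∀ R R' c → successors (R ++ R') c ≡ successors R c ++ successors R' c
successors-++ []      R' c = refl
successors-++ (x ∷ R) R' c with matches x c
... | true  = cong (applyRule x c ∷_) (successors-++ R R' c)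
... | false = successors-++ R R' c

successors-miss : ∀ {K : Set} (ρ : K → Rule) c → (∀ k → matches (ρ k) c ≡ false) →
                  ∀ ks → successors (map ρ ks) c ≡ []
successors-miss ρ c miss []       = refl
successors-miss ρ c miss (k ∷ ks) rewrite miss k = successors-miss ρ c miss ks

successors-miss-∉ : ∀ {K : Set} (ρ : K → Rule) c (k₀ : K) → (∀ k → matches (ρ k) c ≡ true → k ≡ k₀) →
                    ∀ ks → All (λ k → ¬ (k₀ ≡ k)) ks → successors (map ρ ks) c ≡ []
successors-miss-∉ ρ c k₀ only []       []       = refl
successors-miss-∉ ρ c k₀ only (k ∷ ks) (k≢ ∷ a) with matches (ρ k) c in eq
... | true  = ⊥-elim (k≢ (sym (only k eq)))
... | false = successors-miss-∉ ρ c k₀ only ks a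

successors-hit : ∀ {K : Set} (ρ : K → Rule) c (k₀ : K) → matches (ρ k₀) c ≡ true →
                 (∀ k → matches (ρ k) c ≡ true → k ≡ k₀) →
                 ∀ {ks} → Unique ks → k₀ ∈ ks → successors (map ρ ks) c ≡ applyRule (ρ k₀) c ∷ []
successors-hit ρ c k₀ hit only {k ∷ ks} (k∉ ∷ u) (here refl) rewrite hit =
  cong (applyRule (ρ k₀) c ∷_) (successors-miss-∉ ρ c k₀ only ks k∉)
successors-hit ρ c k₀ hit only {k ∷ ks} (k∉ ∷ u) (there k∈) with matches (ρ k) c in eq
... | false = successors-hit ρ c k₀ hit only u k∈
... | true with only k eq
...   | refl = ⊥-elim (lookup∉ k∉ k∈)
  where lookup∉ : ∀ {xs} → All (λ k' → ¬ (k ≡ k')) xs → k ∈ xs → ⊥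
        lookup∉ (px ∷ _) (here e)  = px e
        lookup∉ (_ ∷ a)  (there i) = lookup∉ a i

length-product : ∀ {X Y : Set} (xs : List X) (ys : List Y) → length (cartesianProduct xs ys) ≡ length xs * length ys
length-product []       ys = refl
length-product (x ∷ xs) ys = trans (length-++ (map (x ,_) ys)) (cong₂ _+_ (length-map (x ,_) ys) (length-product xs ys))

≡ᵇ-refl : ∀ n → (n ≡ᵇ n) ≡ true
≡ᵇ-refl zero    = refl
≡ᵇ-refl (suc n) = ≡ᵇ-refl n

≡ᵇ-sound : ∀ m n → (m ≡ᵇ n) ≡ true → m ≡ n
≡ᵇ-sound m n e = ≡ᵇ⇒≡ m n (subst T (sym e) tt)

≡ᵇ-≢ : ∀ m n → ¬ (m ≡ n) → (m ≡ᵇ n) ≡ false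
≡ᵇ-≢ m n m≢n with m ≡ᵇ n in e
... | true  = ⊥-elim (m≢n (≡ᵇ-sound m n e))
... | false = refl

∧-true : ∀ {x y} → x ∧ y ≡ true → x ≡ true × y ≡ true
∧-true {true} {true} _ = refl , refl

<ᵇ-true : ∀ {m n} → m < n → (m <ᵇ n) ≡ true
<ᵇ-true {m} {n} m<n with m <ᵇ n | <⇒<ᵇ m<n
... | true | _ = refl

<ᵇ-false : ∀ {m n} → n ≤ m → (m <ᵇ n) ≡ false
<ᵇ-false {m} {n} n≤m with m <ᵇ n in e
... | false = refl
... | true  = ⊥-elim (<⇒≱ (<ᵇ⇒< m n (subst T (sym e) tt)) n≤m)

if-true : ∀ {X : Set} {b} {x y : X} → b ≡ true → (if b then x else y) ≡ x
if-true refl = refl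

if-false : ∀ {X : Set} {b} {x y : X} → b ≡ false → (if b then x else y) ≡ y
if-false refl = refl

-- Injective and never 1, the accepting state.
skip1 : ℕ → ℕ
skip1 zero    = zero
skip1 (suc n) = suc (suc n)

skip1-inj : ∀ {m n} → skip1 m ≡ skip1 n → m ≡ n
skip1-inj {zero}  {zero}  _ = refl
skip1-inj {suc m} {suc n} e = suc-injective e

skip1-≢1 : ∀ n → ¬ (skip1 n ≡ 1)
skip1-≢1 zero    ()
skip1-≢1 (suc n) ()

-- A tape alphabet of A = 4 + B³ symbols (the bits, the blank, a marker and triples over Fin B)
-- and a finite control with a register in Fin B.
module Tape (B : ℕ) where
  A : ℕ
  A = 4 + B * (B * B)

  blankΓ markΓ : Fin A
  blankΓ = fsuc (fsuc fzero)
  markΓ  = fsuc (fsuc (fsuc fzero))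

  record Zip : Set where
    constructor zip
    field
      reg   : Fin B
      left  : List (Fin A)
      head  : Fin A
      right : List (Fin A)

  view : Fin B → List (Fin A) → List (Fin A) → Zip
  view v l []      = zip v l blankΓ []
  view v l (s ∷ r) = zip v l s r

  move : Move → Fin B → List (Fin A) → Fin A → List (Fin A) → Zip
  move mS v l       h r       = zip v l h r
  move mR v l       h r       = view v (h ∷ l) r
  move mL v []      h r       = zip v [] blankΓ (h ∷ r)
  move mL v (s ∷ l) h r       = zip v l s (h ∷ r)

  TInstr TTest : Set
  TInstr = Fin B → Fin A → Fin B × Fin A × Move
  TTest  = Fin B → Fin A → Bool

  texec : TInstr → Zip → Zip
  texec i (zip v l h r) = let (v' , h' , m) = i v h in move m v' l h' r

  tape : Lang
  tape = lang {C = TTest} texec (λ c z → c (Zip.reg z) (Zip.head z))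

  TProg : Set
  TProg = Prog TInstr TTest

  Table : Set
  Table = ℕ → Fin B → Fin A → ℕ × Fin B × Fin A × Move

  -- A fragment owns the `progSize` labels starting at `n` and leaves through `e`; a test sits at
  -- the first label of its fragment, and a loop body leaves to the test of its loop.
  compile : TProg → ℕ → ℕ → Table
  compile (act i)     n e ℓ v γ = e , i v γ
  compile (P ⨾ Q)     n e ℓ v γ =
    if ℓ <ᵇ n + progSize P then compile P n (n + progSize P) ℓ v γ
                           else compile Q (n + progSize P) e ℓ v γ
  compile (ifp c P Q) n e ℓ v γ =
    if ℓ ≡ᵇ n then (if c v γ then suc n else suc n + progSize P) , v , γ , mS else
    if ℓ <ᵇ suc n + progSize P then compile P (suc n) e ℓ v γ
                               else compile Q (suc n + progSize P) e ℓ v γ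
  compile (while c P) n e ℓ v γ =
    if ℓ ≡ᵇ n then (if c v γ then suc n else e) , v , γ , mS else compile P (suc n) n ℓ v γ

  -- Agreement is asked only on the labels of the fragment, so it passes to subprograms and one
  -- global table serves the whole induction in `simulate`.
  Implements : Table → TProg → ℕ → ℕ → Set
  Implements Δ P n e = ∀ ℓ → n ≤ ℓ → ℓ < n + progSize P → ∀ v γ → Δ ℓ v γ ≡ compile P n e ℓ v γ

  module _ {Δ : Table} where
    impl-seqˡ : ∀ {P Q n e} → Implements Δ (P ⨾ Q) n e → Implements Δ P n (n + progSize P)
    impl-seqˡ {n = n} im ℓ lo hi v γ =
      trans (im ℓ lo (<-≤-trans hi (+-monoʳ-≤ n (m≤m+n _ _))) v γ) (if-true (<ᵇ-true hi))

    impl-seqʳ : ∀ {P Q n e} → Implements Δ (P ⨾ Q) n e → Implements Δ Q (n + progSize P) e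
    impl-seqʳ {n = n} im ℓ lo hi v γ =
      trans (im ℓ (≤-trans (m≤m+n n _) lo) (subst (ℓ <_) (+-assoc n _ _) hi) v γ) (if-false (<ᵇ-false lo))

    impl-ifT : ∀ {c P Q n e} → Implements Δ (ifp c P Q) n e → Implements Δ P (suc n) e
    impl-ifT {P = P} {n = n} im ℓ lo hi v γ =
      trans (im ℓ (≤-trans (n≤1+n n) lo)
               (<-≤-trans hi (≤-trans (s≤s (+-monoʳ-≤ n (m≤m+n (progSize P) _))) (≤-reflexive (sym (+-suc n _))))) v γ)
        (trans (if-false (≡ᵇ-≢ ℓ n (>⇒≢ lo))) (if-true (<ᵇ-true hi)))

    impl-ifF : ∀ {c P Q n e} → Implements Δ (ifp c P Q) n e → Implements Δ Q (suc n + progSize P) e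
    impl-ifF {n = n} im ℓ lo hi v γ =
      trans (im ℓ (≤-trans (m≤m+n n _) (≤-trans (n≤1+n _) lo))
               (<-≤-trans hi (≤-reflexive (trans (cong suc (+-assoc n _ _)) (sym (+-suc n _))))) v γ)
        (trans (if-false (≡ᵇ-≢ ℓ n (>⇒≢ (≤-trans (s≤s (m≤m+n n _)) lo)))) (if-false (<ᵇ-false lo)))

    impl-wh : ∀ {c P n e} → Implements Δ (while c P) n e → Implements Δ P (suc n) n
    impl-wh {n = n} im ℓ lo hi v γ =
      trans (im ℓ (≤-trans (n≤1+n n) lo) (<-≤-trans hi (≤-reflexive (sym (+-suc n _)))) v γ)
        (if-false (≡ᵇ-≢ ℓ n (>⇒≢ lo)))

    impl-test : ∀ {c P Q n e} → Implements Δ (ifp c P Q) n e →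
                ∀ v γ → Δ n v γ ≡ ((if c v γ then suc n else suc n + progSize P) , v , γ , mS)
    impl-test {n = n} im v γ = trans (im n ≤-refl (m<m+n n (s≤s z≤n)) v γ) (if-true (≡ᵇ-refl n))

    impl-wtest : ∀ {c P n e} → Implements Δ (while c P) n e →
                 ∀ v γ → Δ n v γ ≡ ((if c v γ then suc n else e) , v , γ , mS)
    impl-wtest {n = n} im v γ = trans (im n ≤-refl (m<m+n n (s≤s z≤n)) v γ) (if-true (≡ᵇ-refl n))

  module Sim (base : ℕ) where
    -- Label and register together form the machine state. With `base` 0 the first label and
    -- register 0 give the start state 0; with `base` 2 the states 0, 1 and 2 remain free for
    -- guessing, accepting and returning.
    code : ℕ → Fin B → ℕ
    code ℓ v = skip1 (base + (B * ℓ + toℕ v))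

    -- A blank under the head has two list forms, an explicit symbol or the empty list; `at-end` is
    -- the latter.
    data _≃_ : Config → ℕ × Zip → Set where
      inside : ∀ {ℓ v l h r} → cfg (code ℓ v) (map toℕ l) (map toℕ (h ∷ r)) ≃ (ℓ , zip v l h r)
      at-end : ∀ {ℓ v l} → cfg (code ℓ v) (map toℕ l) [] ≃ (ℓ , zip v l blankΓ [])

    trule : Table → Fin B → Fin A → ℕ → Rule
    trule Δ v h ℓ = let (ℓ' , v' , h' , m) = Δ ℓ v h in rule (code ℓ v) (toℕ h) (code ℓ' v') (toℕ h') m

    tstep : ℕ × Fin B × Fin A × Move → Zip → ℕ × Zip
    tstep (ℓ' , v' , h' , m) (zip v l h r) = ℓ' , move m v' l h' r

    ≃-head : ∀ {c ℓ z} → c ≃ (ℓ , z) → headSym (Config.right c) ≡ toℕ (Zip.head z)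
    ≃-head inside = refl
    ≃-head at-end = refl

    ≃-state : ∀ {c ℓ z} → c ≃ (ℓ , z) → Config.state c ≡ code ℓ (Zip.reg z)
    ≃-state inside = refl
    ≃-state at-end = refl

    apply-≃ : ∀ {c ℓ z} (q a : ℕ) (d : ℕ × Fin B × Fin A × Move) → c ≃ (ℓ , z) → let (ℓ' , v' , h' , m) = d in
              applyRule (rule q a (code ℓ' v') (toℕ h') m) c ≃ tstep d z
    apply-≃ {z = zip v l h r}       q a (ℓ' , v' , h' , mS) inside = inside
    apply-≃ {z = zip v l h []}      q a (ℓ' , v' , h' , mR) inside = at-end
    apply-≃ {z = zip v l h (x ∷ r)} q a (ℓ' , v' , h' , mR) inside = inside
    apply-≃ {z = zip v [] h r}      q a (ℓ' , v' , h' , mL) inside = inside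
    apply-≃ {z = zip v (x ∷ l) h r} q a (ℓ' , v' , h' , mL) inside = inside
    apply-≃ q a (ℓ' , v' , h' , mS) at-end = inside
    apply-≃ q a (ℓ' , v' , h' , mR) at-end = at-end
    apply-≃ {z = zip v [] h r}      q a (ℓ' , v' , h' , mL) at-end = inside
    apply-≃ {z = zip v (x ∷ l) h r} q a (ℓ' , v' , h' , mL) at-end = inside

    Realises : Machine → Table → ℕ → Set
    Realises M Δ Q = ∀ {c ℓ z} → ℓ < Q → c ≃ (ℓ , z) →
                     successors M c ≡ applyRule (trule Δ (Zip.reg z) (Zip.head z) ℓ) c ∷ []

    module _ {M Δ Q} (realises : Realises M Δ Q) where
      one-step : ∀ {c ℓ z} → ℓ < Q → c ≃ (ℓ , z) → ∀ {d} → Δ ℓ (Zip.reg z) (Zip.head z) ≡ d →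
                 ∃ λ c' → Reach M 1 c c' × c' ≃ tstep d z
      one-step {c} {ℓ} {z} ℓ<Q c≃ refl =
        _ , step (λ e → skip1-≢1 _ (trans (sym (≃-state c≃)) e)) (realises ℓ<Q c≃) done ,
        apply-≃ 0 0 (Δ ℓ (Zip.reg z) (Zip.head z)) c≃

      simulate : ∀ {P : TProg} {n e k c z z'} → Implements Δ P n e → n + progSize P ≤ Q → Run tape P z z' k →
                 c ≃ (n , z) → ∃ λ c' → Reach M k c c' × c' ≃ (e , z')
      simulate {act i} {n} {z = z} im n≤Q act c≃ =
        one-step (<-≤-trans (m<m+n n (s≤s z≤n)) n≤Q) c≃ (im n ≤-refl (m<m+n n (s≤s z≤n)) (Zip.reg z) (Zip.head z))
      simulate {P ⨾ R} {n} im n≤Q (r ⨾ r') c≃ =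
        let c₁ , s₁ , e₁ = simulate (impl-seqˡ {P = P} {R} im) (≤-trans (+-monoʳ-≤ n (m≤m+n _ _)) n≤Q) r c≃
            c₂ , s₂ , e₂ = simulate (impl-seqʳ {P = P} {R} im) (≤-trans (≤-reflexive (+-assoc n _ _)) n≤Q) r' e₁
        in c₂ , reach-trans s₁ s₂ , e₂
      simulate {ifp c P R} {n} {z = z} im n≤Q (ifT e r) c≃ =
        let c₁ , s₁ , e₁ = one-step (<-≤-trans (m<m+n n (s≤s z≤n)) n≤Q) c≃
                             (trans (impl-test {P = P} {R} im _ _) (cong (_, (Zip.reg z , Zip.head z , mS)) (if-true e)))
            c₂ , s₂ , e₂ = simulate (impl-ifT {P = P} {R} im) (≤-trans (≤-trans (s≤s (+-monoʳ-≤ n (m≤m+n _ _))) (≤-reflexive (sym (+-suc n _)))) n≤Q) r e₁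
        in c₂ , reach-trans s₁ s₂ , e₂
      simulate {ifp c P R} {n} {z = z} im n≤Q (ifF e r) c≃ =
        let c₁ , s₁ , e₁ = one-step (<-≤-trans (m<m+n n (s≤s z≤n)) n≤Q) c≃
                             (trans (impl-test {P = P} {R} im _ _) (cong (_, (Zip.reg z , Zip.head z , mS)) (if-false e)))
            c₂ , s₂ , e₂ = simulate (impl-ifF {P = P} {R} im) (≤-trans (≤-reflexive (trans (cong suc (+-assoc n _ _)) (sym (+-suc n _)))) n≤Q) r e₁
        in c₂ , reach-trans s₁ s₂ , e₂
      simulate {while c P} {n} {e} {z = z} im n≤Q (whF e' ) c≃ =
        one-step (<-≤-trans (m<m+n n (s≤s z≤n)) n≤Q) c≃
          (trans (impl-wtest {c = c} {P} {e = e} im _ _) (cong (_, (Zip.reg z , Zip.head z , mS)) (if-false e')))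
      simulate {while c P} {n} {e} {z = z} im n≤Q (whT e' r r') c≃ =
        let c₁ , s₁ , e₁ = one-step (<-≤-trans (m<m+n n (s≤s z≤n)) n≤Q) c≃
                             (trans (impl-wtest {c = c} {P} {e = e} im _ _) (cong (_, (Zip.reg z , Zip.head z , mS)) (if-true e')))
            c₂ , s₂ , e₂ = simulate (impl-wh {c = c} {P} {e = e} im) (≤-trans (≤-reflexive (sym (+-suc n _))) n≤Q) r e₁
            c₃ , s₃ , e₃ = simulate {while c P} im n≤Q r' e₂
        in c₃ , reach-trans s₁ (reach-trans s₂ s₃) , e₃
      simulate im n≤Q (slack k≤m r) c≃ =
        let c₁ , s₁ , e₁ = simulate im n≤Q r c≃ in c₁ , reach-mono k≤m s₁ , e₁

    entry : Table → Fin A → ℕ → Fin B → ℕ → Rule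
    entry Δ γ ℓ v q = let (ℓ' , v' , γ' , m) = Δ ℓ v γ in rule q (toℕ γ) (code ℓ' v') (toℕ γ') m

    key : ∀ Q → Table → Fin (Q * B) × Fin A → Rule
    key Q Δ (s , γ) = entry Δ γ (toℕ (proj₁ (remQuot {Q} B s))) (proj₂ (remQuot {Q} B s)) (skip1 (base + toℕ s))

    tableRules : ℕ → Table → Machine
    tableRules Q Δ = map (key Q Δ) (cartesianProduct (allFin (Q * B)) (allFin A))

    -- Each label contributes at least one rule, so adding labels forces a longer machine and
    -- thereby a larger index in the enumeration.
    tableRules-length : .{{_ : NonZero B}} → ∀ Q Δ → Q ≤ length (tableRules Q Δ)
    tableRules-length Q Δ = begin
      Q                                                      ≤⟨ m≤m*n Q B ⟩
      Q * B                                                  ≤⟨ m≤m*n (Q * B) A ⟩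
      (Q * B) * A                                            ≡⟨ sym (cong₂ _*_ (length-tabulate {n = Q * B} id) (length-tabulate {n = A} id)) ⟩
      length (allFin (Q * B)) * length (allFin A)            ≡⟨ sym (length-product (allFin (Q * B)) (allFin A)) ⟩
      length (cartesianProduct (allFin (Q * B)) (allFin A))  ≡⟨ sym (length-map (key Q Δ) (cartesianProduct (allFin (Q * B)) (allFin A))) ⟩
      length (tableRules Q Δ)                                ∎
      where open ≤-Reasoning

    tableRules-realises : ∀ Q Δ → Realises (tableRules Q Δ) Δ Q
    tableRules-realises Q Δ {c} {ℓ} {z} ℓ<Q c≃ = trans
      (successors-hit (key Q Δ) c (s , h) hit only (cartesianProduct⁺ (allFin⁺ (Q * B)) (allFin⁺ A))
        (∈-cartesianProduct⁺ (∈-allFin s) (∈-allFin h)))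
      (cong (λ x → applyRule x c ∷ []) rule≡)
      where
        v = Zip.reg z
        h = Zip.head z
        s : Fin (Q * B)
        s = combine (fromℕ< ℓ<Q) v
        s≡ : toℕ s ≡ B * ℓ + toℕ v
        s≡ = trans (toℕ-combine (fromℕ< ℓ<Q) v) (cong (λ x → B * x + toℕ v) (toℕ-fromℕ< ℓ<Q))
        rule≡ : key Q Δ (s , h) ≡ trule Δ v h ℓ
        rule≡ = trans
          (cong₂ (λ lv q → entry Δ h (toℕ (proj₁ lv)) (proj₂ lv) q) (remQuot-combine {Q} {B} (fromℕ< ℓ<Q) v)
            (cong (λ x → skip1 (base + x)) s≡))
          (cong (λ x → entry Δ h x v (code ℓ v)) (toℕ-fromℕ< ℓ<Q))
        q≡ : skip1 (base + toℕ s) ≡ Config.state c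
        q≡ = trans (cong (λ x → skip1 (base + x)) s≡) (sym (≃-state c≃))
        match-def : ∀ k → matches (key Q Δ k) c ≡
                    (skip1 (base + toℕ (proj₁ k)) ≡ᵇ Config.state c) ∧ (toℕ (proj₂ k) ≡ᵇ headSym (Config.right c))
        match-def k = refl
        hit : matches (key Q Δ (s , h)) c ≡ true
        hit = trans (match-def (s , h)) (cong₂ _∧_
          (subst (λ x → (skip1 (base + toℕ s) ≡ᵇ x) ≡ true) q≡ (≡ᵇ-refl (skip1 (base + toℕ s))))
          (subst (λ x → (toℕ h ≡ᵇ x) ≡ true) (sym (≃-head c≃)) (≡ᵇ-refl (toℕ h))))
        only : ∀ k → matches (key Q Δ k) c ≡ true → k ≡ (s , h)
        only (s' , h') e =
          let (e₁ , e₂) = ∧-true (trans (sym (match-def (s' , h'))) e)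
          in cong₂ _,_ (toℕ-injective (+-cancelˡ-≡ base _ _ (skip1-inj (trans (≡ᵇ-sound (skip1 (base + toℕ s')) (Config.state c) e₁) (sym q≡)))))
                       (toℕ-injective (trans (≡ᵇ-sound (toℕ h') (headSym (Config.right c)) e₂) (≃-head c≃)))

    successors-foreign : ∀ Q Δ c → (∀ n → n < Q * B → ¬ (skip1 (base + n) ≡ Config.state c)) →
                         successors (tableRules Q Δ) c ≡ []
    successors-foreign Q Δ c foreign = successors-miss (key Q Δ) c miss (cartesianProduct (allFin (Q * B)) (allFin A))
      where miss : ∀ k → matches (key Q Δ k) c ≡ false
            miss (s , γ) rewrite ≡ᵇ-≢ (skip1 (base + toℕ s)) (Config.state c) (foreign (toℕ s) (toℕ<n s)) = refl

    simulate-compiled : ∀ (P : TProg) Q {M k c z z'} → Realises M (compile P 0 Q) Q → progSize P ≤ Q → Run tape P z z' k →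
                        c ≃ (0 , z) → ∃ λ c' → Reach M k c c' × c' ≃ (Q , z')
    simulate-compiled P Q realises P≤Q = simulate realises {P} (λ _ _ _ _ _ → refl) P≤Q

-- Three-stack programs on the tracks of a single tape

data Ix : Set where
  iA iB iM : Ix

record St : Set where
  constructor ⟪_,_,_⟫
  field
    stA stB stM : List ℕ
open St public

-- Stacks are padded by zeros at the bottom.
hd : List ℕ → ℕ
hd []      = 0
hd (x ∷ _) = x

tl : List ℕ → List ℕ
tl []       = []
tl (_ ∷ xs) = xs

get : Ix → St → List ℕ
get iA = stA
get iB = stB
get iM = stM

put : Ix → List ℕ → St → St
put iA x s = record s { stA = x }
put iB x s = record s { stB = x }
put iM x s = record s { stM = x }

data Src : Set where
  lit : ℕ → Src
  top : Ix → Src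

data SInstr : Set where
  push : Ix → Src → SInstr
  pop  : Ix → SInstr

value : Src → St → ℕ
value (lit c) s = c
value (top k) s = hd (get k s)

sexec : SInstr → St → St
sexec (push k x) s = put k (value x s ∷ get k s) s
sexec (pop k)    s = put k (tl (get k s)) s

STest : Set
STest = ℕ → ℕ → ℕ → Bool

stack : Lang
stack = lang {C = STest} sexec (λ c s → c (hd (stA s)) (hd (stB s)) (hd (stM s)))

SProg : Set
SProg = Prog SInstr STest

maxLit : SProg → ℕ
maxLit (act (push _ (lit c))) = c
maxLit (act (push _ (top _))) = 0
maxLit (act (pop _))          = 0
maxLit (P ⨾ Q)                = maxLit P ⊔ maxLit Q
maxLit (ifp _ P Q)            = maxLit P ⊔ maxLit Q
maxLit (while _ P)            = maxLit P

-- The three tracks have a common length while the stacks do not, so contents are compared entry by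
-- entry with 0 as the default below the bottom.
at : List ℕ → ℕ → ℕ
at []       _       = 0
at (x ∷ _)  zero    = x
at (_ ∷ xs) (suc i) = at xs i

at-hd : ∀ xs → at xs 0 ≡ hd xs
at-hd []      = refl
at-hd (_ ∷ _) = refl

at-tl : ∀ xs i → at (tl xs) i ≡ at xs (suc i)
at-tl []      i = refl
at-tl (_ ∷ _) i = refl

at-pad₀ : ∀ n i → at (replicate n 0) i ≡ 0
at-pad₀ zero    i       = refl
at-pad₀ (suc n) zero    = refl
at-pad₀ (suc n) (suc i) = at-pad₀ n i

at-pad : ∀ xs n i → at (xs ++ replicate n 0) i ≡ at xs i
at-pad []       n i       = at-pad₀ n i
at-pad (_ ∷ xs) n zero    = refl
at-pad (_ ∷ xs) n (suc i) = at-pad xs n i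

ʳ++-ʳ++-++ : ∀ {X : Set} (xs zs ys : List X) → (xs ʳ++ zs) ʳ++ ys ≡ zs ʳ++ (xs ++ ys)
ʳ++-ʳ++-++ []       zs ys = refl
ʳ++-ʳ++-++ (x ∷ xs) zs ys = ʳ++-ʳ++-++ xs (x ∷ zs) ys

module Tracks (b : ℕ) where
  -- The values 0 to 3 are the padding, the two bits and the end of a word; `b` makes room for the
  -- literals of the program.
  B : ℕ
  B = 4 + b
  open Tape B public

  record Cell : Set where
    constructor cell
    field
      cA cB cM : Fin B
  open Cell public

  empty : Cell
  empty = cell fzero fzero fzero

  cget : Ix → Cell → Fin B
  cget iA = cA
  cget iB = cB
  cget iM = cM

  cset : Ix → Fin B → Cell → Cell
  cset iA v c = record c { cA = v }
  cset iB v c = record c { cB = v }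
  cset iM v c = record c { cM = v }

  sym-of : Cell → Fin A
  sym-of (cell x y z) = 4 ↑ʳ combine x (combine y z)

  decode : Fin (B * (B * B)) → Cell
  decode i = let (x , yz) = remQuot {B} (B * B) i ; (y , z) = remQuot {B} B yz in cell x y z

  cell-of : Fin A → Cell
  cell-of (fsuc (fsuc (fsuc (fsuc i)))) = decode i
  cell-of _ = empty

  cell-sym : ∀ c → cell-of (sym-of c) ≡ c
  cell-sym (cell x y z) = trans
    (cong (λ q → cell (proj₁ q) (proj₁ (remQuot {B} B (proj₂ q))) (proj₂ (remQuot {B} B (proj₂ q))))
      (remQuot-combine {B} {B * B} x (combine y z)))
    (cong (λ q → cell x (proj₁ q) (proj₂ q)) (remQuot-combine {B} {B} y z))

  syms : List Cell → List (Fin A)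
  syms = map sym-of

  track : Ix → List Cell → List ℕ
  track k = map (λ c → toℕ (cget k c))

  notBlank notMark : TTest
  notBlank v γ = not (toℕ γ ≡ᵇ 2)
  notMark  v γ = not (toℕ γ ≡ᵇ 3)

  goL goR : TInstr
  goL v γ = v , γ , mL
  goR v γ = v , γ , mR

  -- The register carries the displaced symbol to the next cell. Repeated along the tape this shifts
  -- one track by one cell and leaves the other two in place.
  swap-in : Ix → Move → TInstr
  swap-in k m v γ = cget k (cell-of γ) , sym-of (cset k v (cell-of γ)) , m

  goHome : TProg
  goHome = while notMark (act goL) ⨾ act goR

  shiftIn : Ix → TProg
  shiftIn k = while notBlank (act (swap-in k mR)) ⨾ act (λ v γ → v , sym-of (cset k v empty) , mL) ⨾ goHome

  -- The shift towards the marker has to start at the far end, from a fresh zero, so that each cell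
  -- receives the symbol of its right neighbour. At the marker the register holds the old top, which
  -- is thereby dropped.
  shiftOut : Ix → TProg
  shiftOut k = while notBlank (act goR) ⨾ act (λ v γ → fzero , sym-of empty , mL) ⨾
               while notMark (act (swap-in k mL)) ⨾ act goR

  fromLit : ℕ → Fin B
  fromLit c with c <? B
  ... | yes c<B = fromℕ< c<B
  ... | no _    = fzero

  fromLit-< : ∀ {c} → c < B → toℕ (fromLit c) ≡ c
  fromLit-< {c} c<B with c <? B
  ... | yes p = toℕ-fromℕ< p
  ... | no ¬p = contradiction c<B ¬p

  load : Src → TInstr
  load (lit c) v γ = fromLit c , γ , mS
  load (top k) v γ = cget k (cell-of γ) , γ , mS

  on-tops : STest → TTest
  on-tops c v γ = let c' = cell-of γ in c (toℕ (cA c')) (toℕ (cB c')) (toℕ (cM c'))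

  translate : SProg → TProg
  translate (act (push k x)) = act (load x) ⨾ shiftIn k
  translate (act (pop k))    = shiftOut k
  translate (P ⨾ Q)          = translate P ⨾ translate Q
  translate (ifp c P Q)      = ifp (on-tops c) (translate P) (translate Q)
  translate (while c P)      = while (on-tops c) (translate P)

  act≡ : ∀ {i z z'} → texec i z ≡ z' → Run tape (act i) z z' 1
  act≡ refl = act

  module _ (l₀ : List (Fin A)) where
    posR posL : Fin B → List Cell → List Cell → Zip
    posR v ds cs = view v (syms ds ++ markΓ ∷ l₀) (syms cs)
    posL v []       R = zip v l₀ markΓ (syms R)
    posL v (d ∷ ds) R = zip v (syms ds ++ markΓ ∷ l₀) (sym-of d) (syms R)

    home : Fin B → List Cell → Zip
    home v cs = posR v [] cs

    posL-move : ∀ v ds d R → move mL v (syms ds ++ markΓ ∷ l₀) (sym-of d) (syms R) ≡ posL v ds (d ∷ R)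
    posL-move v []       d R = refl
    posL-move v (_ ∷ _)  d R = refl

    goHome-run : ∀ v ds R → Run tape goHome (posL v ds R) (home v (ds ʳ++ R)) (2 * length ds + 2)
    goHome-run v [] R = whF refl ⨾ act
    goHome-run v (d ∷ ds) R = slack≡ (loop (goHome-run v ds (d ∷ R)))
      where
        slack≡ : ∀ {z z'} → Run tape goHome z z' (2 + (2 * length ds + 2)) → Run tape goHome z z' (2 * suc (length ds) + 2)
        slack≡ = slack (≤-reflexive (solve 1 (λ n → con 2 :+ (con 2 :* n :+ con 2) := con 2 :* (con 1 :+ n) :+ con 2) refl (length ds)))
          where open +-*-Solver
        first : Run tape (act goL) (posL v (d ∷ ds) R) (posL v ds (d ∷ R)) 1
        first = act≡ (posL-move v ds d R)
        -- The given run may be hidden under `slack`, so a further round is put in front of it by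
        -- recursion on the run.
        loop : ∀ {z k} → Run tape goHome (posL v ds (d ∷ R)) z k → Run tape goHome (posL v (d ∷ ds) R) z (2 + k)
        loop (r ⨾ r') = whT refl first r ⨾ r'
        loop (slack k≤ r) = slack (+-monoʳ-≤ 2 k≤) (loop r)

    shR : Ix → Fin B → List Cell → List Cell
    shR k v []       = cset k v empty ∷ []
    shR k v (c ∷ cs) = cset k v c ∷ shR k (cget k c) cs

    back : Ix → Fin B → List Cell → List Cell → List Cell
    back k v []       R = R
    back k v (d ∷ ds) R = back k (cget k d) ds (cset k v d ∷ R)

    sweepR : ∀ k v ds cs → ∃ λ v' → Run tape (shiftIn k) (posR v ds cs) (home v' (ds ʳ++ shR k v cs))
                                        (4 * length cs + 2 * length ds + 4)
    sweepR k v ds [] = v , slack (≤-reflexive (solve 1 (λ n → con 1 :+ (con 1 :+ (con 2 :* n :+ con 2)) := con 2 :* n :+ con 4) refl (length ds)))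
        (whF refl ⨾ act≡ (posL-move₀ ds) ⨾ goHome-run v ds (cset k v empty ∷ []))
      where
        open +-*-Solver
        posL-move₀ : ∀ ds → move mL v (syms ds ++ markΓ ∷ l₀) (sym-of (cset k v empty)) [] ≡ posL v ds (cset k v empty ∷ [])
        posL-move₀ []      = refl
        posL-move₀ (_ ∷ _) = refl
    sweepR k v ds (c ∷ cs) with sweepR k (cget k c) (cset k v c ∷ ds) cs
    ... | v' , r = v' , slack (≤-reflexive eq) (loop r)
      where
        open +-*-Solver
        eq : 2 + (4 * length cs + 2 * suc (length ds) + 4) ≡ 4 * suc (length cs) + 2 * length ds + 4
        eq = solve 2 (λ m n → con 2 :+ (con 4 :* m :+ con 2 :* (con 1 :+ n) :+ con 4) := con 4 :* (con 1 :+ m) :+ con 2 :* n :+ con 4) refl (length cs) (length ds)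
        first : Run tape (act (swap-in k mR)) (posR v ds (c ∷ cs)) (posR (cget k c) (cset k v c ∷ ds) cs) 1
        first = act≡ (cong (λ x → posR (cget k x) (cset k v x ∷ ds) cs) (cell-sym c))
        loop : ∀ {z n} → Run tape (shiftIn k) (posR (cget k c) (cset k v c ∷ ds) cs) z n → Run tape (shiftIn k) (posR v ds (c ∷ cs)) z (2 + n)
        loop (r ⨾ r') = whT refl first r ⨾ r'
        loop (slack k≤ r) = slack (+-monoʳ-≤ 2 k≤) (loop r)

    walkR : ∀ v ds cs → Run tape (while notBlank (act goR)) (posR v ds cs) (posR v (cs ʳ++ ds) []) (2 * length cs + 1)
    walkR v ds []       = whF refl
    walkR v ds (c ∷ cs) = slack (≤-reflexive (solve 1 (λ m → con 2 :+ (con 2 :* m :+ con 1) := con 2 :* (con 1 :+ m) :+ con 1) refl (length cs)))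
                            (whT refl act (walkR v (c ∷ ds) cs))
      where open +-*-Solver

    sweepL : ∀ k v ds R → ∃ λ v' → Run tape (while notMark (act (swap-in k mL)) ⨾ act goR) (posL v ds R)
                                        (home v' (back k v ds R)) (2 * length ds + 2)
    sweepL k v []       R = v , whF refl ⨾ act
    sweepL k v (d ∷ ds) R with sweepL k (cget k d) ds (cset k v d ∷ R)
    ... | v' , r = v' , slack (≤-reflexive (solve 1 (λ n → con 2 :+ (con 2 :* n :+ con 2) := con 2 :* (con 1 :+ n) :+ con 2) refl (length ds))) (loop r)
      where
        open +-*-Solver
        first : Run tape (act (swap-in k mL)) (posL v (d ∷ ds) R) (posL (cget k d) ds (cset k v d ∷ R)) 1
        first = act≡ (trans (cong (λ x → move mL (cget k x) (syms ds ++ markΓ ∷ l₀) (sym-of (cset k v x)) (syms R)) (cell-sym d))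
                            (posL-move (cget k d) ds (cset k v d) R))
        loop : ∀ {z n} → Run tape (while notMark (act (swap-in k mL)) ⨾ act goR) (posL (cget k d) ds (cset k v d ∷ R)) z n →
               Run tape (while notMark (act (swap-in k mL)) ⨾ act goR) (posL v (d ∷ ds) R) z (2 + n)
        loop (r ⨾ r') = whT refl first r ⨾ r'
        loop (slack k≤ r) = slack (+-monoʳ-≤ 2 k≤) (loop r)

    length-shR : ∀ k v cs → length (shR k v cs) ≡ suc (length cs)
    length-shR k v []       = refl
    length-shR k v (c ∷ cs) = cong suc (length-shR k _ cs)

    length-back : ∀ k v ds R → length (back k v ds R) ≡ length ds + length R
    length-back k v []       R = refl
    length-back k v (d ∷ ds) R = trans (length-back k _ ds _) (+-suc _ _)

    cget-cset : ∀ k v c → cget k (cset k v c) ≡ v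
    cget-cset iA v c = refl
    cget-cset iB v c = refl
    cget-cset iM v c = refl

    cget-cset-≢ : ∀ j k v c → ¬ (j ≡ k) → cget j (cset k v c) ≡ cget j c
    cget-cset-≢ iA iA v c j≢k = contradiction refl j≢k
    cget-cset-≢ iA iB v c j≢k = refl
    cget-cset-≢ iA iM v c j≢k = refl
    cget-cset-≢ iB iA v c j≢k = refl
    cget-cset-≢ iB iB v c j≢k = contradiction refl j≢k
    cget-cset-≢ iB iM v c j≢k = refl
    cget-cset-≢ iM iA v c j≢k = refl
    cget-cset-≢ iM iB v c j≢k = refl
    cget-cset-≢ iM iM v c j≢k = contradiction refl j≢k

    cget-empty : ∀ k → cget k empty ≡ fzero
    cget-empty iA = refl
    cget-empty iB = refl
    cget-empty iM = refl

    track-shR : ∀ k v cs → track k (shR k v cs) ≡ toℕ v ∷ track k cs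
    track-shR k v []       = cong (λ x → toℕ x ∷ []) (cget-cset k v empty)
    track-shR k v (c ∷ cs) = cong₂ _∷_ (cong toℕ (cget-cset k v c)) (track-shR k _ cs)

    track-shR-≢ : ∀ j k v cs → ¬ (j ≡ k) → track j (shR k v cs) ≡ track j cs ++ replicate 1 0
    track-shR-≢ j k v []       j≢k = cong (λ x → toℕ x ∷ []) (trans (cget-cset-≢ j k v empty j≢k) (cget-empty j))
    track-shR-≢ j k v (c ∷ cs) j≢k = cong₂ _∷_ (cong toℕ (cget-cset-≢ j k v c j≢k)) (track-shR-≢ j k _ cs j≢k)

    track-back : ∀ k v ds R → track k (back k v ds R) ≡ tl (track k ds ʳ++ (toℕ v ∷ track k R))
    track-back k v []       R = refl
    track-back k v (d ∷ ds) R = trans (track-back k (cget k d) ds (cset k v d ∷ R))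
      (cong (λ x → tl (track k ds ʳ++ (toℕ (cget k d) ∷ toℕ x ∷ track k R))) (cget-cset k v d))

    track-back-≢ : ∀ j k v ds R → ¬ (j ≡ k) → track j (back k v ds R) ≡ track j ds ʳ++ track j R
    track-back-≢ j k v []       R j≢k = refl
    track-back-≢ j k v (d ∷ ds) R j≢k = trans (track-back-≢ j k (cget k d) ds (cset k v d ∷ R) j≢k)
      (cong (λ x → track j ds ʳ++ (toℕ x ∷ track j R)) (cget-cset-≢ j k v d j≢k))

    record Rep (cs : List Cell) (s : St) : Set where
      constructor mkRep
      field
        rep-at : ∀ k i → at (track k cs) i ≡ at (get k s) i
    open Rep public

    get-put : ∀ k x s → get k (put k x s) ≡ x
    get-put iA x s = refl
    get-put iB x s = refl
    get-put iM x s = refl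

    get-put-≢ : ∀ j k x s → ¬ (j ≡ k) → get j (put k x s) ≡ get j s
    get-put-≢ iA iA x s j≢k = contradiction refl j≢k
    get-put-≢ iA iB x s j≢k = refl
    get-put-≢ iA iM x s j≢k = refl
    get-put-≢ iB iA x s j≢k = refl
    get-put-≢ iB iB x s j≢k = contradiction refl j≢k
    get-put-≢ iB iM x s j≢k = refl
    get-put-≢ iM iA x s j≢k = refl
    get-put-≢ iM iB x s j≢k = refl
    get-put-≢ iM iM x s j≢k = contradiction refl j≢k

    _≟ᵢ_ : ∀ (j k : Ix) → Dec (j ≡ k)
    iA ≟ᵢ iA = yes refl
    iA ≟ᵢ iB = no (λ ())
    iA ≟ᵢ iM = no (λ ())
    iB ≟ᵢ iA = no (λ ())
    iB ≟ᵢ iB = yes refl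
    iB ≟ᵢ iM = no (λ ())
    iM ≟ᵢ iA = no (λ ())
    iM ≟ᵢ iB = no (λ ())
    iM ≟ᵢ iM = yes refl

    rep-push : ∀ {cs s} k v → Rep cs s → Rep (shR k v cs) (put k (toℕ v ∷ get k s) s)
    rep-push {cs} {s} k v rep .rep-at j i with j ≟ᵢ k
    ... | no j≢k rewrite track-shR-≢ j k v cs j≢k | get-put-≢ j k (toℕ v ∷ get k s) s j≢k =
      trans (at-pad (track j cs) 1 i) (rep-at rep j i)
    ... | yes refl rewrite track-shR k v cs | get-put k (toℕ v ∷ get k s) s with i
    ...   | zero   = refl
    ...   | suc i' = rep-at rep k i'

    popped : Ix → List Cell → List Cell
    popped k cs = back k fzero (cs ʳ++ []) (empty ∷ [])

    unwind : ∀ j cs ys → track j (cs ʳ++ []) ʳ++ ys ≡ track j cs ++ ys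
    unwind j cs ys = trans (cong (_ʳ++ ys) (map-ʳ++ _ cs)) (ʳ++-ʳ++-++ (track j cs) [] ys)

    rep-pop : ∀ {cs s} k → Rep cs s → Rep (popped k cs) (put k (tl (get k s)) s)
    rep-pop {cs} {s} k rep .rep-at j i with j ≟ᵢ k
    ... | no j≢k rewrite track-back-≢ j k fzero (cs ʳ++ []) (empty ∷ []) j≢k | get-put-≢ j k (tl (get k s)) s j≢k
                       | unwind j cs (track j (empty ∷ [])) | cget-empty j =
      trans (at-pad (track j cs) 1 i) (rep-at rep j i)
    ... | yes refl rewrite track-back k fzero (cs ʳ++ []) (empty ∷ []) | get-put k (tl (get k s)) s
                       | unwind k cs (0 ∷ track k (empty ∷ [])) | cget-empty k =
      trans (at-tl (track k cs ++ replicate 2 0) i) (trans (at-pad (track k cs) 2 (suc i))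
        (trans (rep-at rep k (suc i)) (sym (at-tl (get k s) i))))

    rep-top : ∀ {cs s} → Rep cs s → ∀ v k → toℕ (cget k (cell-of (Zip.head (home v cs)))) ≡ hd (get k s)
    rep-top {cs} {s} rep v k = trans (top-track cs) (trans (rep-at rep k 0) (at-hd (get k s)))
      where
        top-track : ∀ cs → toℕ (cget k (cell-of (Zip.head (home v cs)))) ≡ at (track k cs) 0
        top-track []      = cong toℕ (cget-empty k)
        top-track (c ∷ _) = cong (λ x → toℕ (cget k x)) (cell-sym c)

    -- A push and a pop each add one cell to the used tape, whence `length cs + n`. Each crosses the
    -- tape twice with a test and a move per cell, whence `4 * H`, where `H` bounds the number of
    -- cells throughout the run.
    Sim : TProg → List Cell → St → ℕ → ℕ → Set
    Sim P cs s' n H = ∀ v → ∃₂ λ v' cs' → Rep cs' s' × length cs' ≤ length cs + n ×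
                      Run tape P (home v cs) (home v' cs') (n * (4 * H + 10))

    load-run : ∀ x v cs → Run tape (act (load x)) (home v cs) (home (proj₁ (load x v (Zip.head (home v cs)))) cs) 1
    load-run (lit c) v []       = act
    load-run (top k) v []       = act
    load-run (lit c) v (_ ∷ cs) = act
    load-run (top k) v (_ ∷ cs) = act

    load-value : ∀ {cs s} x v k → maxLit (act (push k x)) < B → Rep cs s → toℕ (proj₁ (load x v (Zip.head (home v cs)))) ≡ value x s
    load-value (lit c) v _ c<B rep = fromLit-< c<B
    load-value (top k) v _ _   rep = rep-top rep v k

    test-tops : ∀ {cs s} (c : STest) v → Rep cs s → let γ = cell-of (Zip.head (home v cs)) in
                c (toℕ (cA γ)) (toℕ (cB γ)) (toℕ (cM γ)) ≡ c (hd (stA s)) (hd (stB s)) (hd (stM s))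
    test-tops c v rep = cong₂ (λ f z → f z) (cong₂ c (rep-top rep v iA) (rep-top rep v iB)) (rep-top rep v iM)

    translate-sim : ∀ {P s s' n} → Run stack P s s' n → maxLit P < B → ∀ {cs H} → Rep cs s → length cs + n ≤ H →
                    Sim (translate P) cs s' n H
    translate-sim {s = s} (act {push k x}) lt {cs} {H} rep bd v =
      let v₁ = proj₁ (load x v (Zip.head (home v cs)))
          v' , r = sweepR k v₁ [] cs
      in v' , shR k v₁ cs ,
         subst (λ y → Rep (shR k v₁ cs) (put k (y ∷ get k s) s)) (load-value x v k lt rep) (rep-push k v₁ rep) ,
         ≤-reflexive (trans (length-shR k v₁ cs) (sym (+-comm (length cs) 1))) ,
         slack (cost (≤-trans (m≤m+n _ 1) bd)) (load-run x v cs ⨾ r)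
      where
        cost : ∀ {c} → c ≤ H → 1 + (4 * c + 2 * 0 + 4) ≤ 1 * (4 * H + 10)
        cost {c} c≤H = begin
          1 + (4 * c + 0 + 4) ≡⟨ solve 1 (λ x → con 1 :+ (x :+ con 0 :+ con 4) := x :+ con 5) refl (4 * c) ⟩
          4 * c + 5           ≤⟨ +-mono-≤ (*-monoʳ-≤ 4 c≤H) (m≤m+n 5 5) ⟩
          4 * H + 10          ≡⟨ sym (+-identityʳ _) ⟩
          1 * (4 * H + 10)    ∎
          where
            open ≤-Reasoning
            open +-*-Solver
    translate-sim {s = s} (act {pop k}) lt {cs} {H} rep bd v =
      let v' , r = sweepL k fzero (cs ʳ++ []) (empty ∷ [])
      in v' , popped k cs , rep-pop k rep ,
         ≤-reflexive (trans (length-back k fzero (cs ʳ++ []) (empty ∷ [])) (cong (_+ 1) len)) ,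
         slack (cost (≤-trans (m≤m+n _ 1) bd) len) (walkR v [] cs ⨾ act≡ (turn (cs ʳ++ [])) ⨾ r)
      where
        open +-*-Solver
        len : length (cs ʳ++ []) ≡ length cs
        len = trans (length-ʳ++ cs) (+-identityʳ _)
        turn : ∀ ds → move mL fzero (syms ds ++ markΓ ∷ l₀) (sym-of empty) [] ≡ posL fzero ds (empty ∷ [])
        turn []      = refl
        turn (_ ∷ _) = refl
        cost : ∀ {c d} → c ≤ H → d ≡ c → (2 * c + 1) + (1 + (2 * d + 2)) ≤ 1 * (4 * H + 10)
        cost {c} c≤H refl = begin
          (2 * c + 1) + (1 + (2 * c + 2)) ≡⟨ solve 1 (λ x → (con 2 :* x :+ con 1) :+ (con 1 :+ (con 2 :* x :+ con 2)) := con 4 :* x :+ con 4) refl c ⟩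
          4 * c + 4           ≤⟨ +-mono-≤ (*-monoʳ-≤ 4 c≤H) (m≤m+n 4 6) ⟩
          4 * H + 10          ≡⟨ sym (+-identityʳ _) ⟩
          1 * (4 * H + 10)    ∎
          where open ≤-Reasoning
    translate-sim {P ⨾ Q} {s} (_⨾_ {n = n} {m} r r') lt {cs} {H} rep bd v =
      let v₁ , cs₁ , rep₁ , len₁ , t₁ = translate-sim r (m⊔n<o⇒m<o (maxLit P) (maxLit Q) lt) rep (≤-trans (+-monoʳ-≤ _ (m≤m+n n m)) bd) v
          v₂ , cs₂ , rep₂ , len₂ , t₂ = translate-sim r' (m⊔n<o⇒n<o (maxLit P) (maxLit Q) lt) rep₁
            (≤-trans (+-monoˡ-≤ m len₁) (≤-trans (≤-reflexive (+-assoc (length cs) n m)) bd)) v₁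
      in v₂ , cs₂ , rep₂ , ≤-trans len₂ (≤-trans (+-monoˡ-≤ m len₁) (≤-reflexive (+-assoc (length cs) n m))) ,
         slack (≤-reflexive (sym (*-distribʳ-+ _ n m))) (t₁ ⨾ t₂)
    translate-sim {ifp c P Q} (ifT {n = n} e r) lt {cs} {H} rep bd v =
      let v₁ , cs₁ , rep₁ , len₁ , t₁ = translate-sim r (m⊔n<o⇒m<o (maxLit P) (maxLit Q) lt) rep (≤-trans (+-monoʳ-≤ _ (n≤1+n n)) bd) v
      in v₁ , cs₁ , rep₁ , ≤-trans len₁ (+-monoʳ-≤ _ (n≤1+n n)) ,
         slack (+-monoˡ-≤ _ (≤-trans (s≤s z≤n) (m≤n+m 10 (4 * H)))) (ifT (trans (test-tops c v rep) e) t₁)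
    translate-sim {ifp c P Q} (ifF {n = n} e r) lt {cs} {H} rep bd v =
      let v₁ , cs₁ , rep₁ , len₁ , t₁ = translate-sim r (m⊔n<o⇒n<o (maxLit P) (maxLit Q) lt) rep (≤-trans (+-monoʳ-≤ _ (n≤1+n n)) bd) v
      in v₁ , cs₁ , rep₁ , ≤-trans len₁ (+-monoʳ-≤ _ (n≤1+n n)) ,
         slack (+-monoˡ-≤ _ (≤-trans (s≤s z≤n) (m≤n+m 10 (4 * H)))) (ifF (trans (test-tops c v rep) e) t₁)
    translate-sim {while c P} (whF e) lt {cs} {H} rep bd v =
      v , cs , rep , m≤m+n _ 1 , slack (≤-trans (≤-trans (s≤s z≤n) (m≤n+m 10 (4 * H))) (m≤m+n _ 0)) (whF (trans (test-tops c v rep) e))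
    translate-sim {while c P} (whT {n = n} {m} e r r') lt {cs} {H} rep bd v =
      let v₁ , cs₁ , rep₁ , len₁ , t₁ = translate-sim r lt rep (≤-trans (+-monoʳ-≤ _ (≤-trans (m≤m+n n m) (n≤1+n _))) bd) v
          v₂ , cs₂ , rep₂ , len₂ , t₂ = translate-sim r' lt rep₁
            (≤-trans (+-monoˡ-≤ m len₁) (≤-trans (≤-reflexive (+-assoc (length cs) n m)) (≤-trans (+-monoʳ-≤ _ (n≤1+n _)) bd))) v₁
      in v₂ , cs₂ , rep₂ ,
         ≤-trans len₂ (≤-trans (+-monoˡ-≤ m len₁) (≤-trans (≤-reflexive (+-assoc (length cs) n m)) (+-monoʳ-≤ _ (n≤1+n _)))) ,
         slack (+-mono-≤ (≤-trans (s≤s z≤n) (m≤n+m 10 (4 * H))) (≤-reflexive (sym (*-distribʳ-+ _ n m))))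
           (whT (trans (test-tops c v rep) e) t₁ t₂)
    translate-sim (slack {n = n} {m} n≤m r) lt {cs} {H} rep bd v =
      let v₁ , cs₁ , rep₁ , len₁ , t₁ = translate-sim r lt rep (≤-trans (+-monoʳ-≤ _ n≤m) bd) v
      in v₁ , cs₁ , rep₁ , ≤-trans len₁ (+-monoʳ-≤ _ n≤m) , slack (*-monoˡ-≤ _ n≤m) t₁

-- Polynomial bounds

-- A single power with base at least 2 absorbs constants and coefficients, since doubling costs just
-- one more factor; a bound is thus described by one exponent alone.
PB : {X : Set} → (X → ℕ) → (X → ℕ) → Set
PB s c = Σ ℕ λ k → ∀ x → c x ≤ (2 + s x) ^ k

n<2^n : ∀ n → n < 2 ^ n
n<2^n zero    = s≤s z≤n
n<2^n (suc n) = ≤-trans (+-mono-≤ (m^n>0 2 n) (n<2^n n)) (≤-reflexive (cong (2 ^ n +_) (sym (+-identityʳ _))))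

module _ {X : Set} {s : X → ℕ} where
  opaque
    pb-≤ : ∀ {c d : X → ℕ} → (∀ x → c x ≤ d x) → PB s d → PB s c
    pb-≤ c≤d (k , h) = k , λ x → ≤-trans (c≤d x) (h x)

    pb-const : ∀ c → PB s (λ _ → c)
    pb-const c = c , λ x → ≤-trans (<⇒≤ (n<2^n c)) (^-monoˡ-≤ c (m≤m+n 2 (s x)))

    pb-self : PB s s
    pb-self = 1 , λ x → ≤-trans (m≤n+m (s x) 2) (≤-reflexive (sym (*-identityʳ _)))

    pb-+ : ∀ {c d : X → ℕ} → PB s c → PB s d → PB s (λ x → c x + d x)
    pb-+ (k , h) (j , g) = suc (k + j) , λ x →
      ≤-trans (+-mono-≤ (≤-trans (h x) (^-monoʳ-≤ (2 + s x) (m≤m+n k j)))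
                        (≤-trans (g x) (^-monoʳ-≤ (2 + s x) (m≤n+m j k))))
        (≤-trans (≤-reflexive (cong ((2 + s x) ^ (k + j) +_) (sym (+-identityʳ _))))
                 (*-monoˡ-≤ ((2 + s x) ^ (k + j)) (m≤m+n 2 (s x))))

    pb-* : ∀ {c d : X → ℕ} → PB s c → PB s d → PB s (λ x → c x * d x)
    pb-* (k , h) (j , g) = k + j , λ x →
      ≤-trans (*-mono-≤ (h x) (g x)) (≤-reflexive (sym (^-distribˡ-+-* (2 + s x) k j)))

    pb-∘ : ∀ {c d : X → ℕ} → PB s c → PB c d → PB s d
    -- With `y = (2 + s x) ^ k`, which is positive, `2 + c x` is at most `4 * y`, and 4 is at most
    -- the square of the base.
    pb-∘ {c} {d} (k , h) (j , g) = (2 + k) * j , λ x →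
      ≤-trans (g x) (≤-trans (^-monoˡ-≤ j (step₁ x)) (≤-reflexive (^-*-assoc (2 + s x) (2 + k) j)))
      where
        step₁ : ∀ x → 2 + c x ≤ (2 + s x) ^ (2 + k)
        step₁ x = begin
          2 + c x                   ≤⟨ +-monoʳ-≤ 2 (h x) ⟩
          2 + y                     ≤⟨ +-monoˡ-≤ y (*-monoʳ-≤ 2 (m^n>0 (2 + s x) k)) ⟩
          2 * y + y                 ≤⟨ m≤m+n (2 * y + y) y ⟩
          2 * y + y + y             ≡⟨ solve 1 (λ y → con 2 :* y :+ y :+ y := con 2 :* (con 2 :* y)) refl y ⟩
          2 * (2 * y)               ≤⟨ *-mono-≤ (m≤m+n 2 (s x)) (*-monoˡ-≤ y (m≤m+n 2 (s x))) ⟩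
          (2 + s x) ^ (2 + k)       ∎
          where
              open ≤-Reasoning
              open +-*-Solver
              y : ℕ
              y = (2 + s x) ^ k

opaque
  pb-reindex : ∀ {X Y : Set} {s c : X → ℕ} (h : Y → X) → PB s c → PB (s ∘ h) (c ∘ h)
  pb-reindex h (k , b) = k , λ y → b (h y)

  pb⇒clock : ∀ {X : Set} {s c : X → ℕ} → PB s c → Σ ℕ λ k → ∀ x → c x ≤ s x ^ k + k
  pb⇒clock {X} {s} {c} (j , h) = k , λ x → ≤-trans (h x) (clock (s x))
    where
      k : ℕ
      -- For arguments 0 and 1 the power in the clock does not grow, so the summand `3 ^ j` has to
      -- cover the bound; from 2 on, `2 + n` is at most `n ^ 2`, which accounts for `2 * j`.
      k = 2 * j + 3 ^ j
      clock : ∀ n → (2 + n) ^ j ≤ n ^ k + k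
      clock zero          = ≤-trans (^-monoˡ-≤ j (m≤m+n 2 1)) (≤-trans (m≤n+m (3 ^ j) (2 * j)) (m≤n+m k (0 ^ k)))
      clock (suc zero)    = ≤-trans (m≤n+m (3 ^ j) (2 * j)) (m≤n+m k (1 ^ k))
      clock n@(suc (suc m)) = ≤-trans (≤-trans (^-monoˡ-≤ j sq) (≤-trans (≤-reflexive (^-*-assoc n 2 j)) (^-monoʳ-≤ n (m≤m+n (2 * j) (3 ^ j))))) (m≤m+n (n ^ k) k)
        where sq : 2 + n ≤ n ^ 2
              sq = ≤-trans (+-monoˡ-≤ n (m≤m+n 2 m)) (≤-trans (≤-reflexive (cong (n +_) (sym (+-identityʳ n))))
                     (≤-trans (*-monoˡ-≤ n (m≤m+n 2 m)) (≤-reflexive (cong (n *_) (sym (*-identityʳ n))))))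

  clock⇒pb : ∀ {X : Set} {s : X → ℕ} k → PB s (λ x → s x ^ k + k)
  clock⇒pb {s = s} k = pb-+ (k , λ x → ^-monoˡ-≤ k (m≤n+m (s x) 2)) (pb-const k)

-- Bits are stored as 1 and 2, and 3 closes a word.
bitv : Bool → ℕ
bitv false = 1
bitv true  = 2

bw : Word → List ℕ → List ℕ
bw []      r = r
bw (b ∷ w) r = bitv b ∷ bw w r

wd : Word → List ℕ → List ℕ
wd w r = bw w (3 ∷ r)

wordSt : Word → St
wordSt x = ⟪ [] , [] , wd x [] ⟫

-- Conversion between input or output bits and tape cells

module Compiled (b : ℕ) where
  open Tracks b public

  bitΓ : Bool → Fin A
  bitΓ false = fzero
  bitΓ true  = fsuc fzero

  bitCell : Bool → Cell
  bitCell false = cell fzero fzero (fsuc fzero)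
  bitCell true  = cell fzero fzero (fsuc (fsuc fzero))

  hashCell : Cell
  hashCell = cell fzero fzero (fsuc (fsuc (fsuc fzero)))

  isBit : TTest
  isBit v γ = toℕ γ <ᵇ 2

  toCell : Fin A → Cell
  toCell fzero = bitCell false
  toCell _     = bitCell true

  setup : TProg
  setup = act goL ⨾ act (λ v γ → v , markΓ , mR) ⨾ while isBit (act (λ v γ → v , sym-of (toCell γ) , mR)) ⨾
          act (λ v γ → v , sym-of hashCell , mL) ⨾ goHome

  fromCell : Cell → Fin A
  fromCell c = if toℕ (cM c) ≡ᵇ 1 then bitΓ false else bitΓ true

  onBit : TTest
  onBit v γ = let m = toℕ (cM (cell-of γ)) in (m ≡ᵇ 1) ∨ (m ≡ᵇ 2)

  -- Only the leading bits of the main track are converted back. The blank written behind them stops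
  -- `outBits`, so the cells that remain further right do not show in the output.
  teardown : TProg
  teardown = while onBit (act (λ v γ → v , fromCell (cell-of γ) , mR)) ⨾ act (λ v γ → v , blankΓ , mL) ⨾ goHome

  module _ (l₀ : List (Fin A)) where
    -- Here `e` is what follows the input: nothing on the initial tape of a deterministic machine, a
    -- single blank cell after the guessing phase of a nondeterministic one.
    convert-run : ∀ v e → (∀ L → view v L e ≡ zip v L blankΓ []) → ∀ x ds →
      Run tape (while isBit (act (λ v γ → v , sym-of (toCell γ) , mR)) ⨾ act (λ v γ → v , sym-of hashCell , mL) ⨾ goHome)
        (view v (syms ds ++ markΓ ∷ l₀) (map bitΓ x ++ e)) (home l₀ v (ds ʳ++ (map bitCell x ++ hashCell ∷ [])))
        (4 * length x + 2 * length ds + 4)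
    convert-run v e e≡ [] ds rewrite e≡ (syms ds ++ markΓ ∷ l₀) =
      slack (≤-reflexive (solve 1 (λ n → con 1 :+ (con 1 :+ (con 2 :* n :+ con 2)) := con 2 :* n :+ con 4) refl (length ds)))
        (whF refl ⨾ act≡ (turn ds) ⨾ goHome-run l₀ v ds (hashCell ∷ []))
      where
        open +-*-Solver
        turn : ∀ ds → move mL v (syms ds ++ markΓ ∷ l₀) (sym-of hashCell) [] ≡ posL l₀ v ds (hashCell ∷ [])
        turn []      = refl
        turn (_ ∷ _) = refl
    convert-run v e e≡ (y ∷ x) ds = slack (≤-reflexive eq) (loop (convert-run v e e≡ x (bitCell y ∷ ds)))
      where
        open +-*-Solver
        eq : 2 + (4 * length x + 2 * suc (length ds) + 4) ≡ 4 * suc (length x) + 2 * length ds + 4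
        eq = solve 2 (λ m n → con 2 :+ (con 4 :* m :+ con 2 :* (con 1 :+ n) :+ con 4) := con 4 :* (con 1 :+ m) :+ con 2 :* n :+ con 4) refl (length x) (length ds)
        bit-ok : ∀ y → (toℕ (bitΓ y) <ᵇ 2) ≡ true
        bit-ok false = refl
        bit-ok true  = refl
        first : ∀ y → texec (λ v γ → v , sym-of (toCell γ) , mR) (view v (syms ds ++ markΓ ∷ l₀) (map bitΓ (y ∷ x) ++ e))
                ≡ view v (syms (bitCell y ∷ ds) ++ markΓ ∷ l₀) (map bitΓ x ++ e)
        first false = refl
        first true  = refl
        loop : ∀ {Q z k} → Run tape (while isBit (act (λ v γ → v , sym-of (toCell γ) , mR)) ⨾ Q) (view v (syms (bitCell y ∷ ds) ++ markΓ ∷ l₀) (map bitΓ x ++ e)) z k →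
               Run tape (while isBit (act (λ v γ → v , sym-of (toCell γ) , mR)) ⨾ Q) (view v (syms ds ++ markΓ ∷ l₀) (map bitΓ (y ∷ x) ++ e)) z (2 + k)
        loop (r ⨾ r') = whT (bit-ok y) (act≡ (first y)) r ⨾ r'
        loop (slack k≤ r) = slack (+-monoʳ-≤ 2 k≤) (loop r)

  setup-run : ∀ v l e → (∀ L → view v L e ≡ zip v L blankΓ []) → ∀ x →
    ∃ λ l₀ → Run tape setup (view v l (map bitΓ x ++ e)) (home l₀ v (map bitCell x ++ hashCell ∷ [])) (4 * length x + 6)
  setup-run v l e e≡ x = l₀ l ,
    slack (≤-reflexive (solve 1 (λ m → con 2 :+ (con 4 :* m :+ con 0 :+ con 4) := con 4 :* m :+ con 6) refl (length x)))
      (act ⨾ act≡ (to-mark l (map bitΓ x ++ e)) ⨾ convert-run (l₀ l) v e e≡ x [])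
    where
      open +-*-Solver
      l₀ : List (Fin A) → List (Fin A)
      l₀ []      = []
      l₀ (_ ∷ l) = l
      to-mark : ∀ l xs → texec (λ v γ → v , markΓ , mR) (texec goL (view v l xs)) ≡ view v (markΓ ∷ l₀ l) xs
      to-mark []      []       = refl
      to-mark []      (_ ∷ _)  = refl
      to-mark (_ ∷ _) []       = refl
      to-mark (_ ∷ _) (_ ∷ _)  = refl

  setup-rep : ∀ x l₀ → Rep l₀ (map bitCell x ++ hashCell ∷ []) (wordSt x)
  setup-rep x l₀ .rep-at iA i = trans (cong (λ t → at t i) (zeros-A x)) (at-pad₀ (suc (length x)) i)
    where zeros-A : ∀ x → track iA (map bitCell x ++ hashCell ∷ []) ≡ replicate (suc (length x)) 0
          zeros-A []          = refl
          zeros-A (false ∷ x) = cong (0 ∷_) (zeros-A x)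
          zeros-A (true ∷ x)  = cong (0 ∷_) (zeros-A x)
  setup-rep x l₀ .rep-at iB i = trans (cong (λ t → at t i) (zeros-B x)) (at-pad₀ (suc (length x)) i)
    where zeros-B : ∀ x → track iB (map bitCell x ++ hashCell ∷ []) ≡ replicate (suc (length x)) 0
          zeros-B []          = refl
          zeros-B (false ∷ x) = cong (0 ∷_) (zeros-B x)
          zeros-B (true ∷ x)  = cong (0 ∷_) (zeros-B x)
  setup-rep x l₀ .rep-at iM i = cong (λ t → at t i) (word-M x)
    where word-M : ∀ x → track iM (map bitCell x ++ hashCell ∷ []) ≡ wd x []
          word-M []          = refl
          word-M (false ∷ x) = cong (1 ∷_) (word-M x)
          word-M (true ∷ x)  = cong (2 ∷_) (word-M x)

  module _ (l₀ : List (Fin A)) where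
    posL' : Fin B → List Bool → List (Fin A) → Zip
    posL' v []       R = zip v l₀ markΓ R
    posL' v (d ∷ ds) R = zip v (map bitΓ ds ++ markΓ ∷ l₀) (bitΓ d) R

    goHome-bits : ∀ v ds R → Run tape goHome (posL' v ds R) (view v (markΓ ∷ l₀) (map bitΓ ds ʳ++ R)) (2 * length ds + 2)
    goHome-bits v []       R = whF refl ⨾ act
    goHome-bits v (d ∷ ds) R =
      slack (≤-reflexive (solve 1 (λ n → con 2 :+ (con 2 :* n :+ con 2) := con 2 :* (con 1 :+ n) :+ con 2) refl (length ds)))
        (loop (goHome-bits v ds (bitΓ d ∷ R)))
      where
        open +-*-Solver
        first : ∀ ds → texec goL (posL' v (d ∷ ds) R) ≡ posL' v ds (bitΓ d ∷ R)
        first []      = refl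
        first (_ ∷ _) = refl
        not-mark : ∀ d → notMark v (bitΓ d) ≡ true
        not-mark false = refl
        not-mark true  = refl
        loop : ∀ {z k} → Run tape goHome (posL' v ds (bitΓ d ∷ R)) z k → Run tape goHome (posL' v (d ∷ ds) R) z (2 + k)
        loop (r ⨾ r') = whT (not-mark d) (act≡ (first ds)) r ⨾ r'
        loop (slack k≤ r) = slack (+-monoʳ-≤ 2 k≤) (loop r)

    teardown-run : ∀ v m y ds cs → (∀ i → at (track iM cs) i ≡ at (wd y m) i) → ∃ λ R →
      Run tape teardown (view v (map bitΓ ds ++ markΓ ∷ l₀) (syms cs))
        (view v (markΓ ∷ l₀) (map bitΓ ds ʳ++ (map bitΓ y ++ blankΓ ∷ R))) (4 * length y + 2 * length ds + 4)
    teardown-run v m []      ds []       h = contradiction (h 0) (λ ())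
    teardown-run v m []      ds (c ∷ cs) h = syms cs ,
      slack (≤-reflexive (solve 1 (λ n → con 1 :+ (con 1 :+ (con 2 :* n :+ con 2)) := con 2 :* n :+ con 4) refl (length ds)))
        (whF (trans (cong (λ c' → (toℕ (cM c') ≡ᵇ 1) ∨ (toℕ (cM c') ≡ᵇ 2)) (cell-sym c))
                    (cong (λ n → (n ≡ᵇ 1) ∨ (n ≡ᵇ 2)) (h 0))) ⨾
         act≡ (turn ds) ⨾ goHome-bits v ds (blankΓ ∷ syms cs))
      where
        open +-*-Solver
        turn : ∀ ds → move mL v (map bitΓ ds ++ markΓ ∷ l₀) blankΓ (syms cs) ≡ posL' v ds (blankΓ ∷ syms cs)
        turn []      = refl
        turn (_ ∷ _) = refl
    teardown-run v m (y ∷ ys) ds []       h = contradiction (h 0) (bit≢0 y)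
      where bit≢0 : ∀ y → ¬ (0 ≡ bitv y)
            bit≢0 false ()
            bit≢0 true  ()
    teardown-run v m (y ∷ ys) ds (c ∷ cs) h with teardown-run v m ys (y ∷ ds) cs (λ i → h (suc i))
    ... | R , r = R , slack (≤-reflexive eq) (loop r)
      where
        open +-*-Solver
        eq : 2 + (4 * length ys + 2 * suc (length ds) + 4) ≡ 4 * suc (length ys) + 2 * length ds + 4
        eq = solve 2 (λ m n → con 2 :+ (con 4 :* m :+ con 2 :* (con 1 :+ n) :+ con 4) := con 4 :* (con 1 :+ m) :+ con 2 :* n :+ con 4) refl (length ys) (length ds)
        is-bit : ∀ y → (bitv y ≡ᵇ 1) ∨ (bitv y ≡ᵇ 2) ≡ true
        is-bit false = refl
        is-bit true  = refl
        back-bit : ∀ y → (if bitv y ≡ᵇ 1 then bitΓ false else bitΓ true) ≡ bitΓ y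
        back-bit false = refl
        back-bit true  = refl
        main≡ : toℕ (cM (cell-of (sym-of c))) ≡ bitv y
        main≡ = trans (cong (λ c' → toℕ (cM c')) (cell-sym c)) (h 0)
        first : texec (λ v γ → v , fromCell (cell-of γ) , mR) (view v (map bitΓ ds ++ markΓ ∷ l₀) (syms (c ∷ cs)))
                ≡ view v (map bitΓ (y ∷ ds) ++ markΓ ∷ l₀) (syms cs)
        first = cong (λ γ → view v (γ ∷ map bitΓ ds ++ markΓ ∷ l₀) (syms cs))
                  (trans (cong (λ n → if n ≡ᵇ 1 then bitΓ false else bitΓ true) main≡) (back-bit y))
        loop : ∀ {Q z k} → Run tape (while onBit (act (λ v γ → v , fromCell (cell-of γ) , mR)) ⨾ Q) (view v (map bitΓ (y ∷ ds) ++ markΓ ∷ l₀) (syms cs)) z k →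
               Run tape (while onBit (act (λ v γ → v , fromCell (cell-of γ) , mR)) ⨾ Q) (view v (map bitΓ ds ++ markΓ ∷ l₀) (syms (c ∷ cs))) z (2 + k)
        loop (r ⨾ r') = whT (trans (cong (λ n → (n ≡ᵇ 1) ∨ (n ≡ᵇ 2)) main≡) (is-bit y)) (act≡ first) r ⨾ r'
        loop (slack k≤ r) = slack (+-monoʳ-≤ 2 k≤) (loop r)

  toℕ-bitΓ : ∀ x → map toℕ (map bitΓ x) ≡ map bitSym x
  toℕ-bitΓ []          = refl
  toℕ-bitΓ (false ∷ x) = cong (0 ∷_) (toℕ-bitΓ x)
  toℕ-bitΓ (true ∷ x)  = cong (1 ∷_) (toℕ-bitΓ x)

  outBits-tape : ∀ y R → outBits (map toℕ (map bitΓ y ++ blankΓ ∷ R)) ≡ y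
  outBits-tape []          R = refl
  outBits-tape (false ∷ y) R = cong (false ∷_) (outBits-tape y R)
  outBits-tape (true ∷ y)  R = cong (true ∷_) (outBits-tape y R)

-- From stack programs to deterministic and nondeterministic machines

stepD-successors : ∀ M c → (successors M c ≡ [] × stepD M c ≡ nothing) ⊎
                           ∃₂ λ c' cs → successors M c ≡ c' ∷ cs × stepD M c ≡ just c'
stepD-successors []      c = inj₁ (refl , refl)
stepD-successors (r ∷ M) c with matches r c
... | true  = inj₂ (_ , _ , refl , refl)
... | false = stepD-successors M c

reach-runD : ∀ {M k m c c'} → Reach M k c c' → successors M c' ≡ [] → k ≤ m →
             runD M m c ≡ c' × stepD M c' ≡ nothing
reach-runD {M} {k} {m} {c} {c'} r halt k≤m = run r k≤m , stuck
  where
    stuck : stepD M c' ≡ nothing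
    stuck with stepD-successors M c'
    ... | inj₁ (_ , e) = e
    ... | inj₂ (_ , _ , e , _) = contradiction (trans (sym halt) e) (λ ())
    stay : ∀ m → runD M m c' ≡ c'
    stay zero = refl
    stay (suc m) rewrite stuck = refl
    run : ∀ {k m c} → Reach M k c c' → k ≤ m → runD M m c ≡ c'
    run {m = m} done _ = stay m
    run {m = suc m} {c} (step _ e r) (s≤s k≤m) with stepD-successors M c
    ... | inj₁ (e' , _) = contradiction (trans (sym e) e') (λ ())
    ... | inj₂ (_ , _ , e' , e'') rewrite e'' with trans (sym e) e'
    ...   | refl = run r k≤m

module Pipeline (P : SProg) where
  open Compiled (maxLit P) public

  opaque
    translate-run : ∀ {s x n} → Run stack P (wordSt x) s n → ∀ v l₀ → ∃₂ λ v' cs' → Rep l₀ cs' s ×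
      Run tape (translate P) (home l₀ v (map bitCell x ++ hashCell ∷ [])) (home l₀ v' cs') (n * (4 * (suc (length x) + n) + 10))
    translate-run {s} {x} {n} r v l₀ =
      let v' , cs' , rep , _ , t = translate-sim l₀ r (m≤n+m _ 3) (setup-rep x l₀)
                                     (≤-reflexive (cong (_+ n) (trans (length-++ (map bitCell x)) (trans (+-comm _ 1) (cong suc (length-map bitCell x)))))) v
      in v' , cs' , rep , t

startCost : ℕ → ℕ → ℕ
startCost x n = (4 * x + 6) + n * (4 * (suc x + n) + 10)

-- The summands follow an accepting path: scanning the input, guessing, one step to stop, walking
-- back over all cells, the compiled program, and the step that announces the verdict.
pathCost : ℕ → ℕ → ℕ → ℕ → ℕ → ℕ
pathCost z u w x n = z + (u + (suc (suc w + (startCost x n + 1 + 0))))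

module _ (P : SProg) (f : Word → Word) (t : Word → ℕ) (pb : PB length t)
         (run : ∀ x → Run stack P (wordSt x) (wordSt (f x)) (t x)) where
  private
    open Pipeline P
    full : TProg
    full = setup ⨾ translate P ⨾ teardown
    Q : ℕ
    Q = progSize full
    Δ : Table
    Δ = compile full 0 Q
    open Sim 0
    opaque
      M : Machine
      M = tableRules Q Δ

      M-realises : Realises M Δ Q
      M-realises = tableRules-realises Q Δ

      M-foreign : ∀ c → (∀ n → n < Q * B → ¬ (skip1 (0 + n) ≡ Config.state c)) → successors M c ≡ []
      M-foreign = successors-foreign Q Δ

    cost : Word → ℕ
    cost x = startCost (length x) (t x) + (4 * length (f x) + 4)

    full-run : ∀ x → ∃₂ λ v l → ∃ λ R →
      Run tape full (view fzero [] (map bitΓ x)) (view v l (map bitΓ (f x) ++ blankΓ ∷ R)) (cost x)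
    full-run x =
      let l₀ , r₁ = setup-run fzero [] [] (λ _ → refl) x
          v , cs , rep , r₂ = translate-run (run x) fzero l₀
          R , r₃ = teardown-run l₀ v [] (f x) [] cs (rep-at rep iM)
      in v , markΓ ∷ l₀ , R ,
         subst (λ n → Run tape full (view fzero [] (map bitΓ x)) (view v (markΓ ∷ l₀) (map bitΓ (f x) ++ blankΓ ∷ R)) n)
           (trans (sym (+-assoc (4 * length x + 6) _ _))
                  (cong (startCost (length x) (t x) +_) (cong (_+ 4) (+-identityʳ (4 * length (f x))))))
           (subst (λ xs → Run tape setup (view fzero [] xs) (home l₀ fzero (map bitCell x ++ hashCell ∷ [])) (4 * length x + 6))
              (++-identityʳ (map bitΓ x)) r₁ ⨾ (r₂ ⨾ r₃))

    start≃ : ∀ x → initial x ≃ (0 , view fzero [] (map bitΓ x))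
    start≃ x = subst₂ (λ q xs → cfg q [] xs ≃ (0 , view fzero [] (map bitΓ x)))
                 (cong skip1 (trans (+-identityʳ (B * 0)) (*-zeroʳ B))) (toℕ-bitΓ x) (go (map bitΓ x))
      where go : ∀ xs → cfg (code 0 fzero) [] (map toℕ xs) ≃ (0 , view fzero [] xs)
            go []       = at-end
            go (_ ∷ xs) = inside

    halts : ∀ {c z} → c ≃ (Q , z) → successors M c ≡ []
    halts {c} {z} c≃ = M-foreign c foreign
      where
        foreign : ∀ n → n < Q * B → ¬ (skip1 (0 + n) ≡ Config.state c)
        foreign n n<QB e = <⇒≱ n<QB (≤-trans (≤-trans (≤-reflexive (*-comm Q B)) (m≤m+n _ _))
                             (≤-reflexive (sym (skip1-inj (trans e (≃-state c≃))))))

    view-output : ∀ {c v l y R} → c ≃ (Q , view v l (map bitΓ y ++ blankΓ ∷ R)) → output c ≡ y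
    view-output {y = []}        {[]} at-end = refl
    view-output {y = []}    {R} inside = refl
    view-output {y = false ∷ y} {R} inside = cong (false ∷_) (outBits-tape y R)
    view-output {y = true ∷ y}  {R} inside = cong (true ∷_) (outBits-tape y R)

    -- The simulated tape starts with one cell per input bit and one for the end mark, gains at most
    -- one cell per unit of time, and finally contains the output.
    f-length : ∀ x → length (f x) ≤ suc (length x) + t x
    f-length x =
      let _ , _ , R , r = full-run x
          v , cs , rep , len , _ = translate-sim [] (run x) (m≤n+m _ 3) (setup-rep x []) ≤-refl fzero
      in ≤-trans (bound (f x) cs (rep-at rep iM))
           (≤-trans len (+-monoˡ-≤ (t x) (≤-reflexive (trans (length-++ (map bitCell x)) (trans (+-comm _ 1) (cong suc (length-map bitCell x)))))))
      where
        bound : ∀ y cs → (∀ i → at (track iM cs) i ≡ at (wd y []) i) → length y ≤ length cs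
        bound []      cs       h = z≤n
        bound (false ∷ y) []   h = contradiction (h 0) (λ ())
        bound (true ∷ y) []    h = contradiction (h 0) (λ ())
        bound (_ ∷ y) (_ ∷ cs) h = s≤s (bound y cs (λ i → h (suc i)))

    startCost-pb : PB length (λ x → startCost (length x) (t x))
    startCost-pb = pb-+ (pb-+ (pb-* (pb-const 4) pb-self) (pb-const 6))
                        (pb-* pb (pb-+ (pb-* (pb-const 4) (pb-+ (pb-+ (pb-const 1) pb-self) pb)) (pb-const 10)))

    cost-pb : PB length cost
    cost-pb = pb-+ startCost-pb (pb-+ (pb-* (pb-const 4) (pb-≤ f-length (pb-+ (pb-+ (pb-const 1) pb-self) pb))) (pb-const 4))

    opaque
      clock : Σ ℕ λ k → ∀ x → cost x ≤ length x ^ k + k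
      clock = pb⇒clock cost-pb

    full-reach : ∀ x → ∃₂ λ v l → ∃₂ λ R c' → Reach M (cost x) (initial x) c' × c' ≃ (Q , view v l (map bitΓ (f x) ++ blankΓ ∷ R))
    full-reach x =
      let v , l , R , r = full-run x
          c' , reach , c'≃ = simulate-compiled full Q M-realises ≤-refl r (start≃ x)
      in v , l , R , c' , reach , c'≃

  polyTime-intro : PolyTime f
  polyTime-intro = M , proj₁ clock , λ x →
    let v , l , R , c' , reach , c'≃ = full-reach x
        runs , stuck = reach-runD reach (halts c'≃) (proj₂ clock x)
    in subst (λ c → stepD M c ≡ nothing) (sym runs) stuck , trans (cong output runs) (view-output {v = v} {l} {f x} {R} c'≃)

-- Accepting paths and nondeterministic verification

data AccPath (M : Machine) : ℕ → Config → Set where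
  now  : ∀ {n c} → Config.state c ≡ 1 → AccPath M n c
  next : ∀ {n c c'} → c' ∈ successors M c → AccPath M n c' → AccPath M (suc n) c

accPath-mono : ∀ {M n m c} → n ≤ m → AccPath M n c → AccPath M m c
accPath-mono _         (now e)     = now e
accPath-mono (s≤s n≤m) (next i a) = next i (accPath-mono n≤m a)

mutual
  accPath-sound : ∀ M n c → AccPath M n c → acceptsWithin M n c ≡ true
  accPath-sound M n c (now e) rewrite e = refl
  accPath-sound M (suc n) c (next i a) with Config.state c ≡ᵇ 1
  ... | true  = refl
  ... | false = anySucc-sound M n i a

  anySucc-sound : ∀ M n {cs c'} → c' ∈ cs → AccPath M n c' → anySucc M (suc n) cs ≡ true
  anySucc-sound M n {c ∷ cs} (here refl) a rewrite accPath-sound M n c a = refl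
  anySucc-sound M n {c ∷ cs} (there i)   a with acceptsWithin M n c
  ... | true  = refl
  ... | false = anySucc-sound M n i a

mutual
  accPath-complete : ∀ M n c → acceptsWithin M n c ≡ true → AccPath M n c
  accPath-complete M n c e with Config.state c ≡ᵇ 1 in eq
  ... | true = now (≡ᵇ-sound (Config.state c) 1 eq)
  accPath-complete M zero    c () | false
  accPath-complete M (suc n) c e | false = let c' , i , a = anySucc-complete M n _ e in next i a

  anySucc-complete : ∀ M n cs → anySucc M (suc n) cs ≡ true → ∃ λ c' → c' ∈ cs × AccPath M n c'
  anySucc-complete M n (c ∷ cs) e with acceptsWithin M n c in eq
  ... | true  = c , here refl , accPath-complete M n c eq
  ... | false = let c' , i , a = anySucc-complete M n cs e in c' , there i , a

Rejects : Machine → Config → Set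
Rejects M c = ∀ n → ¬ AccPath M n c

reach-accPath : ∀ {M k n c c'} → Reach M k c c' → AccPath M n c' → AccPath M (k + n) c
reach-accPath {k = k} {n} done a = accPath-mono (m≤n+m n k) a
reach-accPath (step _ e r) a = next (subst (_ ∈_) (sym e) (here refl)) (reach-accPath r a)

-- An accepting path from `c` has to follow the forced steps of the run, so it would pass through
-- `c'`.
reach-rejects : ∀ {M k c c'} → Reach M k c c' → Rejects M c' → Rejects M c
reach-rejects done rej = rej
reach-rejects (step ≢1 e r) rej n       (now e')   = ≢1 e'
reach-rejects (step ≢1 e r) rej (suc n) (next i a) with subst (_ ∈_) e i
... | here refl = reach-rejects r rej n a

∉[] : ∀ {X : Set} {x : X} → ¬ (x ∈ [])
∉[] ()

∈-three : ∀ {X : Set} {x a b c : X} → x ∈ a ∷ b ∷ c ∷ [] → x ≡ a ⊎ x ≡ b ⊎ x ≡ c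
∈-three (here e)                 = inj₁ e
∈-three (there (here e))         = inj₂ (inj₁ e)
∈-three (there (there (here e))) = inj₂ (inj₂ e)

-- The extra labels K only enlarge the rule table, and with it the index of the machine and its clock.
module Nondet (P : SProg) (h : Word → Bool) (t : Word → ℕ)
  (run : ∀ x → ∃ λ s → Run stack P (wordSt x) s (t x) × (hd (stM s) ≡ᵇ 2) ≡ h x) (K : ℕ) where
  open Pipeline P

  full : TProg
  full = setup ⨾ translate P

  open Sim 2

  opaque
    Q : ℕ
    Q = progSize full + K

    Δ : Table
    Δ = compile full 0 Q

    full-simulate : ∀ {M k c z z'} → Realises M Δ Q → Run tape full z z' k → c ≃ (0 , z) →
                    ∃ λ c' → Reach M k c c' × c' ≃ (Q , z')
    full-simulate realises = simulate-compiled full Q realises (m≤m+n _ K)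

    table : Machine
    table = tableRules Q Δ

    K≤table : K ≤ length table
    K≤table = ≤-trans (m≤n+m K (progSize full)) (tableRules-length Q Δ)

    table-realises : Realises table Δ Q
    table-realises = tableRules-realises Q Δ

    table-miss : ∀ c → (∀ n → n < Q * B → ¬ (skip1 (2 + n) ≡ Config.state c)) → successors table c ≡ []
    table-miss = successors-foreign Q Δ

  -- State 0 runs to the end of the input and appends bits of its choice; state 2 returns to the
  -- left end and enters the compiled program. The guess thus stands directly behind the input, and
  -- on input `z` the program is run on some `z ++ u`.
  guessRules : Machine
  guessRules = rule 0 0 0 0 mR ∷ rule 0 1 0 1 mR ∷ rule 0 2 0 0 mR ∷ rule 0 2 0 1 mR ∷ rule 0 2 2 2 mL ∷
               rule 2 0 2 0 mL ∷ rule 2 1 2 1 mL ∷ rule 2 2 (code 0 fzero) 2 mR ∷ []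

  opaque
    -- This label lies beyond both the table and `finalRules`, so a negative answer leaves the
    -- machine stuck.
    dead : ℕ
    dead = code (suc Q) fzero

    dead≡ : dead ≡ code (suc Q) fzero
    dead≡ = refl

  verdict : Bool → ℕ
  verdict true  = 1
  verdict false = dead

  guess-foreign : ∀ q l r → 3 ≤ q → successors guessRules (cfg q l r) ≡ []
  guess-foreign (suc (suc (suc q))) l r (s≤s (s≤s (s≤s _))) = refl

  final : Fin B × Fin A → Rule
  final (v , γ) = rule (code Q v) (toℕ γ) (verdict (toℕ (cM (cell-of γ)) ≡ᵇ 2)) (toℕ γ) mS

  finalRules : Machine
  finalRules = map final (cartesianProduct (allFin B) (allFin A))

  final-foreign : ∀ c → (∀ v → ¬ (code Q v ≡ Config.state c)) → successors finalRules c ≡ []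
  final-foreign c foreign = successors-miss final c miss (cartesianProduct (allFin B) (allFin A))
    where miss : ∀ k → matches (final k) c ≡ false
          miss (v , γ) rewrite ≡ᵇ-≢ (code Q v) (Config.state c) (foreign v) = refl

  opaque
    N : Machine
    N = guessRules ++ (table ++ finalRules)

    K≤N : K ≤ length N
    K≤N = ≤-trans K≤table (≤-trans (≤-trans (m≤m+n _ (length finalRules)) (≤-reflexive (sym (length-++ table)))) (m≤n+m _ 8))

    N-guess : ∀ c → Config.state c ≤ 2 → successors N c ≡ successors guessRules c
    N-guess c c≤2 = trans (successors-++ guessRules (table ++ finalRules) c) (trans (cong (successors guessRules c ++_)
      (trans (successors-++ (table) finalRules c)
        (cong₂ _++_ (table-miss c (λ n _ → big n)) (final-foreign c (λ v → big (B * Q + toℕ v))))))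
      (++-identityʳ _))
      where big : ∀ n → ¬ (3 + n ≡ Config.state c)
            big n e = <⇒≱ (≤-trans (m≤m+n 3 n) (≤-reflexive e)) c≤2

    N-code : ∀ c → 3 ≤ Config.state c → successors N c ≡ successors (table) c ++ successors finalRules c
    N-code c@(cfg q l r) 3≤q = trans (successors-++ guessRules (table ++ finalRules) c)
      (trans (cong (_++ successors (table ++ finalRules) c) (guess-foreign q l r 3≤q)) (successors-++ (table) finalRules c))

  ≃-3≤ : ∀ {c ℓ z} → c ≃ (ℓ , z) → 3 ≤ Config.state c
  ≃-3≤ c≃ = ≤-trans (s≤s (s≤s (s≤s z≤n))) (≤-reflexive (sym (≃-state c≃)))

  code-≢ : ∀ {ℓ ℓ' v v'} → ℓ < ℓ' → ¬ (code ℓ' v' ≡ code ℓ v)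
  code-≢ {ℓ} {ℓ'} {v} {v'} ℓ<ℓ' e = <⇒≢ (≤-trans lt (m≤m+n (B * ℓ') (toℕ v'))) (sym (+-cancelˡ-≡ 2 _ _ (skip1-inj e)))
    where lt : B * ℓ + toℕ v < B * ℓ'
          lt = ≤-trans (+-monoʳ-< (B * ℓ) (toℕ<n v)) (≤-trans (≤-reflexive (trans (+-comm (B * ℓ) B) (sym (*-suc B ℓ)))) (*-monoʳ-≤ B ℓ<ℓ'))

  table-foreign : ∀ {ℓ v} c → Q ≤ ℓ → Config.state c ≡ code ℓ v → successors (table) c ≡ []
  table-foreign {ℓ} {v} c Q≤ℓ e = table-miss c λ n n<QB e' →
    <⇒≱ n<QB (≤-trans (≤-reflexive (*-comm Q B)) (≤-trans (*-monoʳ-≤ B Q≤ℓ) (≤-trans (m≤m+n (B * ℓ) (toℕ v))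
      (≤-reflexive (sym (+-cancelˡ-≡ 2 _ _ (skip1-inj (trans e' e))))))))

  realises : Realises N Δ Q
  realises {c} ℓ<Q c≃ = trans (N-code c (≃-3≤ c≃))
    (trans (cong₂ _++_ (table-realises ℓ<Q c≃) (final-foreign c (λ v e → code-≢ ℓ<Q (trans e (≃-state c≃))))) refl)

  N-final : ∀ {c z} → c ≃ (Q , z) → successors N c ≡ applyRule (final (Zip.reg z , Zip.head z)) c ∷ []
  N-final {c} {z} c≃ = trans (N-code c (≃-3≤ c≃)) (trans (cong (_++ successors finalRules c) (table-foreign c ≤-refl (≃-state c≃)))
    (successors-hit final c (Zip.reg z , Zip.head z) hit only (cartesianProduct⁺ (allFin⁺ B) (allFin⁺ A))
      (∈-cartesianProduct⁺ (∈-allFin (Zip.reg z)) (∈-allFin (Zip.head z)))))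
    where
      hit : matches (final (Zip.reg z , Zip.head z)) c ≡ true
      hit = cong₂ _∧_ (subst (λ x → (code Q (Zip.reg z) ≡ᵇ x) ≡ true) (sym (≃-state c≃)) (≡ᵇ-refl (code Q (Zip.reg z))))
                      (subst (λ x → (toℕ (Zip.head z) ≡ᵇ x) ≡ true) (sym (≃-head c≃)) (≡ᵇ-refl (toℕ (Zip.head z))))
      only : ∀ k → matches (final k) c ≡ true → k ≡ (Zip.reg z , Zip.head z)
      only (v , γ) e = let (e₁ , e₂) = ∧-true {code Q v ≡ᵇ Config.state c} e in
        cong₂ _,_ (toℕ-injective (+-cancelˡ-≡ (B * Q) _ _ (+-cancelˡ-≡ 2 _ _ (skip1-inj (trans (≡ᵇ-sound (code Q v) (Config.state c) e₁) (≃-state c≃))))))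
                  (toℕ-injective (trans (≡ᵇ-sound (toℕ γ) (headSym (Config.right c)) e₂) (≃-head c≃)))

  start : Word → Config
  start x = cfg (code 0 fzero) (2 ∷ []) (map bitSym x ++ 2 ∷ [])

  start≃ : ∀ x → start x ≃ (0 , view fzero (blankΓ ∷ []) (map bitΓ x ++ blankΓ ∷ []))
  start≃ x = subst (λ xs → cfg (code 0 fzero) (2 ∷ []) xs ≃ (0 , view fzero (blankΓ ∷ []) (map bitΓ x ++ blankΓ ∷ [])))
               (trans (map-++ toℕ (map bitΓ x) (blankΓ ∷ [])) (cong (_++ 2 ∷ []) (toℕ-bitΓ x))) (go (map bitΓ x ++ blankΓ ∷ []))
    where go : ∀ xs → cfg (code 0 fzero) (2 ∷ []) (map toℕ xs) ≃ (0 , view fzero (blankΓ ∷ []) xs)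
          go []       = at-end
          go (_ ∷ xs) = inside

  applied-state : ∀ q a q' b c → Config.state (applyRule (rule q a q' b mS) c) ≡ q'
  applied-state q a q' b (cfg _ _ _) = refl

  conclude : ∀ {c z} → c ≃ (Q , z) → ∃ λ c' → Reach N 1 c c' ×
             Config.state c' ≡ verdict (toℕ (cM (cell-of (Zip.head z))) ≡ᵇ 2)
  conclude {c} {z} c≃ = _ , step {k = 0} (λ e → skip1-≢1 _ (trans (sym (≃-state c≃)) e)) (N-final c≃) done ,
    applied-state (code Q (Zip.reg z)) (toℕ (Zip.head z)) _ (toℕ (Zip.head z)) c

  opaque
    full-run : ∀ x {s} → Run stack P (wordSt x) s (t x) → ∃₂ λ l₀ v → ∃ λ cs → Rep l₀ cs s ×
               Run tape full (view fzero (blankΓ ∷ []) (map bitΓ x ++ blankΓ ∷ [])) (home l₀ v cs) (startCost (length x) (t x))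
    full-run x r =
      let l₀ , r₁ = setup-run fzero (blankΓ ∷ []) (blankΓ ∷ []) (λ _ → refl) x
          v , cs , rep , r₂ = translate-run r fzero l₀
      in l₀ , v , cs , rep , (r₁ ⨾ r₂)

    full-reach : ∀ x {z n} → Run tape full (view fzero (blankΓ ∷ []) (map bitΓ x ++ blankΓ ∷ [])) z n →
                 ∃ λ c → Reach N n (start x) c × c ≃ (Q , z)
    full-reach x r = full-simulate realises r (start≃ x)

    verdict-top : ∀ {l₀ cs s b} v → Rep l₀ cs s → (hd (stM s) ≡ᵇ 2) ≡ b →
                  verdict (toℕ (cM (cell-of (Zip.head (home l₀ v cs)))) ≡ᵇ 2) ≡ verdict b
    verdict-top {l₀} v rep hd≡ = cong verdict (trans (cong (_≡ᵇ 2) (rep-top l₀ rep v iM)) hd≡)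

    finish : ∀ x → ∃ λ c → Reach N (startCost (length x) (t x) + 1) (start x) c × Config.state c ≡ verdict (h x)
    finish x =
      let s , r , hd≡ = run x
          l₀ , v , cs , rep , r₁ = full-run x r
          c' , reach , c'≃ = full-reach x r₁
          c'' , reach' , state≡ = conclude c'≃
      in c'' , reach-trans reach reach' , trans state≡ (verdict-top v rep hd≡)

  accepts-start : ∀ x → h x ≡ true → AccPath N (startCost (length x) (t x) + 1 + 0) (start x)
  accepts-start x hx = let c , r , e = finish x in reach-accPath r (now (trans e (cong verdict hx)))

  dead-foreign : ∀ c → Config.state c ≡ code (suc Q) fzero → ∀ v → ¬ (code Q v ≡ Config.state c)
  dead-foreign c e v e' = code-≢ {Q} {suc Q} {v} {fzero} (n<1+n Q) (sym (trans e' e))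

  3≤code : ∀ ℓ v → 3 ≤ code ℓ v
  3≤code ℓ v = m≤m+n 3 (B * ℓ + toℕ v)

  dead-stuck : ∀ c → Config.state c ≡ dead → successors N c ≡ []
  dead-stuck c e = trans (N-code c (subst (3 ≤_) (sym e') (3≤code (suc Q) fzero)))
    (cong₂ _++_ (table-foreign {suc Q} {fzero} c (n≤1+n Q) e') (final-foreign c (dead-foreign c e')))
    where e' = trans e dead≡

  dead-rejects : ∀ c → Config.state c ≡ dead → Rejects N c
  dead-rejects c e n       (now e')   = skip1-≢1 _ (trans (sym dead≡) (trans (sym e) e'))
  dead-rejects c e (suc n) (next {c' = c'} i a) = ∉[] (subst (c' ∈_) (dead-stuck c e) i)

  rejects-start : ∀ x → h x ≡ false → Rejects N (start x)
  rejects-start x hx = let c , r , e = finish x in reach-rejects r (dead-rejects c (trans e (cong verdict hx)))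

  -- The left part of a tape lists the nearest cell first, so the word already passed appears
  -- reversed; this is the origin of `ʳ++` in the lemmas that follow.
  guessed : Word → Config
  guessed w = cfg 0 (map bitSym w) []

  scan : ∀ z w → Reach N (length z) (cfg 0 (map bitSym w) (map bitSym z)) (guessed (z ʳ++ w))
  scan []          w = done
  scan (false ∷ z) w = step (λ ()) (N-guess _ z≤n) (scan z (false ∷ w))
  scan (true ∷ z)  w = step (λ ()) (N-guess _ z≤n) (scan z (true ∷ w))

  returning : Word → Word → Config
  returning w r = setState 2 (moveHead mL (map bitSym w) (map bitSym r ++ 2 ∷ []))

  return : ∀ w r → Reach N (suc (length w)) (returning w r) (start (w ʳ++ r))
  return []          r = step (λ ()) (N-guess _ ≤-refl) done
  return (false ∷ w) r = step (λ ()) (N-guess _ ≤-refl) (return w (false ∷ r))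
  return (true ∷ w)  r = step (λ ()) (N-guess _ ≤-refl) (return w (true ∷ r))

  successors-guessed : ∀ w → successors N (guessed w) ≡ guessed (false ∷ w) ∷ guessed (true ∷ w) ∷ returning w [] ∷ []
  successors-guessed w = N-guess (guessed w) z≤n

  stop-accepts : ∀ w → h (w ʳ++ []) ≡ true → AccPath N (suc (suc (length w) + (startCost (length (w ʳ++ [])) (t (w ʳ++ [])) + 1 + 0))) (guessed w)
  stop-accepts w hx = next (subst (returning w [] ∈_) (sym (successors-guessed w)) (there (there (here refl))))
    (reach-accPath (return w []) (accepts-start (w ʳ++ []) hx))

  guess-accepts : ∀ u w {n} → AccPath N n (guessed (u ʳ++ w)) → AccPath N (length u + n) (guessed w)
  guess-accepts []          w a = a
  guess-accepts (false ∷ u) w a = next (subst (guessed (false ∷ w) ∈_) (sym (successors-guessed w)) (here refl)) (guess-accepts u (false ∷ w) a)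
  guess-accepts (true ∷ u)  w a = next (subst (guessed (true ∷ w) ∈_) (sym (successors-guessed w)) (there (here refl))) (guess-accepts u (true ∷ w) a)

  guess-rejects : ∀ w → (∀ u → h ((u ʳ++ w) ʳ++ []) ≡ false) → Rejects N (guessed w)
  guess-rejects w all n       (now ())
  guess-rejects w all (suc n) (next {c' = c'} i a) = case ∈-three (subst (c' ∈_) (successors-guessed w) i) of λ where
    (inj₁ refl)        → guess-rejects (false ∷ w) (λ u → all (false ∷ u)) n a
    (inj₂ (inj₁ refl)) → guess-rejects (true ∷ w) (λ u → all (true ∷ u)) n a
    (inj₂ (inj₂ refl)) → reach-rejects (return w []) (rejects-start (w ʳ++ []) (all [])) n a

  unwound : ∀ (z u : Word) → (u ʳ++ (z ʳ++ [])) ʳ++ [] ≡ z ++ u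
  unwound z u = trans (ʳ++-ʳ++-++ u (z ʳ++ []) []) (trans (ʳ++-ʳ++-++ z [] (u ++ [])) (cong (z ++_) (++-identityʳ u)))

  N-rejects : ∀ z → (∀ u → h (z ++ u) ≡ false) → Rejects N (initial z)
  N-rejects z all = reach-rejects (scan z []) (guess-rejects (z ʳ++ []) (λ u → trans (cong h (unwound z u)) (all u)))

  N-time : Word → Word → ℕ
  N-time z u = pathCost (length z) (length u) (length (u ʳ++ (z ʳ++ []))) (length (z ++ u)) (t (z ++ u))

  N-accepts : ∀ z u → h (z ++ u) ≡ true → AccPath N (N-time z u) (initial z)
  N-accepts z u hx = reach-accPath (scan z []) (guess-accepts u (z ʳ++ [])
    (subst (λ x → AccPath N (suc (suc (length (u ʳ++ (z ʳ++ []))) + (startCost (length x) (t x) + 1 + 0))) (guessed (u ʳ++ (z ʳ++ []))))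
      (unwound z u) (stop-accepts (u ʳ++ (z ʳ++ [])) (trans (cong h (unwound z u)) hx))))

module _ (P : SProg) (h : Word → Bool) (t : Word → ℕ)
  (run : ∀ x → ∃ λ s → Run stack P (wordSt x) s (t x) × (hd (stM s) ≡ᵇ 2) ≡ h x) where
  opaque
    verifier-machine : ∀ K → ∃ λ N → K ≤ length N ×
      (∀ z → (∀ u → h (z ++ u) ≡ false) → Rejects N (initial z)) ×
      (∀ z u → h (z ++ u) ≡ true →
         AccPath N (pathCost (length z) (length u) (length (u ʳ++ (z ʳ++ []))) (length (z ++ u)) (t (z ++ u))) (initial z))
    verifier-machine K = N , K≤N , N-rejects , N-accepts
      where open Nondet P h t run K

-- Verifiers as indices of the enumeration

unary : ℕ → Word → Word
unary zero    w = false ∷ w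
unary (suc n) w = true ∷ unary n w

moveCode : Move → ℕ
moveCode mL = 0
moveCode mR = 1
moveCode mS = 2

toMove-moveCode : ∀ m → toMove (moveCode m) ≡ m
toMove-moveCode mL = refl
toMove-moveCode mR = refl
toMove-moveCode mS = refl

encRules : Machine → Word
encRules []                       = []
encRules (rule q a q' b m ∷ rs) = unary q (unary a (unary q' (unary b (unary (moveCode m) (encRules rs)))))

readU-unary : ∀ n w → readU (unary n w) ≡ (n , w)
readU-unary zero    w = refl
readU-unary (suc n) w rewrite readU-unary n w = refl

length-unary : ∀ n w → length (unary n w) ≡ suc n + length w
length-unary zero    w = refl
length-unary (suc n) w = cong suc (length-unary n w)

parse-encRules : ∀ f rs → length rs ≤ f → parseRules f (encRules rs) ≡ rs
parse-encRules zero    []                         _ = refl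
parse-encRules (suc f) []                         _ = refl
parse-encRules (suc f) (rule zero a q' b m ∷ rs) (s≤s le)
  rewrite readU-unary a (unary q' (unary b (unary (moveCode m) (encRules rs))))
        | readU-unary q' (unary b (unary (moveCode m) (encRules rs)))
        | readU-unary b (unary (moveCode m) (encRules rs))
        | readU-unary (moveCode m) (encRules rs) | toMove-moveCode m = cong (_ ∷_) (parse-encRules f rs le)
parse-encRules (suc f) (rule (suc q) a q' b m ∷ rs) (s≤s le)
  rewrite readU-unary q (unary a (unary q' (unary b (unary (moveCode m) (encRules rs)))))
        | readU-unary a (unary q' (unary b (unary (moveCode m) (encRules rs))))
        | readU-unary q' (unary b (unary (moveCode m) (encRules rs)))
        | readU-unary b (unary (moveCode m) (encRules rs))
        | readU-unary (moveCode m) (encRules rs) | toMove-moveCode m = cong (_ ∷_) (parse-encRules f rs le)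

length-encRules : ∀ rs → length rs ≤ length (encRules rs)
length-encRules []                       = z≤n
length-encRules (rule q a q' b m ∷ rs) = ≤-trans (s≤s (length-encRules rs))
  (grow q (≤-trans (n≤1+n _) (grow a (≤-trans (n≤1+n _) (grow q' (≤-trans (n≤1+n _) (grow b (≤-trans (n≤1+n _) (grow (moveCode m) ≤-refl)))))))))
  where
    grow : ∀ n {w k} → k ≤ length w → suc k ≤ length (unary n w)
    grow n {w} {k} k≤ = ≤-trans (s≤s (≤-trans k≤ (m≤n+m _ n))) (≤-reflexive (sym (length-unary n w)))

sucW-length : ∀ w → length (sucW w) ≤ suc (length w)
sucW-length []          = ≤-refl
sucW-length (false ∷ w) = n≤1+n _
sucW-length (true ∷ w)  = s≤s (sucW-length w)

natToWord-length : ∀ n → length (natToWord n) ≤ n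
natToWord-length zero    = z≤n
natToWord-length (suc n) = ≤-trans (sucW-length (natToWord n)) (s≤s (natToWord-length n))

-- Two successors take `false ∷ w` to `false ∷ sucW w`, so one step of the induction on `n` is two
-- steps of counting.
natToWord-double : ∀ n → natToWord (suc (n + n)) ≡ false ∷ natToWord n
natToWord-double zero    = refl
natToWord-double (suc n) = trans (cong (λ k → sucW (sucW (natToWord k))) (+-suc n n))
                             (cong (λ w → sucW (sucW w)) (natToWord-double n))

natToWord-onto : ∀ w → ∃ λ n → natToWord n ≡ w
natToWord-onto []          = 0 , refl
natToWord-onto (false ∷ w) = let n , e = natToWord-onto w in
  suc (n + n) , trans (natToWord-double n) (cong (false ∷_) e)
natToWord-onto (true ∷ w)  = let n , e = natToWord-onto w in
  suc (suc (n + n)) , trans (cong sucW (natToWord-double n)) (cong (true ∷_) e)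

opaque
  -- The index is no smaller than the number of rules: every rule takes at least one bit of the
  -- code, and the word of a number is never longer than that number.
  index : ∀ N → ∃ λ c → decodeMachine c ≡ N × length N ≤ c
  index N = let c , e = natToWord-onto (encRules N) in c ,
    trans (cong (λ w → parseRules (length w) w) e) (parse-encRules _ N (length-encRules N)) ,
    ≤-trans (length-encRules N) (≤-trans (≤-reflexive (cong length (sym e))) (natToWord-length c))

-- The assumption `1 ≤ c` serves the case in which `n` and `k` are both 0, where `0 ^ 0` is 1.
clock-mono : ∀ n {k c} → k ≤ c → 1 ≤ c → n ^ k + k ≤ n ^ c + c
clock-mono zero    {zero}  k≤c 1≤c = ≤-trans 1≤c (m≤n+m _ _)
clock-mono zero    {suc k} k≤c 1≤c = ≤-trans k≤c (m≤n+m _ _)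
clock-mono (suc n) k≤c 1≤c = +-mono-≤ (^-monoʳ-≤ (suc n) k≤c) k≤c

startCost-mono : ∀ {x y m n} → x ≤ y → m ≤ n → startCost x m ≤ startCost y n
startCost-mono x≤y m≤n = +-mono-≤ (+-monoˡ-≤ 6 (*-monoʳ-≤ 4 x≤y))
  (*-mono-≤ m≤n (+-monoˡ-≤ 10 (*-monoʳ-≤ 4 (+-mono-≤ (s≤s x≤y) m≤n))))

pathCost-mono : ∀ {z u u' w w' x x' n n'} → u ≤ u' → w ≤ w' → x ≤ x' → n ≤ n' → pathCost z u w x n ≤ pathCost z u' w' x' n'
pathCost-mono {z} u≤ w≤ x≤ n≤ = +-monoʳ-≤ z (+-mono-≤ u≤ (s≤s (+-mono-≤ (s≤s w≤)
  (+-monoˡ-≤ 0 (+-monoˡ-≤ 1 (startCost-mono x≤ n≤))))))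

module _ (P : SProg) (h : Word → Bool) (t : Word → ℕ) (pb : PB length t)
         (run : ∀ x → ∃ λ s → Run stack P (wordSt x) s (t x) × (hd (stM s) ≡ᵇ 2) ≡ h x) where
  private
    -- The worst case for an input of length `n`: the guess is as long as the input, and the program
    -- runs on a word of length `n + n`.
    bound : ℕ → ℕ
    bound n = pathCost n n (n + n) (n + n) ((2 + (n + n)) ^ proj₁ pb)

    bound-pb : PB {ℕ} id bound
    bound-pb = pb-+ pb-self (pb-+ pb-self (pb-+ (pb-const 1) (pb-+ (pb-+ (pb-const 1) double) (pb-+ (pb-+ sc (pb-const 1)) (pb-const 0)))))
      where
        double : PB {ℕ} id (λ n → n + n)
        double = pb-+ pb-self pb-self
        t-pb : PB {ℕ} id (λ n → (2 + (n + n)) ^ proj₁ pb)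
        t-pb = pb-∘ double (proj₁ pb , λ _ → ≤-refl)
        sc : PB {ℕ} id (λ n → startCost (n + n) ((2 + (n + n)) ^ proj₁ pb))
        sc = pb-+ (pb-+ (pb-* (pb-const 4) double) (pb-const 6))
                  (pb-* t-pb (pb-+ (pb-* (pb-const 4) (pb-+ (pb-+ (pb-const 1) double) t-pb)) (pb-const 10)))

    time : ∀ z u → length u ≤ length z →
           pathCost (length z) (length u) (length (u ʳ++ (z ʳ++ []))) (length (z ++ u)) (t (z ++ u)) ≤ bound (length z)
    time z u u≤z = pathCost-mono {length z} u≤z len₁ len₂ (≤-trans (proj₂ pb (z ++ u)) (^-monoˡ-≤ (proj₁ pb) (+-monoʳ-≤ 2 len₂)))
      where
        len₂ : length (z ++ u) ≤ length z + length z
        len₂ = ≤-trans (≤-reflexive (length-++ z)) (+-monoʳ-≤ (length z) u≤z)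
        len₁ : length (u ʳ++ (z ʳ++ [])) ≤ length z + length z
        len₁ = ≤-trans (≤-reflexive (trans (length-ʳ++ u) (cong (length u +_) (trans (length-ʳ++ z) (+-identityʳ _))))) (+-monoˡ-≤ (length z) u≤z)

    rejects⇒false : ∀ {M} n c → Rejects M c → acceptsWithin M n c ≡ false
    rejects⇒false {M} n c rej with acceptsWithin M n c in e
    ... | false = refl
    ... | true  = ⊥-elim (rej n (accPath-complete M n c e))

    from-machine : ∀ k → (∀ n → bound n ≤ n ^ k + k) → ∀ N → 2 + k ≤ length N →
      (∀ z → (∀ u → h (z ++ u) ≡ false) → Rejects N (initial z)) →
      (∀ z u → h (z ++ u) ≡ true →
         AccPath N (pathCost (length z) (length u) (length (u ʳ++ (z ʳ++ []))) (length (z ++ u)) (t (z ++ u))) (initial z)) →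
      ∀ c → decodeMachine c ≡ N → length N ≤ c → 2 ≤ c ×
      (∀ z → (∀ u → h (z ++ u) ≡ false) → ∀ n → acceptsWithin (decodeMachine c) n (initial z) ≡ false) ×
      (∀ z u → length u ≤ length z → h (z ++ u) ≡ true →
         acceptsWithin (decodeMachine c) ((length z ^ k + k) ⊓ p c (length z)) (initial z) ≡ true)
    from-machine k bound≤ N k≤N rej acc c refl N≤c = ≤-trans (m≤m+n 2 k) 2+k≤c ,
      (λ z all n → rejects⇒false n (initial z) (rej z all)) ,
      (λ z u u≤z hx → accPath-sound N _ (initial z) (accPath-mono
        (≤-trans (time z u u≤z) (≤-trans (bound≤ (length z)) (≤-reflexive (sym (m≤n⇒m⊓n≡m
          (clock-mono (length z) (≤-trans (m≤n+m k 2) 2+k≤c) (≤-trans (s≤s z≤n) 2+k≤c)))))))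
        (acc z u hx)))
      where
        2+k≤c : 2 + k ≤ c
        2+k≤c = ≤-trans k≤N N≤c

  opaque
    verifier-index : ∃₂ λ c k → 2 ≤ c ×
      (∀ z → (∀ u → h (z ++ u) ≡ false) → ∀ n → acceptsWithin (decodeMachine c) n (initial z) ≡ false) ×
      (∀ z u → length u ≤ length z → h (z ++ u) ≡ true →
         acceptsWithin (decodeMachine c) ((length z ^ k + k) ⊓ p c (length z)) (initial z) ≡ true)
    verifier-index =
      let k , bound≤ = pb⇒clock bound-pb
          -- The path length is independent of the number of extra labels, so `k` is known before
          -- the machine is built and can then be taken as that number. The index is thereby at
          -- least `2 + k`: p_c does not cut the run short, and the special indices 0 and 1 are
          -- avoided.
          N , k≤N , rej , acc = verifier-machine P h t run (2 + k)
          c , decode≡ , N≤c = index N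
      in c , k , from-machine k bound≤ N k≤N rej acc c decode≡ N≤c

-- Stack programs on words

isB : ℕ → Bool
isB n = (n ≡ᵇ 1) ∨ (n ≡ᵇ 2)

isB-bitv : ∀ b → isB (bitv b) ≡ true
isB-bitv false = refl
isB-bitv true  = refl

rev : Word → Word
rev w = w ʳ++ []

rev-rev : ∀ w → rev (rev w) ≡ w
rev-rev w = trans (ʳ++-ʳ++-++ w [] []) (++-identityʳ w)

length-rev : ∀ w → length (rev w) ≡ length w
length-rev w = trans (length-ʳ++ w) (+-identityʳ _)

word-loop : ∀ (c : STest) P (σ : Word → Word → St) k → (∀ b w acc → Run stack P (σ (b ∷ w) acc) (σ w (b ∷ acc)) k) →
            (∀ b w acc → Lang.ts stack c (σ (b ∷ w) acc) ≡ true) → (∀ acc → Lang.ts stack c (σ [] acc) ≡ false) →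
            ∀ w acc → Run stack (while c P) (σ w acc) (σ [] (w ʳ++ acc)) (length w * suc k + 1)
word-loop c P σ k body yes' no' []      acc = whF (no' acc)
word-loop c P σ k body yes' no' (b ∷ w) acc =
  slack (≤-reflexive (cong suc (sym (+-assoc k _ 1)))) (whT (yes' b w acc) (body b w acc) (word-loop c P σ k body yes' no' w (b ∷ acc)))

-- The cost is uniform in the remainder `r` of the main stack. A computation can therefore be
-- carried out on top of words that are saved for later.
record PolyRun {X : Set} (sz : X → ℕ) (P : SProg) (σ σ' : X → List ℕ → St) : Set where
  constructor fr
  field
    cost    : X → ℕ
    cost-pb : PB sz cost
    run     : ∀ x r → Run stack P (σ x r) (σ' x r) (cost x)
open PolyRun public

module _ {X : Set} {sz : X → ℕ} where
  infixr 5 _⨾ᶠ_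

  _⨾ᶠ_ : ∀ {P Q σ σ' σ''} → PolyRun sz P σ σ' → PolyRun sz Q σ' σ'' → PolyRun sz (P ⨾ Q) σ σ''
  fr c p r ⨾ᶠ fr c' p' r' = fr (λ x → c x + c' x) (pb-+ p p') (λ x s → r x s ⨾ r' x s)

  fr-act : ∀ {i σ σ'} → (∀ x r → sexec i (σ x r) ≡ σ' x r) → PolyRun sz (act i) σ σ'
  fr-act {i} {σ} e = fr (λ _ → 1) (pb-const 1) (λ x r → subst (λ s → Run stack (act i) (σ x r) s 1) (e x r) act)

  fr-ext : ∀ {P σ σ' τ τ'} → (∀ x r → σ x r ≡ τ x r) → (∀ x r → σ' x r ≡ τ' x r) → PolyRun sz P σ σ' → PolyRun sz P τ τ'
  fr-ext {P} e e' (fr c p run) = fr c p (λ x r → subst₂ (λ s s' → Run stack P s s' (c x)) (e x r) (e' x r) (run x r))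

  fr-loop : ∀ (c : STest) P (σ : X → List ℕ → Word → Word → St) k →
            (∀ x r b w acc → Run stack P (σ x r (b ∷ w) acc) (σ x r w (b ∷ acc)) k) →
            (∀ x r b w acc → Lang.ts stack c (σ x r (b ∷ w) acc) ≡ true) →
            (∀ x r acc → Lang.ts stack c (σ x r [] acc) ≡ false) →
            (w : X → Word) → PB sz (λ x → length (w x)) →
            PolyRun sz (while c P) (λ x r → σ x r (w x) []) (λ x r → σ x r [] (rev (w x)))
  fr-loop c P σ k body yes' no' w pb = fr (λ x → length (w x) * suc k + 1) (pb-+ (pb-* pb (pb-const (suc k))) (pb-const 1))
    (λ x r → word-loop c P (σ x r) k (body x r) (yes' x r) (no' x r) (w x) [])

fr-reindex : ∀ {X Y : Set} {sz sz'} {P σ σ'} (h : Y → X) (ρ : Y → List ℕ → List ℕ) → PB sz' (sz ∘ h) → PolyRun {X} sz P σ σ' →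
             PolyRun {Y} sz' P (λ y r → σ (h y) (ρ y r)) (λ y r → σ' (h y) (ρ y r))
fr-reindex h ρ pb (fr c p run) = fr (c ∘ h) (pb-∘ pb (pb-reindex h p)) (λ y r → run (h y) (ρ y r))

bitA bitB bitM : STest
bitA a b m = isB a
bitB a b m = isB b
bitM a b m = isB m

-- In the names of the moves the source comes first. A move reverses a word, so every word is moved
-- an even number of times. In `pairP` the literals 2 and 1 put the separator 01 in front of the
-- second component before the bits of the first are doubled.
mvMA mvMB mvAM mvBM mvBA mvAMB dupP swapP dropBits dropP clearA pairP : SProg
mvMA  = while bitM (act (push iA (top iM)) ⨾ act (pop iM))
mvMB  = while bitM (act (push iB (top iM)) ⨾ act (pop iM))
mvAM  = while bitA (act (push iM (top iA)) ⨾ act (pop iA))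
mvBM  = while bitB (act (push iM (top iB)) ⨾ act (pop iB))
mvBA  = while bitB (act (push iA (top iB)) ⨾ act (pop iB))
mvAMB = while bitA (act (push iM (top iA)) ⨾ act (push iB (top iA)) ⨾ act (pop iA))
dupP  = mvMA ⨾ mvAMB ⨾ act (push iM (lit 3)) ⨾ mvBA ⨾ mvAM
swapP = mvMA ⨾ act (pop iM) ⨾ mvMB ⨾ mvAM ⨾ act (push iM (lit 3)) ⨾ mvBM
dropBits = while bitM (act (pop iM))
dropP = dropBits ⨾ act (pop iM)
clearA = while bitA (act (pop iA))
pairP = mvMA ⨾ act (pop iM) ⨾ mvMB ⨾ mvAM ⨾ act (push iM (lit 2)) ⨾ act (push iM (lit 1)) ⨾
        while bitB (act (push iM (top iB)) ⨾ act (push iM (top iB)) ⨾ act (pop iB))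

module _ {X : Set} {sz : X → ℕ} (w : X → Word) (pb : PB sz (λ x → length (w x))) where
  private
    pb-rev : PB sz (λ x → length (rev (w x)))
    pb-rev = pb-≤ (λ x → ≤-reflexive (length-rev (w x))) pb

  mvMA-fr : ∀ (b : X → List ℕ) → PolyRun sz mvMA (λ x r → ⟪ [] , b x , wd (w x) r ⟫) (λ x r → ⟪ bw (rev (w x)) [] , b x , 3 ∷ r ⟫)
  mvMA-fr b = fr-loop bitM _ (λ x r v acc → ⟪ bw acc [] , b x , wd v r ⟫) 2
    (λ x r b w acc → act ⨾ act) (λ x r b w acc → isB-bitv b) (λ x r acc → refl) w pb

  mvMB-fr : ∀ (a : X → List ℕ) → PolyRun sz mvMB (λ x r → ⟪ a x , [] , wd (w x) r ⟫) (λ x r → ⟪ a x , bw (rev (w x)) [] , 3 ∷ r ⟫)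
  mvMB-fr a = fr-loop bitM _ (λ x r v acc → ⟪ a x , bw acc [] , wd v r ⟫) 2
    (λ x r b w acc → act ⨾ act) (λ x r b w acc → isB-bitv b) (λ x r acc → refl) w pb

  mvAM-fr : ∀ (b : X → List ℕ) (m : X → List ℕ → List ℕ) → PolyRun sz mvAM (λ x r → ⟪ bw (rev (w x)) [] , b x , m x r ⟫) (λ x r → ⟪ [] , b x , bw (w x) (m x r) ⟫)
  mvAM-fr b m = fr-ext (λ x r → refl) (λ x r → cong (λ v → ⟪ [] , b x , bw v (m x r) ⟫) (rev-rev (w x)))
    (fr-loop bitA _ (λ x r v acc → ⟪ bw v [] , b x , bw acc (m x r) ⟫) 2
      (λ x r b w acc → act ⨾ act) (λ x r b w acc → isB-bitv b) (λ x r acc → refl) (λ x → rev (w x)) pb-rev)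

  mvBM-fr : ∀ (m : X → List ℕ → List ℕ) → PolyRun sz mvBM (λ x r → ⟪ [] , bw (rev (w x)) [] , m x r ⟫) (λ x r → ⟪ [] , [] , bw (w x) (m x r) ⟫)
  mvBM-fr m = fr-ext (λ x r → refl) (λ x r → cong (λ v → ⟪ [] , [] , bw v (m x r) ⟫) (rev-rev (w x)))
    (fr-loop bitB _ (λ x r v acc → ⟪ [] , bw v [] , bw acc (m x r) ⟫) 2
      (λ x r b w acc → act ⨾ act) (λ x r b w acc → isB-bitv b) (λ x r acc → refl) (λ x → rev (w x)) pb-rev)

  mvBA-fr : ∀ (m : X → List ℕ → List ℕ) → PolyRun sz mvBA (λ x r → ⟪ [] , bw (w x) [] , m x r ⟫) (λ x r → ⟪ bw (rev (w x)) [] , [] , m x r ⟫)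
  mvBA-fr m = fr-loop bitB _ (λ x r v acc → ⟪ bw acc [] , bw v [] , m x r ⟫) 2
      (λ x r b w acc → act ⨾ act) (λ x r b w acc → isB-bitv b) (λ x r acc → refl) w pb

  mvAMB-fr : ∀ (m : X → List ℕ → List ℕ) → PolyRun sz mvAMB (λ x r → ⟪ bw (rev (w x)) [] , [] , m x r ⟫) (λ x r → ⟪ [] , bw (w x) [] , bw (w x) (m x r) ⟫)
  mvAMB-fr m = fr-ext (λ x r → refl) (λ x r → cong (λ v → ⟪ [] , bw v [] , bw v (m x r) ⟫) (rev-rev (w x)))
    (fr-loop bitA _ (λ x r v acc → ⟪ bw v [] , bw acc [] , bw acc (m x r) ⟫) 3
      (λ x r b w acc → act ⨾ act ⨾ act) (λ x r b w acc → isB-bitv b) (λ x r acc → refl) (λ x → rev (w x)) pb-rev)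

  dup-fr : PolyRun sz dupP (λ x r → ⟪ [] , [] , wd (w x) r ⟫) (λ x r → ⟪ [] , [] , wd (w x) (wd (w x) r) ⟫)
  dup-fr = mvMA-fr (λ _ → []) ⨾ᶠ mvAMB-fr (λ x r → 3 ∷ r) ⨾ᶠ fr-act (λ x r → refl) ⨾ᶠ
           mvBA-fr (λ x r → 3 ∷ wd (w x) r) ⨾ᶠ mvAM-fr (λ _ → []) (λ x r → 3 ∷ wd (w x) r)

  dropBits-fr : ∀ (a b : X → List ℕ) → PolyRun sz dropBits (λ x r → ⟪ a x , b x , wd (w x) r ⟫) (λ x r → ⟪ a x , b x , 3 ∷ r ⟫)
  dropBits-fr a b = fr-loop bitM _ (λ x r v acc → ⟪ a x , b x , wd v r ⟫) 1
    (λ x r b w acc → act) (λ x r b w acc → isB-bitv b) (λ x r acc → refl) w pb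

  drop-fr : PolyRun sz dropP (λ x r → ⟪ [] , [] , wd (w x) r ⟫) (λ x r → ⟪ [] , [] , r ⟫)
  drop-fr = dropBits-fr (λ _ → []) (λ _ → []) ⨾ᶠ fr-act (λ x r → refl)

  clearA-fr : ∀ (b : X → List ℕ) (m : X → List ℕ → List ℕ) → PolyRun sz clearA (λ x r → ⟪ bw (rev (w x)) [] , b x , m x r ⟫) (λ x r → ⟪ [] , b x , m x r ⟫)
  clearA-fr b m = fr-loop bitA _ (λ x r v acc → ⟪ bw v [] , b x , m x r ⟫) 1
    (λ x r b w acc → act) (λ x r b w acc → isB-bitv b) (λ x r acc → refl) (λ x → rev (w x)) pb-rev

module _ {X : Set} {sz : X → ℕ} (w v : X → Word) (pw : PB sz (λ x → length (w x))) (pv : PB sz (λ x → length (v x))) where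
  swap-fr : PolyRun sz swapP (λ x r → ⟪ [] , [] , wd (w x) (wd (v x) r) ⟫) (λ x r → ⟪ [] , [] , wd (v x) (wd (w x) r) ⟫)
  swap-fr = fr-reindex id (λ x r → wd (v x) r) pb-self (mvMA-fr w pw (λ _ → [])) ⨾ᶠ fr-act (λ x r → refl) ⨾ᶠ
            mvMB-fr v pv (λ x → bw (rev (w x)) []) ⨾ᶠ mvAM-fr w pw (λ x → bw (rev (v x)) []) (λ x r → 3 ∷ r) ⨾ᶠ
            fr-act (λ x r → refl) ⨾ᶠ mvBM-fr v pv (λ x r → 3 ∷ wd (w x) r)

  pair-fr : PolyRun sz pairP (λ x r → ⟪ [] , [] , wd (w x) (wd (v x) r) ⟫) (λ x r → ⟪ [] , [] , wd (encComp (v x) ++ w x) r ⟫)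
  pair-fr = fr-reindex id (λ x r → wd (v x) r) pb-self (mvMA-fr w pw (λ _ → [])) ⨾ᶠ fr-act (λ x r → refl) ⨾ᶠ
            mvMB-fr v pv (λ x → bw (rev (w x)) []) ⨾ᶠ mvAM-fr w pw (λ x → bw (rev (v x)) []) (λ x r → 3 ∷ r) ⨾ᶠ
            fr-act (λ x r → refl) ⨾ᶠ fr-act (λ x r → refl) ⨾ᶠ
            fr-ext (λ x r → refl) (λ x r → cong (λ u → ⟪ [] , [] , wd (encComp u ++ w x) r ⟫) (rev-rev (v x)))
              (fr-loop bitB _ (λ x r u acc → ⟪ [] , bw u [] , wd (encComp acc ++ w x) r ⟫) 3
                (λ x r b w acc → act ⨾ act ⨾ act) (λ x r b w acc → isB-bitv b) (λ x r acc → refl) (λ x → rev (v x))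
                (pb-≤ (λ x → ≤-reflexive (length-rev (v x))) pv))

split : Word → Word × Word
split []          = [] , []
split (_ ∷ [])    = [] , []
split (false ∷ false ∷ w) = false ∷ proj₁ (split w) , proj₂ (split w)
split (true ∷ true ∷ w)   = true ∷ proj₁ (split w) , proj₂ (split w)
split (false ∷ true ∷ w)  = [] , w
split (true ∷ false ∷ w)  = [] , w

split-pair : ∀ u v → split (encComp u ++ v) ≡ (u , v)
split-pair []          v = refl
split-pair (false ∷ u) v rewrite split-pair u v = refl
split-pair (true ∷ u)  v rewrite split-pair u v = refl

split-length : ∀ w → length (proj₁ (split w)) ≤ length w × length (proj₂ (split w)) ≤ length w
split-length []                  = z≤n , z≤n
split-length (_ ∷ [])            = z≤n , z≤n
split-length (false ∷ false ∷ w) = let a , b = split-length w in s≤s (≤-trans a (n≤1+n _)) , ≤-trans b (m≤n+m _ 2)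
split-length (true ∷ true ∷ w)   = let a , b = split-length w in s≤s (≤-trans a (n≤1+n _)) , ≤-trans b (m≤n+m _ 2)
split-length (false ∷ true ∷ w)  = z≤n , m≤n+m _ 2
split-length (true ∷ false ∷ w)  = z≤n , m≤n+m _ 2

-- Stack B holds a flag for having met the separator. A bit goes to A on trial and is taken back if
-- its neighbour differs from it. If the word ends after an unpaired bit, `pop iB` acts on an empty
-- stack and the end mark stays in place.
splitP : SProg
splitP = while (λ a b m → isB m ∧ (b ≡ᵇ 0))
  (act (push iA (top iM)) ⨾ act (pop iM) ⨾
   ifp (λ a b m → a ≡ᵇ m) (act (pop iM))
     (ifp bitM (act (pop iM)) (act (pop iB)) ⨾ act (pop iA) ⨾ act (push iB (lit 1)))) ⨾ act (pop iB)

split-run : ∀ x acc r → Run stack splitP ⟪ bw acc [] , [] , wd x r ⟫ ⟪ bw (proj₁ (split x) ʳ++ acc) [] , [] , wd (proj₂ (split x)) r ⟫ (8 * length x + 2)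
split-run []            acc r = whF refl ⨾ act
split-run (false ∷ [])  acc r = whT refl (act ⨾ act ⨾ ifF refl (ifF refl act ⨾ act ⨾ act)) (whF refl) ⨾ act
split-run (true ∷ [])   acc r = whT refl (act ⨾ act ⨾ ifF refl (ifF refl act ⨾ act ⨾ act)) (whF refl) ⨾ act
split-run (false ∷ true ∷ x)  acc r = slack (≤-trans (m≤m+n 10 8) (≤-trans (m≤n+m 18 (8 * length x)) (≤-reflexive (solve 1 (λ n → con 8 :* n :+ con 18 := con 8 :* (con 2 :+ n) :+ con 2) refl (length x)))))
  (whT refl (act ⨾ act ⨾ ifF refl (ifT refl act ⨾ act ⨾ act)) (whF (bits-and x)) ⨾ act)
  where
    open +-*-Solver
    bits-and : ∀ x → isB (hd (wd x r)) ∧ false ≡ false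
    bits-and []          = refl
    bits-and (false ∷ _) = refl
    bits-and (true ∷ _)  = refl
split-run (true ∷ false ∷ x)  acc r = slack (≤-trans (m≤m+n 10 8) (≤-trans (m≤n+m 18 (8 * length x)) (≤-reflexive (solve 1 (λ n → con 8 :* n :+ con 18 := con 8 :* (con 2 :+ n) :+ con 2) refl (length x)))))
  (whT refl (act ⨾ act ⨾ ifF refl (ifT refl act ⨾ act ⨾ act)) (whF (bits-and x)) ⨾ act)
  where
    open +-*-Solver
    bits-and : ∀ x → isB (hd (wd x r)) ∧ false ≡ false
    bits-and []          = refl
    bits-and (false ∷ _) = refl
    bits-and (true ∷ _)  = refl
split-run (false ∷ false ∷ x) acc r = slack (≤-trans (m≤n+m _ 11) (≤-reflexive (solve 1 (λ n → con 11 :+ (con 5 :+ (con 8 :* n :+ con 2)) := con 8 :* (con 2 :+ n) :+ con 2) refl (length x))))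
  (loop (split-run x (false ∷ acc) r))
  where
    open +-*-Solver
    loop : ∀ {s k} → Run stack splitP ⟪ bw (false ∷ acc) [] , [] , wd x r ⟫ s k → Run stack splitP ⟪ bw acc [] , [] , wd (false ∷ false ∷ x) r ⟫ s (5 + k)
    loop (q ⨾ q') = whT refl (act ⨾ act ⨾ ifT refl act) q ⨾ q'
    loop (slack le q) = slack (+-monoʳ-≤ 5 le) (loop q)
split-run (true ∷ true ∷ x) acc r = slack (≤-trans (m≤n+m _ 11) (≤-reflexive (solve 1 (λ n → con 11 :+ (con 5 :+ (con 8 :* n :+ con 2)) := con 8 :* (con 2 :+ n) :+ con 2) refl (length x))))
  (loop (split-run x (true ∷ acc) r))
  where
    open +-*-Solver
    loop : ∀ {s k} → Run stack splitP ⟪ bw (true ∷ acc) [] , [] , wd x r ⟫ s k → Run stack splitP ⟪ bw acc [] , [] , wd (true ∷ true ∷ x) r ⟫ s (5 + k)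
    loop (q ⨾ q') = whT refl (act ⨾ act ⨾ ifT refl act) q ⨾ q'
    loop (slack le q) = slack (+-monoʳ-≤ 5 le) (loop q)

-- Running time bounds the size of the result

total : St → ℕ
total s = length (stA s) + length (stB s) + length (stM s)

total-act : ∀ i s → total (sexec i s) ≤ total s + 1
total-act (push iA x) s = ≤-reflexive (sym (+-comm _ 1))
total-act (push iB x) s = ≤-reflexive (solve 3 (λ a b m → a :+ (con 1 :+ b) :+ m := a :+ b :+ m :+ con 1) refl (length (stA s)) (length (stB s)) (length (stM s)))
  where open +-*-Solver
total-act (push iM x) s = ≤-reflexive (solve 3 (λ a b m → a :+ b :+ (con 1 :+ m) := a :+ b :+ m :+ con 1) refl (length (stA s)) (length (stB s)) (length (stM s)))
  where open +-*-Solver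
total-act (pop k) s = ≤-trans (shrink k) (m≤m+n (total s) 1)
  where
    tl-≤ : ∀ xs → length (tl xs) ≤ length xs
    tl-≤ []       = z≤n
    tl-≤ (_ ∷ xs) = n≤1+n _
    shrink : ∀ k → total (sexec (pop k) s) ≤ total s
    shrink iA = +-monoˡ-≤ (length (stM s)) (+-monoˡ-≤ (length (stB s)) (tl-≤ (stA s)))
    shrink iB = +-monoˡ-≤ (length (stM s)) (+-monoʳ-≤ (length (stA s)) (tl-≤ (stB s)))
    shrink iM = +-monoʳ-≤ (length (stA s) + length (stB s)) (tl-≤ (stM s))

-- Each instruction creates at most one stack entry. Through `j-size` this makes intermediate
-- results polynomially long, which composition and pairing rely on.
run-total : ∀ {P s s' n} → Run stack P s s' n → total s' ≤ total s + n
run-total (act {i} {s}) = total-act i s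
run-total {s = s} (_⨾_ {n = n} {m} r r') = ≤-trans (run-total r') (≤-trans (+-monoˡ-≤ m (run-total r)) (≤-reflexive (+-assoc (total s) n m)))
run-total {s = s} (ifT _ r) = ≤-trans (run-total r) (+-monoʳ-≤ (total s) (n≤1+n _))
run-total {s = s} (ifF _ r) = ≤-trans (run-total r) (+-monoʳ-≤ (total s) (n≤1+n _))
run-total {s = s} (whF _) = m≤m+n (total s) 1
run-total {s = s} (whT {n = n} {m} _ r r') = ≤-trans (run-total r') (≤-trans (+-monoˡ-≤ m (run-total r))
  (≤-trans (≤-reflexive (+-assoc (total s) n m)) (+-monoʳ-≤ (total s) (n≤1+n _))))
run-total {s = s} (slack le r) = ≤-trans (run-total r) (+-monoʳ-≤ (total s) le)

length-wd : ∀ w r → length (wd w r) ≡ suc (length w + length r)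
length-wd []      r = refl
length-wd (_ ∷ w) r = cong suc (length-wd w r)

-- Polynomial-time computability of typed functions

infixr 6 _⊗_

data Ty : Set where
  tW tN tB tR tC : Ty
  _⊗_ : Ty → Ty → Ty
  tL  : Ty → Ty

⟦_⟧ : Ty → Set
⟦ tW ⟧    = Word
⟦ tN ⟧    = ℕ
⟦ tB ⟧    = Bool
⟦ tR ⟧    = Rule
⟦ tC ⟧    = Config
⟦ σ ⊗ τ ⟧ = ⟦ σ ⟧ × ⟦ τ ⟧
⟦ tL τ ⟧  = List ⟦ τ ⟧

pair : Word → Word → Word
pair u v = encComp u ++ v

-- A list is a chain of pairs that ends in the empty word. A pair is never empty, so `isNull` on the
-- code recognises the empty list.
encL : ∀ {X : Set} → (X → Word) → List X → Word
encL f []       = []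
encL f (a ∷ as) = pair (f a) (encL f as)

-- Numbers are written in unary, as in the tuples, so polynomial size of a code means polynomial
-- value.
enc : ∀ τ → ⟦ τ ⟧ → Word
enc tW w                     = w
enc tN n                     = zeros n
enc tB b                     = if b then true ∷ [] else []
enc tR (rule q a q' b m)     = pair (zeros q) (pair (zeros a) (pair (zeros q') (pair (zeros b) (zeros (moveCode m)))))
enc tC (cfg s l r)           = pair (zeros s) (pair (encL zeros l) (encL zeros r))
enc (σ ⊗ τ) (a , b)          = pair (enc σ a) (enc τ b)
enc (tL τ) as                = encL (enc τ) as

-- This is the symbol that a program sees on top of the main stack, 3 being the end of the word.
first : Word → ℕ
first []      = 3
first (b ∷ _) = bitv b

-- J i τ a: from the word i x the encoding of a x is computable in time polynomial in the length of i x.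
record J {X : Set} (i : X → Word) (τ : Ty) (a : X → ⟦ τ ⟧) : Set where
  constructor mkJ
  field
    prog : SProg
    runs : PolyRun (λ x → length (i x)) prog (λ x r → ⟪ [] , [] , wd (i x) r ⟫) (λ x r → ⟪ [] , [] , wd (enc τ (a x)) r ⟫)
open J public

Poly : ∀ σ τ → (⟦ σ ⟧ → ⟦ τ ⟧) → Set
Poly σ τ f = J (enc σ) τ f

module _ {X : Set} {i : X → Word} where
  private
    sz : X → ℕ
    sz x = length (i x)

  opaque
    j-size : ∀ {τ a} → J i τ a → PB sz (λ x → length (enc τ (a x)))
    j-size {τ} {a} (mkJ P (fr c p run)) = pb-≤ bound (pb-+ (pb-+ (pb-const 1) pb-self) p)
      where
        bound : ∀ x → length (enc τ (a x)) ≤ suc (length (i x)) + c x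
        bound x = begin
          length (enc τ (a x))                                   ≤⟨ n≤1+n _ ⟩
          suc (length (enc τ (a x)))                             ≡⟨ cong suc (sym (+-identityʳ _)) ⟩
          suc (length (enc τ (a x)) + 0)                         ≡⟨ sym (length-wd (enc τ (a x)) []) ⟩
          length (wd (enc τ (a x)) [])                           ≤⟨ run-total (run x []) ⟩
          length (wd (i x) []) + c x                             ≡⟨ cong (_+ c x) (length-wd (i x) []) ⟩
          suc (length (i x) + 0) + c x                           ≡⟨ cong (λ n → suc n + c x) (+-identityʳ _) ⟩
          suc (length (i x)) + c x                               ∎
          where open ≤-Reasoning

  j-cast : ∀ {σ τ a b} → (∀ x → enc σ (a x) ≡ enc τ (b x)) → J i σ a → J i τ b
  j-cast e (mkJ P r) = mkJ P (fr-ext (λ _ _ → refl) (λ x r → cong (λ w → ⟪ [] , [] , wd w r ⟫) (e x)) r)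

  j-ext : ∀ {τ a b} → (∀ x → a x ≡ b x) → J i τ a → J i τ b
  j-ext {τ} e = j-cast {τ} {τ} (λ x → cong (enc τ) (e x))

  j-input : ∀ {τ a} → (∀ x → i x ≡ enc τ (a x)) → J i τ a
  -- Popping the empty stack A is the program that does nothing.
  j-input e = mkJ (act (pop iA)) (fr-act (λ x r → cong (λ w → ⟪ [] , [] , wd w r ⟫) (e x)))

  j-app : ∀ {σ τ f a} → Poly σ τ f → J i σ a → J i τ (λ x → f (a x))
  j-app {a = a} (mkJ Q q) j@(mkJ P p) = mkJ (P ⨾ Q) (p ⨾ᶠ fr-reindex a (λ _ r → r) (j-size j) q)

  j-pair : ∀ {σ τ a b} → J i σ a → J i τ b → J i (σ ⊗ τ) (λ x → a x , b x)
  j-pair {σ} {τ} {a} {b} j@(mkJ P p) k@(mkJ Q q) = mkJ (dupP ⨾ P ⨾ swapP ⨾ Q ⨾ pairP)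
    (dup-fr i pb-self ⨾ᶠ fr-reindex id (λ x r → wd (i x) r) pb-self p ⨾ᶠ
     swap-fr (λ x → enc σ (a x)) i (j-size j) pb-self ⨾ᶠ
     fr-reindex id (λ x r → wd (enc σ (a x)) r) pb-self q ⨾ᶠ
     pair-fr (λ x → enc τ (b x)) (λ x → enc σ (a x)) (j-size k) (j-size j))

  j-wfst : ∀ {w} → J i tW w → J i tW (λ x → proj₁ (split (w x)))
  j-wfst {w} j@(mkJ P p) = mkJ (P ⨾ splitP ⨾ dropBits ⨾ act (pop iB) ⨾ mvAM) (p ⨾ᶠ
      fr (λ x → 8 * length (w x) + 2) (pb-+ (pb-* (pb-const 8) (j-size j)) (pb-const 2)) (λ x r → split-run (w x) [] r) ⨾ᶠ
      dropBits-fr (λ x → proj₂ (split (w x))) pb₂ (λ x → bw (rev (proj₁ (split (w x)))) []) (λ _ → []) ⨾ᶠ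
      fr-act (λ x r → refl) ⨾ᶠ
      mvAM-fr (λ x → proj₁ (split (w x))) pb₁ (λ _ → []) (λ _ r → 3 ∷ r))
    where
      pb₁ = pb-≤ (λ x → proj₁ (split-length (w x))) (j-size j)
      pb₂ = pb-≤ (λ x → proj₂ (split-length (w x))) (j-size j)

  j-wsnd : ∀ {w} → J i tW w → J i tW (λ x → proj₂ (split (w x)))
  j-wsnd {w} j@(mkJ P p) = mkJ (P ⨾ splitP ⨾ clearA) (p ⨾ᶠ
      fr (λ x → 8 * length (w x) + 2) (pb-+ (pb-* (pb-const 8) (j-size j)) (pb-const 2)) (λ x r → split-run (w x) [] r) ⨾ᶠ
      clearA-fr (λ x → proj₁ (split (w x))) (pb-≤ (λ x → proj₁ (split-length (w x))) (j-size j)) (λ _ → []) (λ x r → wd (proj₂ (split (w x))) r))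

  j-fst : ∀ {σ τ a} → J i (σ ⊗ τ) a → J i σ (λ x → proj₁ (a x))
  j-fst {σ} {τ} {a} j = j-cast {tW} {σ} (λ x → cong proj₁ (split-pair (enc σ (proj₁ (a x))) (enc τ (proj₂ (a x)))))
    (j-wfst (j-cast {σ ⊗ τ} {tW} (λ _ → refl) j))

  j-snd : ∀ {σ τ a} → J i (σ ⊗ τ) a → J i τ (λ x → proj₂ (a x))
  j-snd {σ} {τ} {a} j = j-cast {tW} {τ} (λ x → cong proj₂ (split-pair (enc σ (proj₁ (a x))) (enc τ (proj₂ (a x)))))
    (j-wsnd (j-cast {σ ⊗ τ} {tW} (λ _ → refl) j))

  pushWord : Word → SProg
  pushWord []      = act (pop iA)
  pushWord (b ∷ w) = pushWord w ⨾ act (push iM (lit (bitv b)))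

  pushWord-run : ∀ w r → Run stack (pushWord w) ⟪ [] , [] , 3 ∷ r ⟫ ⟪ [] , [] , wd w r ⟫ (length w + 1)
  pushWord-run []      r = act
  pushWord-run (b ∷ w) r = slack (≤-reflexive (+-comm (length w + 1) 1)) (pushWord-run w r ⨾ act)

  j-const : ∀ τ (c : ⟦ τ ⟧) → J i τ (λ _ → c)
  j-const τ c = mkJ (dropBits ⨾ pushWord (enc τ c)) (dropBits-fr i pb-self (λ _ → []) (λ _ → []) ⨾ᶠ
    fr (λ _ → length (enc τ c) + 1) (pb-const _) (λ x r → pushWord-run (enc τ c) r))

  j-cons : ∀ b {w} → J i tW w → J i tW (λ x → b ∷ w x)
  j-cons b (mkJ P p) = mkJ (P ⨾ act (push iM (lit (bitv b)))) (p ⨾ᶠ fr-act (λ x r → refl))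

  j-tail : ∀ {w} → J i tW w → J i tW (λ x → drop 1 (w x))
  j-tail {w} (mkJ P p) = mkJ (P ⨾ ifp bitM (act (pop iM)) (act (pop iA))) (p ⨾ᶠ fr (λ _ → 2) (pb-const 2) (λ x r → go (w x) r))
    where
      go : ∀ w r → Run stack (ifp bitM (act (pop iM)) (act (pop iA))) ⟪ [] , [] , wd w r ⟫ ⟪ [] , [] , wd (drop 1 w) r ⟫ 2
      go []          r = ifF refl act
      go (false ∷ w) r = ifT refl act
      go (true ∷ w)  r = ifT refl act

  j-first : ∀ (c : ℕ → Bool) {w} → J i tW w → J i tB (λ x → c (first (w x)))
  j-first c {w} j@(mkJ P p) = mkJ (P ⨾ Q) (p ⨾ᶠ fr (λ x → length (w x) * 2 + 3)
      (pb-+ (pb-* (j-size j) (pb-const 2)) (pb-const 3)) (λ x r → go (w x) r))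
    where
      Q : SProg
      Q = ifp (λ a b m → c m) (dropBits ⨾ act (push iM (lit 2))) dropBits
      dropped : ∀ w r → Run stack dropBits ⟪ [] , [] , wd w r ⟫ ⟪ [] , [] , 3 ∷ r ⟫ (length w * 2 + 1)
      dropped w r = word-loop bitM (act (pop iM)) (λ v acc → ⟪ [] , [] , wd v r ⟫) 1 (λ _ _ _ → act) (λ b _ _ → isB-bitv b) (λ _ → refl) w []
      first-hd : ∀ w r → first w ≡ hd (wd w r)
      first-hd []      r = refl
      first-hd (_ ∷ _) r = refl
      go : ∀ w r → Run stack Q ⟪ [] , [] , wd w r ⟫ ⟪ [] , [] , wd (enc tB (c (first w))) r ⟫ (length w * 2 + 3)
      go w r with c (first w) in e
      ... | true  = slack (≤-reflexive (solve 1 (λ n → con 1 :+ ((n :+ con 1) :+ con 1) := n :+ con 3) refl (length w * 2)))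
                      (ifT (trans (cong c (sym (first-hd w r))) e) (dropped w r ⨾ act))
        where open +-*-Solver
      ... | false = slack (≤-trans (≤-reflexive (sym (+-suc (length w * 2) 1))) (+-monoʳ-≤ (length w * 2) (m≤m+n 2 1))) (ifF (trans (cong c (sym (first-hd w r))) e) (dropped w r))

  j-cases : ∀ {τ c a} → J i tB c →
            J {Σ X λ x → c x ≡ true} (λ y → i (proj₁ y)) τ (λ y → a (proj₁ y)) →
            J {Σ X λ x → c x ≡ false} (λ y → i (proj₁ y)) τ (λ y → a (proj₁ y)) → J i τ a
  j-cases {τ} {c} {a} j@(mkJ C q) (mkJ P (fr cp (k , p≤) runP)) (mkJ Q (fr cq (l , q≤) runQ)) =
    mkJ (dupP ⨾ C ⨾ ifp (λ a b m → m ≡ᵇ 2) (dropP ⨾ P) (dropP ⨾ Q))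
      (dup-fr i pb-self ⨾ᶠ fr-reindex id (λ x r → wd (i x) r) pb-self q ⨾ᶠ
       fr costs (pb-+ (pb-+ (cost-pb drop₁) (pb-const 1)) (pb-+ (k , λ _ → ≤-refl) (l , λ _ → ≤-refl))) branch)
    where
      drop₁ : PolyRun (λ x → length (i x)) dropP (λ x r → ⟪ [] , [] , wd (enc tB (c x)) r ⟫) (λ x r → ⟪ [] , [] , r ⟫)
      drop₁ = drop-fr (λ x → enc tB (c x)) (j-size j)
      costs : X → ℕ
      -- The costs of the branches are defined only on the inputs that take them, whereas their
      -- polynomial bounds make sense for every `x`; hence the sum of both bounds.
      costs x = (PolyRun.cost drop₁ x + 1) + ((2 + length (i x)) ^ k + (2 + length (i x)) ^ l)
      branch : ∀ x r → Run stack (ifp (λ a b m → m ≡ᵇ 2) (dropP ⨾ P) (dropP ⨾ Q))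
                 ⟪ [] , [] , wd (enc tB (c x)) (wd (i x) r) ⟫ ⟪ [] , [] , wd (enc τ (a x)) r ⟫ (costs x)
      branch x r = go (c x) refl
        where
          dropped : Run stack dropP ⟪ [] , [] , wd (enc tB (c x)) (wd (i x) r) ⟫ ⟪ [] , [] , wd (i x) r ⟫ (PolyRun.cost drop₁ x)
          dropped = run drop₁ x (wd (i x) r)
          go : ∀ b → c x ≡ b → Run stack (ifp (λ a b m → m ≡ᵇ 2) (dropP ⨾ P) (dropP ⨾ Q))
                 ⟪ [] , [] , wd (enc tB (c x)) (wd (i x) r) ⟫ ⟪ [] , [] , wd (enc τ (a x)) r ⟫ (costs x)
          go true  e = slack (≤-trans (≤-reflexive (cong (_+ cp (x , e)) (+-comm 1 (PolyRun.cost drop₁ x))))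
                               (+-monoʳ-≤ (PolyRun.cost drop₁ x + 1) (≤-trans (p≤ (x , e)) (m≤m+n _ _))))
                         (ifT (cong (λ b → hd (wd (enc tB b) (wd (i x) r)) ≡ᵇ 2) e) (dropped ⨾ runP (x , e) r))
          go false e = slack (≤-trans (≤-reflexive (cong (_+ cq (x , e)) (+-comm 1 (PolyRun.cost drop₁ x))))
                               (+-monoʳ-≤ (PolyRun.cost drop₁ x + 1) (≤-trans (q≤ (x , e)) (m≤n+m _ _))))
                         (ifF (cong (λ b → hd (wd (enc tB b) (wd (i x) r)) ≡ᵇ 2) e) (dropped ⨾ runQ (x , e) r))

j-reindex : ∀ {X Y : Set} {i : X → Word} {τ a} (h : Y → X) → J i τ a → J (λ y → i (h y)) τ (λ y → a (h y))
j-reindex h (mkJ P p) = mkJ P (fr-reindex h (λ _ r → r) pb-self p)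

j-if : ∀ {X : Set} {i : X → Word} {τ c a b} → J i tB c → J i τ a → J i τ b → J i τ (λ x → if c x then a x else b x)
j-if {i = i} {τ} {c} {a} {b} C A B = j-cases C
  (j-ext {τ = τ} (λ y → sym (if-true (proj₂ y))) (j-reindex proj₁ A))
  (j-ext {τ = τ} (λ y → sym (if-false (proj₂ y))) (j-reindex proj₁ B))

itr : ∀ {X : Set} → (X → X) → ℕ → X → X
itr f zero    a = a
itr f (suc n) a = itr f n (f a)

-- Iterating a polynomial-time step may double the size in each round. The bound `bnd` on all
-- intermediate values prevents this and has to be supplied for each iteration separately.
j-iter : ∀ {X : Set} {i : X → Word} {σ f w a} (bnd : X → ℕ) → Poly σ σ f → J i tW w → J i σ a → PB (λ x → length (i x)) bnd →
         (∀ x m → m ≤ length (w x) → length (enc σ (itr f m (a x))) ≤ bnd x) →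
         J i σ (λ x → itr f (length (w x)) (a x))
j-iter {X} {i} {σ} {f} {w} {a} bnd (mkJ F q) jw@(mkJ P p) ja@(mkJ P' p') pbnd h =
  mkJ (dupP ⨾ P' ⨾ swapP ⨾ P ⨾ while bitM body ⨾ act (pop iM))
    (dup-fr i pb-self ⨾ᶠ fr-reindex id (λ x r → wd (i x) r) pb-self p' ⨾ᶠ
     swap-fr (λ x → enc σ (a x)) i (j-size ja) pb-self ⨾ᶠ
     fr-reindex id (λ x r → wd (enc σ (a x)) r) pb-self p ⨾ᶠ
     fr (λ x → length (w x) * suc (K x) + 1) (pb-+ (pb-* (j-size jw) (pb-+ (pb-const 1) (k , λ _ → ≤-refl))) (pb-const 1))
        (λ x r → loop x r (w x) (a x) ≤-refl (h x)) ⨾ᶠ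
     fr-act (λ x r → refl))
  where
    body : SProg
    body = act (pop iM) ⨾ swapP ⨾ F ⨾ swapP
    -- The loop states that can occur: the counter bit about to be removed, the rest of the counter,
    -- and the current value, with their size bounds. Over these states the cost of the body is
    -- polynomial in the size of the original input.
    Y : Set
    Y = Σ X λ x → Bool × Σ Word λ v → Σ ⟦ σ ⟧ λ s → length v ≤ length (w x) × length (enc σ s) ≤ bnd x × length (enc σ (f s)) ≤ bnd x
    val : Y → ⟦ σ ⟧
    val (_ , _ , _ , s , _) = s
    cnt : Y → Word
    cnt (_ , _ , v , _) = v
    bit : Y → Bool
    bit (_ , b , _) = b
    szY : Y → ℕ
    szY y = length (i (proj₁ y))
    pcnt : PB szY (λ y → length (cnt y))
    pcnt = pb-≤ (λ (_ , _ , _ , _ , v≤ , _) → v≤) (pb-reindex proj₁ (j-size jw))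
    pval : PB szY (λ y → length (enc σ (val y)))
    pval = pb-≤ (λ (_ , _ , _ , _ , _ , s≤ , _) → s≤) (pb-reindex proj₁ pbnd)
    pval' : PB szY (λ y → length (enc σ (f (val y))))
    pval' = pb-≤ (λ (_ , _ , _ , _ , _ , _ , s≤) → s≤) (pb-reindex proj₁ pbnd)
    body-fr : PolyRun szY body (λ y r → ⟪ [] , [] , bitv (bit y) ∷ wd (cnt y) (wd (enc σ (val y)) r) ⟫)
                          (λ y r → ⟪ [] , [] , wd (cnt y) (wd (enc σ (f (val y))) r) ⟫)
    body-fr = fr-act (λ y r → refl) ⨾ᶠ swap-fr cnt (λ y → enc σ (val y)) pcnt pval ⨾ᶠ
              fr-reindex val (λ y r → wd (cnt y) r) pval q ⨾ᶠ
              swap-fr (λ y → enc σ (f (val y))) cnt pval' pcnt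
    k : ℕ
    k = proj₁ (cost-pb body-fr)
    K : X → ℕ
    K x = (2 + length (i x)) ^ k
    loop : ∀ x r v s → length v ≤ length (w x) → (∀ m → m ≤ length v → length (enc σ (itr f m s)) ≤ bnd x) →
           Run stack (while bitM body) ⟪ [] , [] , wd v (wd (enc σ s) r) ⟫ ⟪ [] , [] , 3 ∷ wd (enc σ (itr f (length v) s)) r ⟫ (length v * suc (K x) + 1)
    loop x r []      s v≤ h = whF refl
    loop x r (b ∷ v) s v≤ h =
      let y = x , b , v , s , ≤-trans (n≤1+n _) v≤ , h 0 z≤n , h 1 (s≤s z≤n)
      in slack (≤-reflexive (cong suc (sym (+-assoc (K x) _ 1))))
           (whT (isB-bitv b) (slack (proj₂ (cost-pb body-fr) y) (run body-fr y r))
             (loop x r v (f s) (≤-trans (n≤1+n _) v≤) (λ m m≤ → h (suc m) (s≤s m≤))))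

-- Tape symbols are stored shifted by one, so that the padding 0 reads as a blank.
dn : ℕ → ℕ
dn zero    = 2
dn (suc s) = s

up : List ℕ → List ℕ
up = map suc

-- The halves of the tape lie on A and B with the cells nearest the head on top, and the state lies
-- on the main stack, so a machine step touches only tops.
emb : Config → List ℕ → St
emb (cfg q l r) m = ⟪ up l , up r , q ∷ m ⟫

matchT : Rule → STest
matchT (rule q a _ _ _) x y m = (q ≡ᵇ m) ∧ (a ≡ᵇ dn y)

matchAny : Machine → STest
matchAny []      x y m = false
matchAny (r ∷ M) x y m = matchT r x y m ∨ matchAny M x y m

-- The literal 3 is the shifted blank. If the head stays, the state entry is replaced by a
-- provisional 0, which `applyP` overwrites next.
moveP : Move → SProg
moveP mS = act (pop iM) ⨾ act (push iM (lit 0))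
moveP mR = act (push iA (top iB)) ⨾ act (pop iB)
moveP mL = ifp (λ a b m → a ≡ᵇ 0) (act (push iB (lit 3))) (act (push iB (top iA)) ⨾ act (pop iA))

applyP : Rule → SProg
applyP (rule q a q' b m) = act (pop iB) ⨾ act (push iB (lit (suc b))) ⨾ moveP m ⨾ act (pop iM) ⨾ act (push iM (lit q'))

dispatch : Machine → SProg
dispatch []      = act (pop iA)
dispatch (r ∷ M) = ifp (matchT r) (applyP r) (dispatch M)

dn-hd : ∀ r → dn (hd (up r)) ≡ headSym r
dn-hd []      = refl
dn-hd (_ ∷ _) = refl

matchT-matches : ∀ r c m → Lang.ts stack (matchT r) (emb c m) ≡ matches r c
matchT-matches (rule q a _ _ _) (cfg s l r) m = cong (λ y → (q ≡ᵇ s) ∧ (a ≡ᵇ y)) (dn-hd r)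

applyP-run : ∀ r c m → Run stack (applyP r) (emb c m) (emb (applyRule r c) m) 7
applyP-run (rule q a q' b mS) (cfg s l [])      m = slack (n≤1+n _) (act ⨾ act ⨾ (act ⨾ act) ⨾ act ⨾ act)
applyP-run (rule q a q' b mS) (cfg s l (x ∷ r)) m = slack (n≤1+n _) (act ⨾ act ⨾ (act ⨾ act) ⨾ act ⨾ act)
applyP-run (rule q a q' b mR) (cfg s l [])      m = slack (n≤1+n _) (act ⨾ act ⨾ (act ⨾ act) ⨾ act ⨾ act)
applyP-run (rule q a q' b mR) (cfg s l (x ∷ r)) m = slack (n≤1+n _) (act ⨾ act ⨾ (act ⨾ act) ⨾ act ⨾ act)
applyP-run (rule q a q' b mL) (cfg s [] [])     m = slack (n≤1+n _) (act ⨾ act ⨾ ifT refl act ⨾ act ⨾ act)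
applyP-run (rule q a q' b mL) (cfg s [] (x ∷ r)) m = slack (n≤1+n _) (act ⨾ act ⨾ ifT refl act ⨾ act ⨾ act)
applyP-run (rule q a q' b mL) (cfg s (y ∷ l) []) m = act ⨾ act ⨾ ifF refl (act ⨾ act) ⨾ act ⨾ act
applyP-run (rule q a q' b mL) (cfg s (y ∷ l) (x ∷ r)) m = act ⨾ act ⨾ ifF refl (act ⨾ act) ⨾ act ⨾ act

dispatch-run : ∀ M c c' m → stepD M c ≡ just c' → Run stack (dispatch M) (emb c m) (emb c' m) (length M + 7)
dispatch-run (r ∷ M) c c' m e with matches r c in eq
dispatch-run (r ∷ M) c c' m refl | true  = slack (s≤s (m≤n+m 7 (length M))) (ifT (trans (matchT-matches r c m) eq) (applyP-run r c m))
dispatch-run (r ∷ M) c c' m e    | false = ifF (trans (matchT-matches r c m) eq) (dispatch-run M c c' m e)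

matchAny-nothing : ∀ M c m → stepD M c ≡ nothing → Lang.ts stack (matchAny M) (emb c m) ≡ false
matchAny-nothing []      c m e = refl
matchAny-nothing (r ∷ M) c m e with matches r c in eq
... | false = cong₂ _∨_ (trans (matchT-matches r c m) eq) (matchAny-nothing M c m e)

matchAny-just : ∀ M c c' m → stepD M c ≡ just c' → Lang.ts stack (matchAny M) (emb c m) ≡ true
matchAny-just (r ∷ M) c c' m e with matches r c in eq
... | true  = cong (_∨ _) (trans (matchT-matches r c m) eq)
... | false = cong₂ _∨_ (trans (matchT-matches r c m) eq) (matchAny-just M c c' m e)

machine-run : ∀ M n c m → stepD M (runD M n c) ≡ nothing →
              Run stack (while (matchAny M) (dispatch M)) (emb c m) (emb (runD M n c) m) (n * (length M + 8) + 1)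
machine-run M zero    c m stuck = whF (matchAny-nothing M c m stuck)
machine-run M (suc n) c m stuck with stepD M c in e
... | nothing = slack (m≤n+m 1 _) (whF (matchAny-nothing M c m stuck))
... | just c' = slack (≤-reflexive (solve 2 (λ a b → con 1 :+ ((a :+ con 7) :+ (b :+ con 1)) := (a :+ con 8) :+ b :+ con 1) refl (length M) (n * (length M + 8))))
    (whT (matchAny-just M c c' m e) (dispatch-run M c c' m e) (machine-run M n c' m stuck))
  where open +-*-Solver

clearA' clearB' mvAB : SProg
clearA' = while (λ a b m → not (a ≡ᵇ 0)) (act (pop iA))
clearB' = while (λ a b m → not (b ≡ᵇ 0)) (act (pop iB))
mvAB    = while bitA (act (push iB (top iA)) ⨾ act (pop iA))

clearA'-run : ∀ l b m → Run stack clearA' ⟪ up l , b , m ⟫ ⟪ [] , b , m ⟫ (length l * 2 + 1)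
clearA'-run []      b m = whF refl
clearA'-run (x ∷ l) b m = whT refl act (clearA'-run l b m)

clearB'-run : ∀ l a m → Run stack clearB' ⟪ a , up l , m ⟫ ⟪ a , [] , m ⟫ (length l * 2 + 1)
clearB'-run []      a m = whF refl
clearB'-run (x ∷ l) a m = whT refl act (clearB'-run l a m)

rest : List ℕ → List ℕ
rest []                = []
rest (0 ∷ r)           = rest r
rest (1 ∷ r)           = rest r
rest (suc (suc s) ∷ r) = suc (suc s) ∷ r

rest-length : ∀ r → length (rest r) ≤ length r
rest-length []                = z≤n
rest-length (0 ∷ r)           = ≤-trans (rest-length r) (n≤1+n _)
rest-length (1 ∷ r)           = ≤-trans (rest-length r) (n≤1+n _)
rest-length (suc (suc s) ∷ r) = ≤-refl

outBits-length : ∀ r → length (outBits r) ≤ length r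
outBits-length []                = z≤n
outBits-length (0 ∷ r)           = s≤s (outBits-length r)
outBits-length (1 ∷ r)           = s≤s (outBits-length r)
outBits-length (suc (suc s) ∷ r) = z≤n

output-run : ∀ r acc m → Run stack mvBA ⟪ bw acc [] , up r , m ⟫ ⟪ bw (outBits r ʳ++ acc) [] , up (rest r) , m ⟫ (length r * 3 + 1)
output-run []                acc m = whF refl
output-run (0 ∷ r)           acc m = whT refl (act ⨾ act) (output-run r (false ∷ acc) m)
output-run (1 ∷ r)           acc m = whT refl (act ⨾ act) (output-run r (true ∷ acc) m)
output-run (suc (suc s) ∷ r) acc m = slack {n = 1} (s≤s z≤n) (whF refl)

-- The shift takes the tape bits 0 and 1 to the word symbols 1 and 2, so input and output pass
-- between tape and word by plain moves.
up-bits : ∀ x → up (map bitSym x) ≡ bw x []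
up-bits []          = refl
up-bits (false ∷ x) = cong (1 ∷_) (up-bits x)
up-bits (true ∷ x)  = cong (2 ∷_) (up-bits x)

module _ {f : Word → Word} (poly : PolyTime f) where
  private
    M : Machine
    M = proj₁ poly
    n : Word → ℕ
    n x = length x ^ proj₁ (proj₂ poly) + proj₁ (proj₂ poly)
    final : Word → Config
    final x = runD M (n x) (initial x)
    sz : Word → ℕ
    sz x = length x
    L R : Word → List ℕ
    L x = Config.left (final x)
    R x = Config.right (final x)

    loopCost : Word → ℕ
    loopCost x = n x * (length M + 8) + 1

    loop-pb : PB sz loopCost
    loop-pb = pb-+ (pb-* (clock⇒pb (proj₁ (proj₂ poly))) (pb-const _)) (pb-const 1)

    loop : PolyRun sz (while (matchAny M) (dispatch M)) (λ x r → emb (initial x) (3 ∷ r)) (λ x r → emb (final x) (3 ∷ r))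
    loop = fr loopCost loop-pb (λ x r → machine-run M (n x) (initial x) (3 ∷ r) (proj₁ (proj₂ (proj₂ poly) x)))

    total-final : ∀ x → length (L x) + length (R x) ≤ (length x + 2) + loopCost x
    total-final x = ≤-trans (≤-trans (≤-reflexive (cong₂ _+_ (sym (length-map suc (L x))) (sym (length-map suc (R x))))) (m≤m+n _ 2))
      (≤-trans (run-total (run loop x [])) (≤-reflexive (cong (λ k → k + 2 + loopCost x) (trans (length-map suc (map bitSym x)) (length-map bitSym x)))))

    both-pb : PB sz (λ x → length (L x) + length (R x))
    both-pb = pb-≤ total-final (pb-+ (pb-+ pb-self (pb-const 2)) loop-pb)
    L-pb : PB sz (λ x → length (L x))
    L-pb = pb-≤ (λ x → m≤m+n _ _) both-pb
    R-pb : PB sz (λ x → length (R x))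
    R-pb = pb-≤ (λ x → m≤n+m (length (R x)) (length (L x))) both-pb

    load-input : PolyRun sz mvAB (λ x r → ⟪ bw (rev x) [] , [] , 3 ∷ r ⟫) (λ x r → ⟪ [] , bw x [] , 3 ∷ r ⟫)
    load-input = fr-ext (λ x r → refl) (λ x r → cong (λ v → ⟪ [] , bw v [] , 3 ∷ r ⟫) (rev-rev x))
      (fr-loop bitA _ (λ x r v acc → ⟪ bw v [] , bw acc [] , 3 ∷ r ⟫) 2
        (λ x r b w acc → act ⨾ act) (λ x r b w acc → isB-bitv b) (λ x r acc → refl) rev
        (pb-≤ (λ x → ≤-reflexive (length-rev x)) pb-self))

    prepared : ∀ x r → sexec (push iM (lit 0)) ⟪ [] , bw x [] , 3 ∷ r ⟫ ≡ emb (initial x) (3 ∷ r)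
    prepared x r = cong (λ b → ⟪ [] , b , 0 ∷ 3 ∷ r ⟫) (sym (up-bits x))

  polyTime-elim : J id tW f
  polyTime-elim = mkJ (mvMA ⨾ mvAB ⨾ act (push iM (lit 0)) ⨾ while (matchAny M) (dispatch M) ⨾ act (pop iM) ⨾ clearA' ⨾ mvBA ⨾ clearB' ⨾ mvAM)
    (mvMA-fr id pb-self (λ _ → []) ⨾ᶠ load-input ⨾ᶠ fr-act prepared ⨾ᶠ loop ⨾ᶠ
     fr-act {σ' = λ x r → ⟪ up (L x) , up (R x) , 3 ∷ r ⟫} (λ x r → refl) ⨾ᶠ
     fr (λ x → length (L x) * 2 + 1) (pb-+ (pb-* L-pb (pb-const 2)) (pb-const 1)) (λ x r → clearA'-run (L x) (up (R x)) (3 ∷ r)) ⨾ᶠ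
     fr (λ x → length (R x) * 3 + 1) (pb-+ (pb-* R-pb (pb-const 3)) (pb-const 1)) (λ x r → output-run (R x) [] (3 ∷ r)) ⨾ᶠ
     fr (λ x → length (rest (R x)) * 2 + 1) (pb-+ (pb-* (pb-≤ (λ x → rest-length (R x)) R-pb) (pb-const 2)) (pb-const 1))
        (λ x r → clearB'-run (rest (R x)) _ (3 ∷ r)) ⨾ᶠ
     fr-ext (λ _ _ → refl) (λ x r → cong (λ w → ⟪ [] , [] , wd w r ⟫) (proj₂ (proj₂ (proj₂ poly) x)))
       (mvAM-fr (λ x → outBits (R x)) (pb-≤ (λ x → outBits-length (R x)) R-pb) (λ _ → []) (λ x r → 3 ∷ r)))

opaque
  poly⇒polyTime : ∀ {f} → J id tW f → PolyTime f
  poly⇒polyTime {f} (mkJ P (fr c pb run)) = polyTime-intro P f c pb (λ x → run x [])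

  polyTime⇒poly : ∀ {f} → PolyTime f → J id tW f
  polyTime⇒poly = polyTime-elim

  poly-verifier : (h : Word × Word → Bool) → J {Word} id tB (λ x → h (split x)) → ∃₂ λ c k → 2 ≤ c ×
      (∀ z → (∀ u → h (split (z ++ u)) ≡ false) → ∀ n → acceptsWithin (decodeMachine c) n (initial z) ≡ false) ×
      (∀ z u → length u ≤ length z → h (split (z ++ u)) ≡ true →
         acceptsWithin (decodeMachine c) ((length z ^ k + k) ⊓ p c (length z)) (initial z) ≡ true)
  poly-verifier h (mkJ P (fr c pb run)) = verifier-index P (λ x → h (split x)) c pb
    (λ x → wordState x , run x [] , answer (h (split x)))
    where
      wordState : Word → St
      wordState x = ⟪ [] , [] , wd (enc tB (h (split x))) [] ⟫
      answer : ∀ b → (hd (wd (enc tB b) []) ≡ᵇ 2) ≡ b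
      answer true  = refl
      answer false = refl

-- Arithmetic, lists and folds

pair-length : ∀ u v → length (pair u v) ≡ 2 * length u + 2 + length v
pair-length u v = trans (length-++ (encComp u)) (cong (_+ length v) (comp u))
  where
    comp : ∀ u → length (encComp u) ≡ 2 * length u + 2
    comp []      = refl
    comp (b ∷ u) = trans (cong (λ k → suc (suc k)) (comp u)) (cong (_+ 2) (sym (*-suc 2 (length u))))

zeros-length : ∀ n → length (zeros n) ≡ n
zeros-length n = length-replicate n

module _ {X : Set} {i : X → Word} where
  private
    sz : X → ℕ
    sz x = length (i x)

  j-word : ∀ {τ a} → J i τ a → J i tW (λ x → enc τ (a x))
  j-word {τ} = j-cast {σ = τ} {τ = tW} (λ _ → refl)

  j-sizeN : ∀ {n} → J i tN n → PB sz n
  j-sizeN {n} j = pb-≤ (λ x → ≤-reflexive (sym (zeros-length (n x)))) (j-size j)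

  j-not : ∀ {b} → J i tB b → J i tB (λ x → not (b x))
  j-not {b} B = j-ext {τ = tB} (λ x → eq (b x)) (j-if B (j-const tB false) (j-const tB true))
    where eq : ∀ b → (if b then false else true) ≡ not b
          eq false = refl
          eq true  = refl

  j-and : ∀ {b c} → J i tB b → J i tB c → J i tB (λ x → b x ∧ c x)
  j-and {b} {c} B C = j-ext {τ = tB} (λ x → eq (b x) (c x)) (j-if B C (j-const tB false))
    where eq : ∀ b c → (if b then c else false) ≡ b ∧ c
          eq false c = refl
          eq true  c = refl

  j-or : ∀ {b c} → J i tB b → J i tB c → J i tB (λ x → b x ∨ c x)
  j-or {b} {c} B C = j-ext {τ = tB} (λ x → eq (b x) (c x)) (j-if B (j-const tB true) C)
    where eq : ∀ b c → (if b then true else c) ≡ b ∨ c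
          eq false c = refl
          eq true  c = refl

  j-iterN : ∀ {σ f n a} (bnd : X → ℕ) → Poly σ σ f → J i tN n → J i σ a → PB sz bnd →
            (∀ x m → m ≤ n x → length (enc σ (itr f m (a x))) ≤ bnd x) → J i σ (λ x → itr f (n x) (a x))
  j-iterN {σ} {f} {n} {a} bnd F N A pb h = j-ext {τ = σ} (λ x → cong (λ k → itr f k (a x)) (zeros-length (n x)))
    (j-iter {w = λ x → zeros (n x)} bnd F (j-word N) A pb (λ x m m≤ → h x m (≤-trans m≤ (≤-reflexive (zeros-length (n x))))))

  j-suc : ∀ {n} → J i tN n → J i tN (λ x → suc (n x))
  j-suc N = j-cast {σ = tW} {τ = tN} (λ _ → refl) (j-cons false (j-word N))

  j-pred : ∀ {n} → J i tN n → J i tN (λ x → pred (n x))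
  j-pred {n} N = j-cast {σ = tW} {τ = tN} (λ x → eq (n x)) (j-tail (j-word N))
    where eq : ∀ n → drop 1 (zeros n) ≡ zeros (pred n)
          eq zero    = refl
          eq (suc n) = refl

  j-isZero : ∀ {n} → J i tN n → J i tB (λ x → n x ≡ᵇ 0)
  j-isZero {n} N = j-ext {τ = tB} (λ x → eq (n x)) (j-first (_≡ᵇ 3) (j-word N))
    where eq : ∀ n → (first (zeros n) ≡ᵇ 3) ≡ (n ≡ᵇ 0)
          eq zero    = refl
          eq (suc n) = refl

itr-suc : ∀ m b → itr suc m b ≡ m + b
itr-suc zero    b = refl
itr-suc (suc m) b = trans (itr-suc m (suc b)) (+-suc m b)

itr-pred : ∀ m a → itr pred m a ≡ a ∸ m
itr-pred zero    a = refl
itr-pred (suc m) a = trans (itr-pred m (pred a)) (trans (cong (_∸ m) (pred≡ a)) (∸-+-assoc a 1 m))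
  where pred≡ : ∀ a → pred a ≡ a ∸ 1
        pred≡ zero    = refl
        pred≡ (suc a) = refl

self : ∀ {τ} → Poly τ τ (λ x → x)
self = j-input (λ _ → refl)

module _ {X : Set} {i : X → Word} where
  private
    sz : X → ℕ
    sz x = length (i x)

  j-add : ∀ {m n} → J i tN m → J i tN n → J i tN (λ x → m x + n x)
  j-add {m} {n} M N = j-ext {τ = tN} (λ x → itr-suc (m x) (n x))
    (j-iterN (λ x → m x + n x) (j-suc self) M N (pb-+ (j-sizeN M) (j-sizeN N))
      (λ x k k≤ → ≤-trans (≤-reflexive (trans (zeros-length (itr suc k (n x))) (itr-suc k (n x)))) (+-monoˡ-≤ (n x) k≤)))

  j-sub : ∀ {m n} → J i tN m → J i tN n → J i tN (λ x → m x ∸ n x)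
  j-sub {m} {n} M N = j-ext {τ = tN} (λ x → itr-pred (n x) (m x))
    (j-iterN m (j-pred self) N M (j-sizeN M)
      (λ x k k≤ → ≤-trans (≤-reflexive (trans (zeros-length (itr pred k (m x))) (itr-pred k (m x)))) (m∸n≤m (m x) k)))

  j-min : ∀ {m n} → J i tN m → J i tN n → J i tN (λ x → m x ⊓ n x)
  j-min {m} {n} M N = j-ext {τ = tN} (λ x → eq (m x) (n x)) (j-sub M (j-sub M N))
    where eq : ∀ m n → m ∸ (m ∸ n) ≡ m ⊓ n
          eq m n with ≤-total m n
          ... | inj₁ m≤n = trans (cong (m ∸_) (m≤n⇒m∸n≡0 m≤n)) (sym (m≤n⇒m⊓n≡m m≤n))
          ... | inj₂ n≤m = trans (m∸[m∸n]≡n n≤m) (sym (m≥n⇒m⊓n≡n n≤m))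

  j-leq : ∀ {m n} → J i tN m → J i tN n → J i tB (λ x → (m x ∸ n x) ≡ᵇ 0)
  j-leq M N = j-isZero (j-sub M N)

  j-eqN : ∀ {m n} → J i tN m → J i tN n → J i tB (λ x → m x ≡ᵇ n x)
  j-eqN {m} {n} M N = j-ext {τ = tB} (λ x → eq (m x) (n x)) (j-isZero (j-add (j-sub M N) (j-sub N M)))
    where eq : ∀ m n → ((m ∸ n) + (n ∸ m) ≡ᵇ 0) ≡ (m ≡ᵇ n)
          eq zero    zero    = refl
          eq zero    (suc n) = refl
          eq (suc m) zero    = refl
          eq (suc m) (suc n) = eq m n

mulStep : ℕ × ℕ → ℕ × ℕ
mulStep (b , acc) = b , b + acc

itr-mulStep : ∀ m b acc → itr mulStep m (b , acc) ≡ (b , m * b + acc)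
itr-mulStep zero    b acc = refl
itr-mulStep (suc m) b acc = trans (itr-mulStep m b (b + acc))
  (cong (b ,_) (solve 3 (λ x b acc → x :+ (b :+ acc) := b :+ x :+ acc) refl (m * b) b acc))
  where open +-*-Solver

module _ {X : Set} {i : X → Word} where
  j-mul : ∀ {m n} → J i tN m → J i tN n → J i tN (λ x → m x * n x)
  j-mul {m} {n} M N = j-ext {τ = tN} (λ x → trans (cong proj₂ (itr-mulStep (m x) (n x) 0)) (+-identityʳ _))
    (j-snd {σ = tN} {τ = tN} (j-iterN {σ = tN ⊗ tN} (λ x → 2 * n x + 2 + (m x * n x + 0))
      (j-pair (j-fst {τ = tN} self) (j-add (j-fst {τ = tN} self) (j-snd {σ = tN} self)))
      M (j-pair N (j-const tN 0))
      (pb-+ (pb-+ (pb-* (pb-const 2) (j-sizeN N)) (pb-const 2)) (pb-+ (pb-* (j-sizeN M) (j-sizeN N)) (pb-const 0)))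
      (λ x k k≤ → ≤-trans (≤-reflexive (trans (cong (λ s → length (enc (tN ⊗ tN) s)) (itr-mulStep k (n x) 0))
          (trans (pair-length (zeros (n x)) (zeros (k * n x + 0))) (cong₂ (λ a b → 2 * a + 2 + b) (zeros-length (n x)) (zeros-length (k * n x + 0))))))
        (+-monoʳ-≤ (2 * n x + 2) (+-monoˡ-≤ 0 (*-monoˡ-≤ (n x) k≤))))))

  j-pow : ∀ {n} k → J i tN n → J i tN (λ x → n x ^ k)
  j-pow zero    N = j-const tN 1
  j-pow (suc k) N = j-mul N (j-pow k N)

isNull isT isF : Word → Bool
isNull w = first w ≡ᵇ 3
isT w    = first w ≡ᵇ 2
isF w    = first w ≡ᵇ 1

drop1-length : ∀ {X : Set} (w : List X) → length (drop 1 w) ≤ length w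
drop1-length []      = z≤n
drop1-length (_ ∷ w) = n≤1+n _

itr-inv : ∀ {A : Set} {f : A → A} (Inv : A → Set) → (∀ a → Inv a → Inv (f a)) → ∀ m a → Inv a → Inv (itr f m a)
itr-inv Inv pres zero    a h = h
itr-inv Inv pres (suc m) a h = itr-inv Inv pres m _ (pres a h)

itr-comm : ∀ {A : Set} (f : A → A) m a → itr f m (f a) ≡ f (itr f m a)
itr-comm f zero    a = refl
itr-comm f (suc m) a = itr-comm f m (f a)

-- Polynomial-time recursion is available as iteration of a step on bounded values, so equality is
-- tested by cancelling equal first bits. A mismatch freezes the pair, which then fails the final
-- test `eqEnd`.
eqStep : Word × Word → Word × Word
eqStep (a , b) = if (isT a ∧ isT b) ∨ (isF a ∧ isF b) then (drop 1 a , drop 1 b) else (a , b)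

eqEnd : Word × Word → Bool
eqEnd (a , b) = isNull a ∧ isNull b

eqW : Word → Word → Bool
eqW a b = eqEnd (itr eqStep (length a) (a , b))

eqStep-reflects : ∀ s → proj₁ (eqStep s) ≡ proj₂ (eqStep s) → proj₁ s ≡ proj₂ s
eqStep-reflects ([]        , [])        e = refl
eqStep-reflects (false ∷ a , false ∷ b) e = cong (false ∷_) e
eqStep-reflects (true ∷ a  , true ∷ b)  e = cong (true ∷_) e

eqW-sound : ∀ a b → eqW a b ≡ true → a ≡ b
eqW-sound a b = go (length a) (a , b)
  where
    go : ∀ m s → eqEnd (itr eqStep m s) ≡ true → proj₁ s ≡ proj₂ s
    go zero    ([]        , []) e = refl
    go zero    ([]        , (false ∷ _)) ()
    go zero    ([]        , (true ∷ _)) ()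
    go zero    ((false ∷ _) , _) ()
    go zero    ((true ∷ _) , _) ()
    go (suc m) s e = eqStep-reflects s (go m (eqStep s) e)

eqW-refl : ∀ a → eqW a a ≡ true
eqW-refl []          = refl
eqW-refl (false ∷ a) = eqW-refl a
eqW-refl (true ∷ a)  = eqW-refl a

pair-mono : ∀ u u' v v' → length u ≤ length u' → length v ≤ length v' → length (pair u v) ≤ length (pair u' v')
pair-mono u u' v v' a b = subst₂ _≤_ (sym (pair-length u v)) (sym (pair-length u' v')) (+-mono-≤ (+-monoˡ-≤ 2 (*-monoʳ-≤ 2 a)) b)

module _ {X : Set} {i : X → Word} where
  private
    sz : X → ℕ
    sz x = length (i x)

  j-isNull : ∀ {w} → J i tW w → J i tB (λ x → isNull (w x))
  j-isNull = j-first (_≡ᵇ 3)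

  j-isT : ∀ {w} → J i tW w → J i tB (λ x → isT (w x))
  j-isT = j-first (_≡ᵇ 2)

  j-isF : ∀ {w} → J i tW w → J i tB (λ x → isF (w x))
  j-isF = j-first (_≡ᵇ 1)

eqStep-poly : Poly (tW ⊗ tW) (tW ⊗ tW) eqStep
eqStep-poly = j-if (j-or (j-and (j-isT a) (j-isT b)) (j-and (j-isF a) (j-isF b))) (j-pair (j-tail a) (j-tail b)) (j-pair a b)
  where
    a : J (enc (tW ⊗ tW)) tW proj₁
    a = j-fst {τ = tW} self
    b : J (enc (tW ⊗ tW)) tW proj₂
    b = j-snd {σ = tW} self

module _ {X : Set} {i : X → Word} where
  j-eqW : ∀ {a b} → J i tW a → J i tW b → J i tB (λ x → eqW (a x) (b x))
  j-eqW {a} {b} A B = j-and (j-isNull (j-fst {τ = tW} end)) (j-isNull (j-snd {σ = tW} end))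
    where
      end : J i (tW ⊗ tW) (λ x → itr eqStep (length (a x)) (a x , b x))
      end = j-iter {σ = tW ⊗ tW} (λ x → length (pair (a x) (b x))) eqStep-poly A (j-pair A B) (j-size (j-pair A B))
        (λ x m _ → let (p₁ , p₂) = itr-inv {f = eqStep} (λ s → length (proj₁ s) ≤ length (a x) × length (proj₂ s) ≤ length (b x))
                                     (λ s (h₁ , h₂) → shrink s h₁ h₂) m (a x , b x) (≤-refl , ≤-refl)
                   in pair-mono (proj₁ (itr eqStep m (a x , b x))) (a x) (proj₂ (itr eqStep m (a x , b x))) (b x) p₁ p₂)
        where
          shrink : ∀ s {m n} → length (proj₁ s) ≤ m → length (proj₂ s) ≤ n → length (proj₁ (eqStep s)) ≤ m × length (proj₂ (eqStep s)) ≤ n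
          shrink (a , b) h₁ h₂ with (isT a ∧ isT b) ∨ (isF a ∧ isF b)
          ... | true  = ≤-trans (drop1-length a) h₁ , ≤-trans (drop1-length b) h₂
          ... | false = h₁ , h₂

  j-length : ∀ {w} → J i tW w → J i tN (λ x → length (w x))
  j-length {w} W = j-ext {τ = tN} (λ x → trans (itr-suc (length (w x)) 0) (+-identityʳ _))
    (j-iter {σ = tN} (λ x → length (w x) + 0) (j-suc self) W (j-const tN 0) (pb-+ (j-size W) (pb-const 0))
      (λ x m m≤ → ≤-trans (≤-reflexive (trans (zeros-length (itr suc m 0)) (itr-suc m 0))) (+-monoˡ-≤ 0 m≤)))

  j-prepend : ∀ {n w} → J i tN n → J i tW w → J i tW (λ x → zeros (n x) ++ w x)
  j-prepend {n} {w} N W = j-ext {τ = tW} (λ x → eq (n x) (w x))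
    (j-iterN {σ = tW} (λ x → n x + length (w x)) (j-cons false self) N W (pb-+ (j-sizeN N) (j-size W))
      (λ x m m≤ → ≤-trans (≤-reflexive (trans (cong length (eq m (w x))) (trans (length-++ (zeros m)) (cong (_+ length (w x)) (zeros-length m))))) (+-monoˡ-≤ (length (w x)) m≤)))
    where
      eq : ∀ m w → itr (false ∷_) m w ≡ zeros m ++ w
      eq zero    w = refl
      eq (suc m) w = trans (itr-comm (false ∷_) m w) (cong (false ∷_) (eq m w))

  j-lnull : ∀ {σ as} → J i (tL σ) as → J i tB (λ x → isNull (encL (enc σ) (as x)))
  j-lnull {σ} A = j-isNull (j-cast {σ = tL σ} {τ = tW} (λ _ → refl) A)

  j-lcons : ∀ {σ a as} → J i σ a → J i (tL σ) as → J i (tL σ) (λ x → a x ∷ as x)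
  j-lcons {σ} A As = j-cast {σ = σ ⊗ tL σ} {τ = tL σ} (λ _ → refl) (j-pair A As)

hdD : ∀ {A : Set} → A → List A → A
hdD d []      = d
hdD d (a ∷ _) = a

isNull-pair : ∀ u v → isNull (pair u v) ≡ false
isNull-pair []          v = refl
isNull-pair (false ∷ u) v = refl
isNull-pair (true ∷ u)  v = refl

module _ {X : Set} {i : X → Word} where
  j-uncons : ∀ {σ as} d → J i (tL σ) as → J i (σ ⊗ tL σ) (λ x → hdD d (as x) , drop 1 (as x))
  j-uncons {σ} {as} d A = j-cases (j-lnull A)
    (j-ext {τ = σ ⊗ tL σ} (λ y → empty (as (proj₁ y)) (proj₂ y)) (j-const (σ ⊗ tL σ) (d , [])))
    (j-cast {σ = tL σ} {τ = σ ⊗ tL σ} (λ y → full (as (proj₁ y)) (proj₂ y)) (j-reindex proj₁ A))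
    where
      empty : ∀ as → isNull (encL (enc σ) as) ≡ true → (d , []) ≡ (hdD d as , drop 1 as)
      empty []       e = refl
      empty (a ∷ as) e = contradiction (trans (sym e) (isNull-pair (enc σ a) (encL (enc σ) as))) (λ ())
      full : ∀ as → isNull (encL (enc σ) as) ≡ false → encL (enc σ) as ≡ pair (enc σ (hdD d as)) (encL (enc σ) (drop 1 as))
      full (a ∷ as) e = refl

  j-lhead : ∀ {σ as} d → J i (tL σ) as → J i σ (λ x → hdD d (as x))
  j-lhead {σ} d A = j-fst {τ = tL σ} (j-uncons d A)

  j-ltail : ∀ {σ as} → ⟦ σ ⟧ → J i (tL σ) as → J i (tL σ) (λ x → drop 1 (as x))
  j-ltail {σ} d A = j-snd {σ = σ} (j-uncons d A)

-- Folds over words and lists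

record Seq (S A : Ty) : Set where
  field
    nul   : ⟦ S ⟧ → Bool
    hed   : ⟦ S ⟧ → ⟦ A ⟧
    tal   : ⟦ S ⟧ → ⟦ S ⟧
    nul-j : Poly S tB nul
    hed-j : Poly S A hed
    tal-j : Poly S S tal
    tal-≤ : ∀ s → length (enc S (tal s)) ≤ length (enc S s)

seqW : Seq tW tB
seqW = record { nul = isNull ; hed = isT ; tal = drop 1 ; nul-j = j-isNull self ; hed-j = j-isT self ; tal-j = j-tail self ; tal-≤ = drop1-length }

ltail-length : ∀ {A : Set} (f : A → Word) as → length (encL f (drop 1 as)) ≤ length (encL f as)
ltail-length f []       = z≤n
ltail-length f (a ∷ as) = ≤-trans (m≤n+m _ _) (≤-reflexive (sym (pair-length (f a) (encL f as))))

seqL : ∀ σ → ⟦ σ ⟧ → Seq (tL σ) σ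
seqL σ d = record
  { nul = λ as → isNull (encL (enc σ) as) ; hed = hdD d ; tal = drop 1
  ; nul-j = j-lnull self ; hed-j = j-lhead d self ; tal-j = j-ltail d self ; tal-≤ = ltail-length (enc σ) }

module _ {S A E R : Ty} (𝒮 : Seq S A) (f : ⟦ E ⟧ × ⟦ A ⟧ × ⟦ R ⟧ → ⟦ R ⟧) where
  open Seq 𝒮
  foldStep : ⟦ S ⟧ × ⟦ E ⟧ × ⟦ R ⟧ → ⟦ S ⟧ × ⟦ E ⟧ × ⟦ R ⟧
  foldStep (s , e , b) = if nul s then (s , e , b) else (tal s , e , f (e , hed s , b))

  foldS : ℕ → ⟦ S ⟧ → ⟦ E ⟧ → ⟦ R ⟧ → ⟦ R ⟧
  foldS n s e b = proj₂ (proj₂ (itr foldStep n (s , e , b)))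

  foldStep-poly : Poly (E ⊗ (A ⊗ R)) R f → Poly (S ⊗ (E ⊗ R)) (S ⊗ (E ⊗ R)) foldStep
  foldStep-poly F = j-if (j-app nul-j s) (j-pair s (j-pair e b)) (j-pair (j-app tal-j s) (j-pair e (j-app F (j-pair e (j-pair (j-app hed-j s) b)))))
    where
      s : J (enc (S ⊗ (E ⊗ R))) S proj₁
      s = j-fst {τ = E ⊗ R} self
      eb : J (enc (S ⊗ (E ⊗ R))) (E ⊗ R) proj₂
      eb = j-snd {σ = S} self
      e : J (enc (S ⊗ (E ⊗ R))) E (λ x → proj₁ (proj₂ x))
      e = j-fst {τ = R} eb
      b : J (enc (S ⊗ (E ⊗ R))) R (λ x → proj₂ (proj₂ x))
      b = j-snd {σ = E} eb

  module _ {X : Set} {i : X → Word} {s : X → ⟦ S ⟧} {e : X → ⟦ E ⟧} {b : X → ⟦ R ⟧} where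
    -- The code of the sequence serves as the counter: it is at least as long as the sequence, and
    -- the step idles once nothing is left. As `Inv` relates the remaining sequence to the
    -- accumulator, growth of the latter can be paid for by the part already consumed.
    j-fold : Poly (E ⊗ (A ⊗ R)) R f → J i S s → J i E e → J i R b → (bnd : X → ℕ) → PB (λ x → length (i x)) bnd →
             (Inv : X → ⟦ S ⟧ → ⟦ R ⟧ → Set) → (∀ x → Inv x (s x) (b x)) →
             (∀ x s b → nul s ≡ false → Inv x s b → Inv x (tal s) (f (e x , hed s , b))) →
             (∀ x s b → Inv x s b → length (enc R b) ≤ bnd x) →
             J i R (λ x → foldS (length (enc S (s x))) (s x) (e x) (b x))
    j-fold F Sj Ej Bj bnd pbnd Inv init pres size =
      j-snd {σ = E} (j-snd {σ = S} (j-iter {σ = S ⊗ (E ⊗ R)}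
        (λ x → 2 * length (enc S (s x)) + 2 + (2 * length (enc E (e x)) + 2 + bnd x))
        (foldStep-poly F) (j-word Sj) (j-pair Sj (j-pair Ej Bj))
        (pb-+ (pb-+ (pb-* (pb-const 2) (j-size Sj)) (pb-const 2)) (pb-+ (pb-+ (pb-* (pb-const 2) (j-size Ej)) (pb-const 2)) pbnd))
        (λ x m _ → bounded x _ (itr-inv {f = foldStep} (Inv' x) (pres' x) m (s x , e x , b x) (≤-refl , refl , init x)))))
      where
        Inv' : X → ⟦ S ⟧ × ⟦ E ⟧ × ⟦ R ⟧ → Set
        Inv' x (s' , e' , b') = length (enc S s') ≤ length (enc S (s x)) × e' ≡ e x × Inv x s' b'
        pres' : ∀ x t → Inv' x t → Inv' x (foldStep t)
        pres' x (s' , e' , b') (h , refl , h') with nul s' in eq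
        ... | true  = h , refl , h'
        ... | false = ≤-trans (tal-≤ s') h , refl , pres x s' b' eq h'
        bounded : ∀ x t → Inv' x t → length (enc (S ⊗ (E ⊗ R)) t) ≤ 2 * length (enc S (s x)) + 2 + (2 * length (enc E (e x)) + 2 + bnd x)
        bounded x (s' , e' , b') (h , refl , h') = ≤-trans (≤-reflexive (trans (pair-length (enc S s') (pair (enc E e') (enc R b')))
            (cong (2 * length (enc S s') + 2 +_) (pair-length (enc E e') (enc R b')))))
          (+-mono-≤ (+-monoˡ-≤ 2 (*-monoʳ-≤ 2 h)) (+-monoʳ-≤ (2 * length (enc E e') + 2) (size x s' b' h')))

module _ {E R : Ty} (f : ⟦ E ⟧ × Bool × ⟦ R ⟧ → ⟦ R ⟧) where
  foldW-foldl : ∀ w e b n → length w ≤ n → foldS seqW f n w e b ≡ foldl (λ b a → f (e , a , b)) b w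
  foldW-foldl []      e b zero    _ = refl
  foldW-foldl []      e b (suc n) _ = foldW-foldl [] e b n z≤n
  foldW-foldl (false ∷ w) e b (suc n) (s≤s h) = foldW-foldl w e (f (e , false , b)) n h
  foldW-foldl (true ∷ w)  e b (suc n) (s≤s h) = foldW-foldl w e (f (e , true , b)) n h

length-encL : ∀ {A : Set} (f : A → Word) as → length as ≤ length (encL f as)
length-encL f []       = z≤n
length-encL f (a ∷ as) = ≤-trans (≤-trans (s≤s (length-encL f as)) (+-monoˡ-≤ _ (≤-trans (s≤s z≤n) (m≤n+m 2 (2 * length (f a))))))
  (≤-reflexive (sym (pair-length (f a) (encL f as))))

module _ {σ E R : Ty} (d : ⟦ σ ⟧) (f : ⟦ E ⟧ × ⟦ σ ⟧ × ⟦ R ⟧ → ⟦ R ⟧) where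
  foldL-foldl : ∀ as e b n → length as ≤ n → foldS {E = E} {R} (seqL σ d) f n as e b ≡ foldl (λ b a → f (e , a , b)) b as
  foldL-foldl []       e b zero    _ = refl
  foldL-foldl []       e b (suc n) _ = foldL-foldl [] e b n z≤n
  foldL-foldl (a ∷ as) e b (suc n) (s≤s h) rewrite isNull-pair (enc σ a) (encL (enc σ) as) = foldL-foldl as e (f (e , a , b)) n h

-- Decoding and executing machines

revStep : Bool × Bool × Word → Word
revStep (_ , a , b) = if a then true ∷ b else false ∷ b

tapeStep : Bool × Bool × List ℕ → List ℕ
tapeStep (_ , a , b) = (if a then 1 else 0) ∷ b

-- Made for the reversed tape: a symbol that is not a bit discards everything collected so far,
-- which is exactly what stands to its right.
outStep : Bool × ℕ × Word → Word
outStep (_ , s , b) = if s ≡ᵇ 0 then false ∷ b else if s ≡ᵇ 1 then true ∷ b else []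

isNull-cons : ∀ w → isNull w ≡ false → suc (length (drop 1 w)) ≡ length w
isNull-cons (_ ∷ w) e = refl

encL-uncons : ∀ {A : Set} (f : A → Word) d as → isNull (encL f as) ≡ false →
              2 * length (f (hdD d as)) + 2 + length (encL f (drop 1 as)) ≡ length (encL f as)
encL-uncons f d (a ∷ as) e = sym (pair-length (f a) (encL f as))

foldl-rev : ∀ w acc → foldl (λ b a → revStep (false , a , b)) acc w ≡ w ʳ++ acc
foldl-rev []          acc = refl
foldl-rev (false ∷ w) acc = foldl-rev w (false ∷ acc)
foldl-rev (true ∷ w)  acc = foldl-rev w (true ∷ acc)

foldl-tape : ∀ w acc → foldl (λ b a → tapeStep (false , a , b)) acc w ≡ map bitSym w ʳ++ acc
foldl-tape []          acc = refl
foldl-tape (false ∷ w) acc = foldl-tape w (0 ∷ acc)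
foldl-tape (true ∷ w)  acc = foldl-tape w (1 ∷ acc)

foldl-out : ∀ r ys → foldl (λ b a → outStep (false , a , b)) [] (r ʳ++ ys) ≡ foldl (λ b a → outStep (false , a , b)) (outBits r) ys
foldl-out []                    ys = refl
foldl-out (0 ∷ r)               ys = foldl-out r (0 ∷ ys)
foldl-out (1 ∷ r)               ys = foldl-out r (1 ∷ ys)
foldl-out (s@(suc (suc _)) ∷ r) ys = foldl-out r (s ∷ ys)

module _ {X : Set} {i : X → Word} where
  j-rev : ∀ {w} → J i tW w → J i tW (λ x → rev (w x))
  j-rev {w} W = j-ext {τ = tW} (λ x → trans (foldW-foldl {tB} {tW} revStep (w x) false [] (length (w x)) ≤-refl) (foldl-rev (w x) []))
    (j-fold {E = tB} {R = tW} seqW revStep F W (j-const tB false) (j-const tW []) (λ x → length (w x)) (j-size W)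
      (λ x s b → length b + length s ≤ length (w x)) (λ x → ≤-refl)
      (λ x s b e h → ≤-trans (≤-reflexive (trans (cong (_+ length (drop 1 s)) (len (isT s) b))
        (trans (sym (+-suc (length b) _)) (cong (length b +_) (isNull-cons s e))))) h)
      (λ x s b h → ≤-trans (m≤m+n _ (length s)) h))
    where
      b : J (enc (tB ⊗ (tB ⊗ tW))) tW (λ x → proj₂ (proj₂ x))
      b = j-snd {σ = tB} (j-snd {σ = tB} self)
      F : Poly (tB ⊗ (tB ⊗ tW)) tW revStep
      F = j-if (j-fst {τ = tW} (j-snd {σ = tB} self)) (j-cons true b) (j-cons false b)
      len : ∀ a b → length (if a then true ∷ b else false ∷ b) ≡ suc (length b)
      len true  b = refl
      len false b = refl

  j-tape : ∀ {w} → J i tW w → J i (tL tN) (λ x → map bitSym (w x))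
  j-tape {w} W = j-ext {τ = tL tN} (λ x → trans (foldW-foldl {tB} {tL tN} tapeStep (rev (w x)) false [] (length (rev (w x))) ≤-refl)
      (trans (foldl-tape (rev (w x)) []) (trans (cong (_ʳ++ []) (map-ʳ++ bitSym (w x)))
        (trans (ʳ++-ʳ++-++ (map bitSym (w x)) [] []) (++-identityʳ _)))))
    -- The factor 4 is the price of one cell: a symbol `s` in an encoded list takes `2 * s + 2`
    -- bits, and `s` is at most 1.
    (j-fold {E = tB} {R = tL tN} seqW tapeStep F (j-rev W) (j-const tB false) (j-const (tL tN) []) (λ x → 4 * length (rev (w x))) (pb-* (pb-const 4) (j-size (j-rev W)))
      (λ x s b → length (encL zeros b) + 4 * length s ≤ 4 * length (rev (w x))) (λ x → ≤-refl)
      (λ x s b e h → ≤-trans (≤-trans (+-monoˡ-≤ (4 * length (drop 1 s)) (len (isT s) b))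
        (≤-reflexive (trans (cong (_+ 4 * length (drop 1 s)) (+-comm 4 (length (encL zeros b)))) (trans (+-assoc (length (encL zeros b)) 4 _)
          (cong (length (encL zeros b) +_) (trans (sym (*-suc 4 (length (drop 1 s)))) (cong (4 *_) (isNull-cons s e)))))))) h)
      (λ x s b h → ≤-trans (m≤m+n _ (4 * length s)) h))
    where
      b : J (enc (tB ⊗ (tB ⊗ tL tN))) (tL tN) (λ x → proj₂ (proj₂ x))
      b = j-snd {σ = tB} (j-snd {σ = tB} self)
      F : Poly (tB ⊗ (tB ⊗ tL tN)) (tL tN) tapeStep
      F = j-lcons {σ = tN} (j-if (j-fst {τ = tL tN} (j-snd {σ = tB} self)) (j-const tN 1) (j-const tN 0)) b
      len : ∀ a b → length (encL zeros ((if a then 1 else 0) ∷ b)) ≤ 4 + length (encL zeros b)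
      len true  b = ≤-refl
      len false b = m≤n+m _ 2

  j-lrev : ∀ {σ as} → ⟦ σ ⟧ → J i (tL σ) as → J i (tL σ) (λ x → as x ʳ++ [])
  j-lrev {σ} {as} d As = j-ext {τ = tL σ} (λ x → foldL-foldl {σ} {tB} {tL σ} d consStep (as x) false [] (length (encL (enc σ) (as x))) (length-encL (enc σ) (as x)))
    (j-fold {E = tB} {R = tL σ} (seqL σ d) consStep F As (j-const tB false) (j-const (tL σ) []) (λ x → length (encL (enc σ) (as x))) (j-size As)
      (λ x s b → length (encL (enc σ) b) + length (encL (enc σ) s) ≤ length (encL (enc σ) (as x))) (λ x → ≤-refl)
      (λ x s b e h → ≤-trans (≤-reflexive (trans (cong (_+ length (encL (enc σ) (drop 1 s))) (pair-length (enc σ (hdD d s)) (encL (enc σ) b)))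
        (trans (swap-sum (2 * length (enc σ (hdD d s)) + 2) (length (encL (enc σ) b)) (length (encL (enc σ) (drop 1 s)))) (cong (length (encL (enc σ) b) +_) (encL-uncons (enc σ) d s e))))) h)
      (λ x s b h → ≤-trans (m≤m+n _ (length (encL (enc σ) s))) h))
    where
      consStep : Bool × ⟦ σ ⟧ × List ⟦ σ ⟧ → List ⟦ σ ⟧
      consStep (_ , a , b) = a ∷ b
      F : Poly (tB ⊗ (σ ⊗ tL σ)) (tL σ) consStep
      F = j-lcons {σ = σ} (j-fst {τ = tL σ} (j-snd {σ = tB} self)) (j-snd {σ = σ} (j-snd {σ = tB} self))
      swap-sum : ∀ a b c → a + b + c ≡ b + (a + c)
      swap-sum = solve 3 (λ a b c → a :+ b :+ c := b :+ (a :+ c)) refl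
        where open +-*-Solver

  j-outBits : ∀ {r} → J i (tL tN) r → J i tW (λ x → outBits (r x))
  j-outBits {r} R = j-ext {τ = tW} (λ x → trans (foldL-foldl {tN} {tB} {tW} 0 outStep (r x ʳ++ []) false [] (length (encL zeros (r x ʳ++ []))) (length-encL zeros (r x ʳ++ [])))
      (foldl-out (r x) []))
    (j-fold {E = tB} {R = tW} (seqL tN 0) outStep F rr (j-const tB false) (j-const tW []) (λ x → length (encL zeros (r x ʳ++ []))) (j-size rr)
      (λ x s b → length b + length (encL zeros s) ≤ length (encL zeros (r x ʳ++ []))) (λ x → ≤-refl)
      (λ x s b e h → ≤-trans (≤-trans (+-monoˡ-≤ (length (encL zeros (drop 1 s))) (len (hdD 0 s) b))
        (≤-trans (≤-reflexive (sym (+-suc (length b) _))) (+-monoʳ-≤ (length b) (shorter s e)))) h)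
      (λ x s b h → ≤-trans (m≤m+n _ (length (encL zeros s))) h))
    where
      rr : J i (tL tN) (λ x → r x ʳ++ [])
      rr = j-lrev 0 R
      s : J (enc (tB ⊗ (tN ⊗ tW))) tN (λ x → proj₁ (proj₂ x))
      s = j-fst {τ = tW} (j-snd {σ = tB} self)
      b : J (enc (tB ⊗ (tN ⊗ tW))) tW (λ x → proj₂ (proj₂ x))
      b = j-snd {σ = tN} (j-snd {σ = tB} self)
      F : Poly (tB ⊗ (tN ⊗ tW)) tW outStep
      F = j-if (j-isZero s) (j-cons false b) (j-if (j-eqN s (j-const tN 1)) (j-cons true b) (j-const tW []))
      len : ∀ s b → length (outStep (false , s , b)) ≤ suc (length b)
      len 0             b = ≤-refl
      len 1             b = ≤-refl
      len (suc (suc _)) b = z≤n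
      shorter : ∀ s → isNull (encL zeros s) ≡ false → suc (length (encL zeros (drop 1 s))) ≤ length (encL zeros s)
      shorter (a ∷ s) e = ≤-trans (+-monoˡ-≤ (length (encL zeros s)) (≤-trans (s≤s z≤n) (m≤n+m 2 (2 * length (zeros a))))) (≤-reflexive (sym (pair-length (zeros a) (encL zeros s))))

-- The leading block of ones is both the unary number that `readU` reads and the block through which
-- the carry of `sucW` runs, so one iteration yields both functions.
stripStep : ℕ × Word → ℕ × Word
stripStep (n , w) = if isT w then (suc n , drop 1 w) else (n , w)

strip : Word → ℕ × Word
strip w = itr stripStep (length w) (0 , w)

strip-stops : ∀ m k w → isT w ≡ false → itr stripStep m (k , w) ≡ (k , w)
strip-stops zero    k w e = refl
strip-stops (suc m) k w e = trans (cong (itr stripStep m) (if-false {b = isT w} e)) (strip-stops m k w e)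

strip-readU : ∀ w m k → length w ≤ m → let s = itr stripStep m (k , w) in
              proj₁ s ≡ k + proj₁ (readU w) × drop 1 (proj₂ s) ≡ proj₂ (readU w)
strip-readU []          m       k h rewrite strip-stops m k [] refl = sym (+-identityʳ k) , refl
strip-readU (false ∷ w) m       k h rewrite strip-stops m k (false ∷ w) refl = sym (+-identityʳ k) , refl
strip-readU (true ∷ w)  (suc m) k (s≤s h) with readU w | strip-readU w m (suc k) h
... | n , r | e , e' = trans e (sym (+-suc k n)) , e'

afterStrip : ℕ × Word → Word
afterStrip (n , w) = zeros n ++ (if isNull w then false ∷ [] else true ∷ drop 1 w)

strip-sucW : ∀ w m k → length w ≤ m → afterStrip (itr stripStep m (k , w)) ≡ zeros k ++ sucW w
strip-sucW []          m       k h rewrite strip-stops m k [] refl = refl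
strip-sucW (false ∷ w) m       k h rewrite strip-stops m k (false ∷ w) refl = refl
strip-sucW (true ∷ w)  (suc m) k (s≤s h) = trans (strip-sucW w m (suc k) h) (shift k)
  where shift : ∀ k → false ∷ zeros k ++ sucW w ≡ zeros k ++ false ∷ sucW w
        shift zero    = refl
        shift (suc k) = cong (false ∷_) (shift k)

readU-size : ∀ w → proj₁ (readU w) + length (proj₂ (readU w)) ≤ length w
readU-size []          = z≤n
readU-size (false ∷ w) = n≤1+n _
readU-size (true ∷ w)  with readU w | readU-size w
... | n , r | h = s≤s h

readU-shrinks : ∀ b w → suc (length (proj₂ (readU (b ∷ w)))) ≤ suc (length w)
readU-shrinks false w = ≤-refl
readU-shrinks true  w with readU w | readU-size w
... | n , r | h = s≤s (≤-trans (m≤n+m (length r) n) h)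

stripStep-poly : Poly (tN ⊗ tW) (tN ⊗ tW) stripStep
stripStep-poly = j-if (j-isT w) (j-pair (j-suc n) (j-tail w)) (j-pair n w)
  where
    n : J (enc (tN ⊗ tW)) tN proj₁
    n = j-fst {τ = tW} self
    w : J (enc (tN ⊗ tW)) tW proj₂
    w = j-snd {σ = tN} self

module _ {X : Set} {i : X → Word} where
  j-strip : ∀ {w} → J i tW w → J i (tN ⊗ tW) (λ x → strip (w x))
  j-strip {w} W = j-iter {σ = tN ⊗ tW} (λ x → 2 * length (w x) + 2 + length (w x)) stripStep-poly W (j-pair (j-const tN 0) W)
    (pb-+ (pb-+ (pb-* (pb-const 2) (j-size W)) (pb-const 2)) (j-size W))
    (λ x m _ → bounded x (itr stripStep m (0 , w x)) (itr-inv {f = stripStep} (λ s → proj₁ s + length (proj₂ s) ≤ length (w x)) (pres x) m (0 , w x) ≤-refl))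
    where
      pres : ∀ x s → proj₁ s + length (proj₂ s) ≤ length (w x) → proj₁ (stripStep s) + length (proj₂ (stripStep s)) ≤ length (w x)
      pres x (n , [])        h = h
      pres x (n , false ∷ v) h = h
      pres x (n , true ∷ v)  h = ≤-trans (≤-reflexive (sym (+-suc n (length v)))) h
      bounded : ∀ x s → proj₁ s + length (proj₂ s) ≤ length (w x) → length (enc (tN ⊗ tW) s) ≤ 2 * length (w x) + 2 + length (w x)
      bounded x (n , v) h = ≤-trans (≤-reflexive (pair-length (zeros n) v)) (+-mono-≤ (+-monoˡ-≤ 2 (*-monoʳ-≤ 2
        (≤-trans (≤-reflexive (zeros-length n)) (≤-trans (m≤m+n n (length v)) h)))) (≤-trans (m≤n+m (length v) n) h))

  j-readU₁ : ∀ {w} → J i tW w → J i tN (λ x → proj₁ (readU (w x)))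
  j-readU₁ {w} W = j-ext {τ = tN} (λ x → proj₁ (strip-readU (w x) (length (w x)) 0 ≤-refl)) (j-fst {τ = tW} (j-strip W))

  j-readU₂ : ∀ {w} → J i tW w → J i tW (λ x → proj₂ (readU (w x)))
  j-readU₂ {w} W = j-ext {τ = tW} (λ x → proj₂ (strip-readU (w x) (length (w x)) 0 ≤-refl)) (j-tail (j-snd {σ = tN} (j-strip W)))

  j-sucW : ∀ {w} → J i tW w → J i tW (λ x → sucW (w x))
  j-sucW {w} W = j-ext {τ = tW} (λ x → strip-sucW (w x) (length (w x)) 0 ≤-refl)
    (j-prepend (j-fst {τ = tW} (j-strip W)) (j-if (j-isNull w') (j-const tW (false ∷ [])) (j-cons true (j-tail w'))))
    where
      w' : J i tW (λ x → proj₂ (strip (w x)))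
      w' = j-snd {σ = tN} (j-strip W)

module _ {X : Set} {i : X → Word} where
  -- Counting up by `sucW` is affordable because the index is given in unary.
  j-natToWord : ∀ {n} → J i tN n → J i tW (λ x → natToWord (n x))
  j-natToWord {n} N = j-ext {τ = tW} (λ x → eq (n x))
    (j-iterN {σ = tW} n (j-sucW self) N (j-const tW []) (j-sizeN N)
      (λ x m m≤ → ≤-trans (≤-reflexive (cong length (eq m))) (≤-trans (natToWord-length m) m≤)))
    where
      eq : ∀ m → itr sucW m [] ≡ natToWord m
      eq zero    = refl
      eq (suc m) = trans (itr-comm sucW m []) (cong sucW (eq m))

moveCode-toMove : ∀ m → moveCode (toMove m) ≡ m ⊓ 2
moveCode-toMove 0             = refl
moveCode-toMove 1             = refl
moveCode-toMove (suc (suc m)) = cong (λ k → suc (suc k)) (sym (⊓-zeroʳ m))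

fields : Word → ℕ × ℕ × ℕ × ℕ × ℕ
fields w = let r = λ v → proj₂ (readU v) ; n = λ v → proj₁ (readU v) in
  n w , n (r w) , n (r (r w)) , n (r (r (r w))) , n (r (r (r (r w))))

afterFields : Word → Word
afterFields w = let r = λ v → proj₂ (readU v) in r (r (r (r (r w))))

readRule : Word → Rule
readRule w = let (q , a , q' , b , m) = fields w in rule q a q' b (toMove m)

parseRules-cons : ∀ f b w → parseRules (suc f) (b ∷ w) ≡ readRule (b ∷ w) ∷ parseRules f (afterFields (b ∷ w))
parseRules-cons f b w with readU (b ∷ w)
... | q , w₁ with readU w₁
... | a , w₂ with readU w₂
... | q' , w₃ with readU w₃
... | b' , w₄ with readU w₄
... | m , w₅ = refl

parseStep : Word × List Rule → Word × List Rule
parseStep (w , acc) = if isNull w then (w , acc) else (afterFields w , readRule w ∷ acc)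

parseRules-[] : ∀ f → parseRules f [] ≡ []
parseRules-[] zero    = refl
parseRules-[] (suc f) = refl

itr-parseStep : ∀ f w acc → proj₂ (itr parseStep f (w , acc)) ≡ parseRules f w ʳ++ acc
itr-parseStep zero    w  acc = refl
itr-parseStep (suc f) [] acc = trans (itr-parseStep f [] acc) (cong (_ʳ++ acc) (parseRules-[] f))
itr-parseStep (suc f) w@(false ∷ v) acc =
  trans (itr-parseStep f (afterFields w) (readRule w ∷ acc)) (sym (cong (_ʳ++ acc) (parseRules-cons f false v)))
itr-parseStep (suc f) w@(true ∷ v) acc =
  trans (itr-parseStep f (afterFields w) (readRule w ∷ acc)) (sym (cong (_ʳ++ acc) (parseRules-cons f true v)))

module _ {X : Set} {i : X → Word} where
  j-readRule : ∀ {w} → J i tW w → J i tR (λ x → readRule (w x))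
  j-readRule {w} W = j-cast {σ = tN ⊗ (tN ⊗ (tN ⊗ (tN ⊗ tN)))} {τ = tR}
      (λ x → let (q , a , q' , b , m) = fields (w x) in
        cong (λ k → pair (zeros q) (pair (zeros a) (pair (zeros q') (pair (zeros b) (zeros k))))) (sym (moveCode-toMove m)))
      (j-pair (j-readU₁ W) (j-pair (j-readU₁ w₁) (j-pair (j-readU₁ w₂) (j-pair (j-readU₁ w₃) (j-min (j-readU₁ w₄) (j-const tN 2))))))
    where
      w₁ = j-readU₂ W
      w₂ = j-readU₂ w₁
      w₃ = j-readU₂ w₂
      w₄ = j-readU₂ w₃

  j-afterFields : ∀ {w} → J i tW w → J i tW (λ x → afterFields (w x))
  j-afterFields W = j-readU₂ (j-readU₂ (j-readU₂ (j-readU₂ (j-readU₂ W))))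

parseStep-poly : Poly (tW ⊗ tL tR) (tW ⊗ tL tR) parseStep
parseStep-poly = j-if (j-isNull w) (j-pair w acc) (j-pair (j-afterFields w) (j-lcons {σ = tR} (j-readRule w) acc))
  where
    w : J (enc (tW ⊗ tL tR)) tW proj₁
    w = j-fst {τ = tL tR} self
    acc : J (enc (tW ⊗ tL tR)) (tL tR) proj₂
    acc = j-snd {σ = tW} self

ruleWeight : ∀ q a q' b m → length (enc tR (rule q a q' b m)) ≡ 2 * (q + a + q' + b) + 8 + moveCode m
ruleWeight q a q' b m =
  trans (pair-length (zeros q) _) (trans (cong₂ (λ x y → 2 * x + 2 + y) (zeros-length q)
  (trans (pair-length (zeros a) _) (cong₂ (λ x y → 2 * x + 2 + y) (zeros-length a)
  (trans (pair-length (zeros q') _) (cong₂ (λ x y → 2 * x + 2 + y) (zeros-length q')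
  (trans (pair-length (zeros b) _) (cong₂ (λ x y → 2 * x + 2 + y) (zeros-length b) (zeros-length (moveCode m)))))))))
  (solve 5 (λ q a q' b m → con 2 :* q :+ con 2 :+ (con 2 :* a :+ con 2 :+ (con 2 :* q' :+ con 2 :+ (con 2 :* b :+ con 2 :+ m)))
     := con 2 :* (q :+ a :+ q' :+ b) :+ con 8 :+ m) refl q a q' b (moveCode m)))
  where open +-*-Solver

fields-size : ∀ w → let (q , a , q' , b , m) = fields w in q + a + q' + b + m + length (afterFields w) ≤ length w
fields-size w = begin
  q + a + q' + b + m + length w₅   ≡⟨ +-assoc (q + a + q' + b) m _ ⟩
  q + a + q' + b + (m + length w₅) ≤⟨ +-monoʳ-≤ (q + a + q' + b) (readU-size w₄) ⟩
  q + a + q' + b + length w₄       ≡⟨ +-assoc (q + a + q') b _ ⟩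
  q + a + q' + (b + length w₄)     ≤⟨ +-monoʳ-≤ (q + a + q') (readU-size w₃) ⟩
  q + a + q' + length w₃           ≡⟨ +-assoc (q + a) q' _ ⟩
  q + a + (q' + length w₃)         ≤⟨ +-monoʳ-≤ (q + a) (readU-size w₂) ⟩
  q + a + length w₂                ≡⟨ +-assoc q a _ ⟩
  q + (a + length w₂)              ≤⟨ +-monoʳ-≤ q (readU-size w₁) ⟩
  q + length w₁                    ≤⟨ readU-size w ⟩
  length w                         ∎
  where
    open ≤-Reasoning
    w₁ w₂ w₃ w₄ w₅ : Word
    w₁ = proj₂ (readU w)
    w₂ = proj₂ (readU w₁)
    w₃ = proj₂ (readU w₂)
    w₄ = proj₂ (readU w₃)
    w₅ = proj₂ (readU w₄)
    q a q' b m : ℕ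
    q  = proj₁ (readU w)
    a  = proj₁ (readU w₁)
    q' = proj₁ (readU w₂)
    b  = proj₁ (readU w₃)
    m  = proj₁ (readU w₄)

afterFields-shrinks : ∀ b w → suc (length (afterFields (b ∷ w))) ≤ suc (length w)
afterFields-shrinks b w = ≤-trans (s≤s (≤-trans (tail-≤ (r (r (r w₁)))) (≤-trans (tail-≤ (r (r w₁))) (≤-trans (tail-≤ (r w₁)) (tail-≤ w₁))))) (readU-shrinks b w)
  where
    r : Word → Word
    r v = proj₂ (readU v)
    w₁ : Word
    w₁ = r (b ∷ w)
    tail-≤ : ∀ w → length (proj₂ (readU w)) ≤ length w
    tail-≤ w = ≤-trans (m≤n+m _ (proj₁ (readU w))) (readU-size w)

-- A rule in the list costs at most `4 * (S + m) + 18` bits, where `S + m` is the sum of its five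
-- numbers. The parsed bits pay for it: 4 per bit cover the numbers, and 18 per bit cover the
-- constant, as every rule consumes at least one bit. This gives the factor 22.
parseWeight : Word × List Rule → ℕ
parseWeight (w , acc) = 22 * length w + length (encL (enc tR) acc)

parseStep-weight : ∀ s → parseWeight (parseStep s) ≤ parseWeight s
parseStep-weight ([] , acc)    = ≤-refl
parseStep-weight (w@(b ∷ v) , acc) = subst (λ s → parseWeight s ≤ parseWeight (w , acc)) (sym (if-false {b = isNull w} (not-null b))) (begin
    22 * r + length (pair (enc tR (readRule w)) (encL (enc tR) acc))     ≡⟨ cong (22 * r +_) (pair-length (enc tR (readRule w)) (encL (enc tR) acc)) ⟩
    22 * r + (2 * length (enc tR (readRule w)) + 2 + e)                  ≡⟨ cong (λ x → 22 * r + (2 * x + 2 + e)) (ruleWeight q a q' b' (toMove m)) ⟩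
    22 * r + (2 * (2 * S + 8 + moveCode (toMove m)) + 2 + e)             ≤⟨ +-monoʳ-≤ (22 * r) (+-monoˡ-≤ e (+-monoˡ-≤ 2 (*-monoʳ-≤ 2 (+-monoʳ-≤ (2 * S + 8) mv≤)))) ⟩
    22 * r + (2 * (2 * S + 8 + m) + 2 + e)                               ≤⟨ +-monoʳ-≤ (22 * r) (+-monoˡ-≤ e (+-monoˡ-≤ 2 (*-monoʳ-≤ 2 (+-monoʳ-≤ (2 * S + 8) (m≤m+n m m))))) ⟩
    22 * r + (2 * (2 * S + 8 + (m + m)) + 2 + e)                         ≡⟨ solve 4 (λ r S m e → con 22 :* r :+ (con 2 :* (con 2 :* S :+ con 8 :+ (m :+ m)) :+ con 2 :+ e)
                                                                              := con 4 :* (S :+ m :+ r) :+ con 18 :* (con 1 :+ r) :+ e) refl r S m e ⟩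
    4 * (S + m + r) + 18 * suc r + e                                     ≤⟨ +-monoˡ-≤ e (+-mono-≤ (*-monoʳ-≤ 4 (fields-size w)) (*-monoʳ-≤ 18 (afterFields-shrinks b v))) ⟩
    4 * length w + 18 * length w + e                                     ≡⟨ cong (_+ e) (sym (*-distribʳ-+ (length w) 4 18)) ⟩
    22 * length w + e                                                    ∎)
  where
    open ≤-Reasoning
    open +-*-Solver
    q a q' b' m S r e : ℕ
    q  = proj₁ (fields w)
    a  = proj₁ (proj₂ (fields w))
    q' = proj₁ (proj₂ (proj₂ (fields w)))
    b' = proj₁ (proj₂ (proj₂ (proj₂ (fields w))))
    m  = proj₂ (proj₂ (proj₂ (proj₂ (fields w))))
    S = q + a + q' + b'
    r = length (afterFields w)
    e = length (encL (enc tR) acc)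
    mv≤ : moveCode (toMove m) ≤ m
    mv≤ = ≤-trans (≤-reflexive (moveCode-toMove m)) (m⊓n≤m m 2)
    not-null : ∀ b → isNull (b ∷ v) ≡ false
    not-null false = refl
    not-null true  = refl

dummyRule : Rule
dummyRule = rule 0 0 0 0 mS

module _ {X : Set} {i : X → Word} where
  j-parse : ∀ {w} → J i tW w → J i (tL tR) (λ x → parseRules (length (w x)) (w x))
  j-parse {w} W = j-ext {τ = tL tR}
    (λ x → trans (cong (_ʳ++ []) (itr-parseStep (length (w x)) (w x) [])) (trans (ʳ++-ʳ++-++ (parseRules (length (w x)) (w x)) [] []) (++-identityʳ _)))
    (j-lrev dummyRule (j-snd {σ = tW} (j-iter {σ = tW ⊗ tL tR} (λ x → 2 * (22 * length (w x) + 0) + 2 + (22 * length (w x) + 0)) parseStep-poly W (j-pair W (j-const (tL tR) []))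
      (pb-+ (pb-+ (pb-* (pb-const 2) (pb-+ (pb-* (pb-const 22) (j-size W)) (pb-const 0))) (pb-const 2)) (pb-+ (pb-* (pb-const 22) (j-size W)) (pb-const 0)))
      (λ x m _ → bounded (w x) (itr parseStep m (w x , []))
         (itr-inv {f = parseStep} (λ s → parseWeight s ≤ parseWeight (w x , [])) (λ s h → ≤-trans (parseStep-weight s) h) m (w x , []) ≤-refl)))))
    where
      bounded : ∀ w s → parseWeight s ≤ parseWeight (w , []) → length (enc (tW ⊗ tL tR) s) ≤ 2 * (22 * length w + 0) + 2 + (22 * length w + 0)
      bounded w (v , acc) h = ≤-trans (≤-reflexive (pair-length v (encL (enc tR) acc)))
        (+-mono-≤ (+-monoˡ-≤ 2 (*-monoʳ-≤ 2 (≤-trans (m≤n*m (length v) 22) (≤-trans (m≤m+n (22 * length v) _) h))))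
                  (≤-trans (m≤n+m _ (22 * length v)) h))

  j-decode : ∀ {n} → J i tN n → J i (tL tR) (λ x → decodeMachine (n x))
  j-decode N = j-parse (j-natToWord N)

-- Single machine steps in polynomial time

ruleTuple configTuple : Ty
ruleTuple   = tN ⊗ (tN ⊗ (tN ⊗ (tN ⊗ tN)))
configTuple = tN ⊗ (tL tN ⊗ tL tN)

module _ {X : Set} {i : X → Word} where
  j-rule : ∀ {r} → J i tR r → J i ruleTuple (λ x → Rule.q (r x) , Rule.a (r x) , Rule.q' (r x) , Rule.b (r x) , moveCode (Rule.mv (r x)))
  j-rule = j-cast {σ = tR} {τ = ruleTuple} (λ _ → refl)

  j-config : ∀ {c} → J i tC c → J i configTuple (λ x → Config.state (c x) , Config.left (c x) , Config.right (c x))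
  j-config = j-cast {σ = tC} {τ = configTuple} (λ _ → refl)

  j-state : ∀ {c} → J i tC c → J i tN (λ x → Config.state (c x))
  j-state C = j-fst {τ = tL tN ⊗ tL tN} (j-config C)

  j-left : ∀ {c} → J i tC c → J i (tL tN) (λ x → Config.left (c x))
  j-left C = j-fst {τ = tL tN} (j-snd {σ = tN} (j-config C))

  j-right : ∀ {c} → J i tC c → J i (tL tN) (λ x → Config.right (c x))
  j-right C = j-snd {σ = tL tN} (j-snd {σ = tN} (j-config C))

  j-cfg : ∀ {q l r} → J i tN q → J i (tL tN) l → J i (tL tN) r → J i tC (λ x → cfg (q x) (l x) (r x))
  j-cfg Q L R = j-cast {σ = configTuple} {τ = tC} (λ _ → refl) (j-pair Q (j-pair L R))

  j-matches : ∀ {r c} → J i tR r → J i tC c → J i tB (λ x → matches (r x) (c x))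
  j-matches {r} {c} R C = j-ext {τ = tB} (λ x → cong (λ h → (Rule.q (r x) ≡ᵇ Config.state (c x)) ∧ (Rule.a (r x) ≡ᵇ h)) (head≡ (Config.right (c x))))
    (j-and (j-eqN (j-fst {τ = tN ⊗ (tN ⊗ (tN ⊗ tN))} (j-rule R)) (j-state C))
           (j-eqN (j-fst {τ = tN ⊗ (tN ⊗ tN)} (j-snd {σ = tN} (j-rule R))) (j-lhead 2 (j-right C))))
    where head≡ : ∀ r → hdD 2 r ≡ headSym r
          head≡ []      = refl
          head≡ (_ ∷ _) = refl

  -- `hdD 2` supplies the blank when the left part is empty. The right part is nonempty after the
  -- write, so a move to the right always takes a cell from it.
  j-apply : ∀ {r c} → J i tR r → J i tC c → J i tC (λ x → applyRule (r x) (c x))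
  j-apply {r} {c} R C = j-ext {τ = tC} (λ x → eq (r x) (c x))
    (j-if (j-isZero mv) (j-cfg q' (j-ltail 0 L) (j-lcons {σ = tN} (j-lhead 2 L) bR))
      (j-if (j-eqN mv (j-const tN 1)) (j-cfg q' (j-lcons {σ = tN} b L) (j-ltail 0 (j-right C))) (j-cfg q' L bR)))
    where
      L = j-left C
      tail₂ : J i (tN ⊗ (tN ⊗ tN)) (λ x → Rule.q' (r x) , Rule.b (r x) , moveCode (Rule.mv (r x)))
      tail₂ = j-snd {σ = tN} (j-snd {σ = tN} (j-rule R))
      q' : J i tN (λ x → Rule.q' (r x))
      q' = j-fst {τ = tN ⊗ tN} tail₂
      b : J i tN (λ x → Rule.b (r x))
      b = j-fst {τ = tN} (j-snd {σ = tN} tail₂)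
      mv : J i tN (λ x → moveCode (Rule.mv (r x)))
      mv = j-snd {σ = tN} (j-snd {σ = tN} tail₂)
      bR : J i (tL tN) (λ x → Rule.b (r x) ∷ drop 1 (Config.right (c x)))
      bR = j-lcons {σ = tN} b (j-ltail 0 (j-right C))
      eq : ∀ r c → (if moveCode (Rule.mv r) ≡ᵇ 0 then cfg (Rule.q' r) (drop 1 (Config.left c)) (hdD 2 (Config.left c) ∷ Rule.b r ∷ drop 1 (Config.right c))
                    else if moveCode (Rule.mv r) ≡ᵇ 1 then cfg (Rule.q' r) (Rule.b r ∷ Config.left c) (drop 1 (Config.right c))
                    else cfg (Rule.q' r) (Config.left c) (Rule.b r ∷ drop 1 (Config.right c))) ≡ applyRule r c
      eq (rule q a q' b mL) (cfg s []      [])      = refl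
      eq (rule q a q' b mL) (cfg s []      (_ ∷ _)) = refl
      eq (rule q a q' b mL) (cfg s (_ ∷ _) [])      = refl
      eq (rule q a q' b mL) (cfg s (_ ∷ _) (_ ∷ _)) = refl
      eq (rule q a q' b mR) (cfg s l       [])      = refl
      eq (rule q a q' b mR) (cfg s l       (_ ∷ _)) = refl
      eq (rule q a q' b mS) (cfg s l       [])      = refl
      eq (rule q a q' b mS) (cfg s l       (_ ∷ _)) = refl

-- Stays put if there are at most k successors, so that an accepting path can be padded.
pickM : Machine → ℕ → Config → Config
pickM []      k       c = c
pickM (r ∷ M) k       c with matches r c
pickM (r ∷ M) k       c | false = pickM M k c
pickM (r ∷ M) zero    c | true  = applyRule r c
pickM (r ∷ M) (suc k) c | true  = pickM M k c

PickState : Set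
PickState = Bool × ℕ × Config

pickStep : Config × Rule × PickState → PickState
pickStep (c , r , fin , k , cur) =
  if fin ∨ not (matches r c) then (fin , k , cur) else
  if k ≡ᵇ 0 then (true , k , applyRule r c) else (false , pred k , cur)

foldl-pick-fin : ∀ M c k cur → foldl (λ b r → pickStep (c , r , b)) (true , k , cur) M ≡ (true , k , cur)
foldl-pick-fin []      c k cur = refl
foldl-pick-fin (r ∷ M) c k cur = foldl-pick-fin M c k cur

foldl-pick : ∀ M c k → proj₂ (proj₂ (foldl (λ b r → pickStep (c , r , b)) (false , k , c) M)) ≡ pickM M k c
foldl-pick []      c k = refl
foldl-pick (r ∷ M) c k with matches r c
foldl-pick (r ∷ M) c k       | false = foldl-pick M c k
foldl-pick (r ∷ M) c zero    | true  = cong (λ s → proj₂ (proj₂ s)) (foldl-pick-fin M c zero (applyRule r c))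
foldl-pick (r ∷ M) c (suc k) | true  = foldl-pick M c k

tP : Ty
tP = tB ⊗ (tN ⊗ tC)

pickStep-poly : Poly (tC ⊗ (tR ⊗ tP)) tP pickStep
pickStep-poly = j-if (j-or fin (j-not (j-matches r c))) (j-pair fin (j-pair k cur))
    (j-if (j-isZero k) (j-pair (j-const tB true) (j-pair k (j-apply r c))) (j-pair (j-const tB false) (j-pair (j-pred k) cur)))
  where
    In : Ty
    In = tC ⊗ (tR ⊗ tP)
    c : J (enc In) tC proj₁
    c = j-fst {τ = tR ⊗ tP} self
    rs : J (enc In) (tR ⊗ tP) proj₂
    rs = j-snd {σ = tC} self
    r : J (enc In) tR (λ x → proj₁ (proj₂ x))
    r = j-fst {τ = tP} rs
    s : J (enc In) tP (λ x → proj₂ (proj₂ x))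
    s = j-snd {σ = tR} rs
    fin : J (enc In) tB (λ x → proj₁ (proj₂ (proj₂ x)))
    fin = j-fst {τ = tN ⊗ tC} s
    k : J (enc In) tN (λ x → proj₁ (proj₂ (proj₂ (proj₂ x))))
    k = j-fst {τ = tC} (j-snd {σ = tB} s)
    cur : J (enc In) tC (λ x → proj₂ (proj₂ (proj₂ (proj₂ x))))
    cur = j-snd {σ = tN} (j-snd {σ = tB} s)

apply-poly : Poly (tR ⊗ tC) tC (λ x → applyRule (proj₁ x) (proj₂ x))
apply-poly = j-apply (j-fst {τ = tC} self) (j-snd {σ = tR} self)

opaque
  apply-size : Σ ℕ λ j → ∀ r c → length (enc tC (applyRule r c)) ≤ (2 + length (enc (tR ⊗ tC) (r , c))) ^ j
  apply-size = let j , h = j-size apply-poly in j , λ r c → h (r , c)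

module _ {X : Set} {i : X → Word} where
  j-pick : ∀ {M k c} → J i (tL tR) M → J i tN k → J i tC c → J i tC (λ x → pickM (M x) (k x) (c x))
  j-pick {M} {k} {c} Mj K C = j-ext {τ = tC} eq (j-snd {σ = tN} (j-snd {σ = tB} folded))
    where
      j : ℕ
      j = proj₁ apply-size
      sizeC sizeM : X → ℕ
      sizeC x = length (enc tC (c x))
      sizeM x = length (encL (enc tR) (M x))
      cur≤ : X → ℕ
      -- A pass through the rules applies at most one of them, and to the original configuration, so
      -- the bound for a single application suffices.
      cur≤ x = sizeC x + (2 + (2 * sizeM x + 2 + sizeC x)) ^ j
      bnd : X → ℕ
      bnd x = 4 + (2 * k x + 2 + cur≤ x)
      bnd-pb : PB (λ x → length (i x)) bnd
      bnd-pb = pb-+ (pb-const 4) (pb-+ (pb-+ (pb-* (pb-const 2) (j-sizeN K)) (pb-const 2)) (pb-+ (j-size C)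
        (pb-∘ {c = λ x → 2 * sizeM x + 2 + sizeC x} (pb-+ (pb-+ (pb-* (pb-const 2) (j-size Mj)) (pb-const 2)) (j-size C)) (j , λ _ → ≤-refl))))
      Inv : X → Machine → PickState → Set
      Inv x s (_ , k' , cur) = length (encL (enc tR) s) ≤ sizeM x × k' ≤ k x × length (enc tC cur) ≤ cur≤ x
      pres : ∀ x s b → isNull (encL (enc tR) s) ≡ false → Inv x s b → Inv x (drop 1 s) (pickStep (c x , hdD dummyRule s , b))
      pres x (r ∷ s) (fin , k' , cur) e (h₁ , h₂ , h₃) with fin ∨ not (matches r (c x))
      ... | true = ≤-trans (ltail-length (enc tR) (r ∷ s)) h₁ , h₂ , h₃
      ... | false with k' ≡ᵇ 0
      ...   | false = ≤-trans (ltail-length (enc tR) (r ∷ s)) h₁ , ≤-trans (pred[n]≤n {k'}) h₂ , h₃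
      ...   | true  = ≤-trans (ltail-length (enc tR) (r ∷ s)) h₁ , h₂ ,
        ≤-trans (proj₂ apply-size r (c x)) (≤-trans (^-monoˡ-≤ j (+-monoʳ-≤ 2 (≤-trans (≤-reflexive (pair-length (enc tR r) (enc tC (c x))))
          (+-monoˡ-≤ (sizeC x) (+-monoˡ-≤ 2 (*-monoʳ-≤ 2 r≤)))))) (m≤n+m _ (sizeC x)))
        where r≤ : length (enc tR r) ≤ sizeM x
              r≤ = ≤-trans (≤-trans (m≤m+n (length (enc tR r)) (length (enc tR r) + 0)) (≤-trans (m≤m+n _ 2) (m≤m+n _ (length (encL (enc tR) s)))))
                     (≤-trans (≤-reflexive (sym (pair-length (enc tR r) (encL (enc tR) s)))) h₁)
      size : ∀ x s b → Inv x s b → length (enc tP b) ≤ bnd x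
      size x s (d , k' , cur) (h₁ , h₂ , h₃) = ≤-trans (≤-reflexive (trans (pair-length (enc tB d) (pair (zeros k') (enc tC cur)))
          (cong (2 * length (enc tB d) + 2 +_) (trans (pair-length (zeros k') (enc tC cur)) (cong (λ n → 2 * n + 2 + length (enc tC cur)) (zeros-length k'))))))
        (+-mono-≤ (flag d) (+-mono-≤ (+-monoˡ-≤ 2 (*-monoʳ-≤ 2 h₂)) h₃))
        where flag : ∀ d → 2 * length (enc tB d) + 2 ≤ 4
              flag true  = ≤-refl
              flag false = m≤m+n 2 2
      folded : J i tP (λ x → foldS {E = tC} {R = tP} (seqL tR dummyRule) pickStep (sizeM x) (M x) (c x) (false , k x , c x))
      folded = j-fold {E = tC} {R = tP} (seqL tR dummyRule) pickStep pickStep-poly Mj C (j-pair (j-const tB false) (j-pair K C))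
        bnd bnd-pb Inv (λ x → ≤-refl , ≤-refl , m≤m+n (sizeC x) ((2 + (2 * sizeM x + 2 + sizeC x)) ^ j)) pres size
      eq : ∀ x → proj₂ (proj₂ (foldS {E = tC} {R = tP} (seqL tR dummyRule) pickStep (sizeM x) (M x) (c x) (false , k x , c x))) ≡ pickM (M x) (k x) (c x)
      eq x = trans (cong (λ s → proj₂ (proj₂ s)) (foldL-foldl {tR} {tC} {tP} dummyRule pickStep (M x) (c x) (false , k x , c x) (sizeM x) (length-encL (enc tR) (M x))))
                   (foldl-pick (M x) (c x) (k x))

-- Machine runs under a word of choices

tE : Ty
tE = tL tR ⊗ (tW ⊗ tC)

execStep : ⟦ tE ⟧ → ⟦ tE ⟧
execStep (M , u , c) = M , proj₂ (readU u) , pickM M (proj₁ (readU u)) c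

-- The word u resolves the nondeterminism; once it is used up the first matching rule is taken, as in runD.
exec : Machine → ℕ → Word → Config → Config
exec M n u c = proj₂ (proj₂ (itr execStep n (M , u , c)))

execStep-poly : Poly tE tE execStep
execStep-poly = j-pair M (j-pair (j-readU₂ u) (j-pick M (j-readU₁ u) c))
  where
    M : J (enc tE) (tL tR) proj₁
    M = j-fst {τ = tW ⊗ tC} self
    u : J (enc tE) tW (λ x → proj₁ (proj₂ x))
    u = j-fst {τ = tC} (j-snd {σ = tL tR} self)
    c : J (enc tE) tC (λ x → proj₂ (proj₂ x))
    c = j-snd {σ = tW} (j-snd {σ = tL tR} self)

-- A polynomial bound per step would not survive many steps. This measure grows in each step by an
-- amount that depends on the rules alone, and the state number stays below a fixed bound.
cells : Config → ℕ
cells c = length (encL zeros (Config.left c)) + length (encL zeros (Config.right c))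

rule-b : ∀ r → Rule.b r ≤ length (enc tR r)
rule-b (rule q a q' b m) = ≤-trans (≤-trans (m≤n+m b (q + a + q')) (≤-trans (m≤m+n _ _) (≤-trans (m≤m+n _ 8) (m≤m+n _ (moveCode m)))))
  (≤-reflexive (sym (ruleWeight q a q' b m)))

rule-q' : ∀ r → Rule.q' r ≤ length (enc tR r)
rule-q' (rule q a q' b m) = ≤-trans (≤-trans (m≤n+m q' (q + a)) (≤-trans (m≤m+n _ b) (≤-trans (m≤m+n _ _) (≤-trans (m≤m+n _ 8) (m≤m+n _ (moveCode m))))))
  (≤-reflexive (sym (ruleWeight q a q' b m)))

cell-length : ∀ s l → length (encL zeros (s ∷ l)) ≡ 2 * s + 2 + length (encL zeros l)
cell-length s l = trans (pair-length (zeros s) (encL zeros l)) (cong (λ n → 2 * n + 2 + length (encL zeros l)) (zeros-length s))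

write-length : ∀ b r → length (encL zeros (writeSym b r)) ≤ length (encL zeros r) + (2 * b + 2)
write-length b []      = ≤-reflexive (trans (cell-length b []) (+-identityʳ _))
write-length b (x ∷ r) = ≤-trans (≤-reflexive (trans (cell-length b r) (+-comm (2 * b + 2) _)))
  (+-monoˡ-≤ (2 * b + 2) (≤-trans (m≤n+m _ (2 * x + 2)) (≤-reflexive (sym (cell-length x r)))))

-- A move can only add a fresh blank, and the blank 2 takes `2 * 2 + 2 = 6` bits.
move-cells : ∀ m q l r → cells (setState q (moveHead m l r)) ≤ length (encL zeros l) + length (encL zeros r) + 6
move-cells mS q l       r       = m≤m+n _ 6
move-cells mR q l       []      = ≤-reflexive (trans (cong (_+ 0) (cell-length 2 l)) (solve 1 (λ x → con 6 :+ x :+ con 0 := x :+ con 0 :+ con 6) refl (length (encL zeros l))))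
  where open +-*-Solver
move-cells mR q l       (s ∷ r) = ≤-trans (≤-reflexive (trans (cong (_+ length (encL zeros r)) (cell-length s l))
  (trans (solve 3 (λ a x y → a :+ x :+ y := x :+ (a :+ y)) refl (2 * s + 2) (length (encL zeros l)) (length (encL zeros r)))
         (cong (length (encL zeros l) +_) (sym (cell-length s r)))))) (m≤m+n _ 6)
  where open +-*-Solver
move-cells mL q []      r       = ≤-reflexive (trans (cell-length 2 r) (+-comm 6 _))
move-cells mL q (s ∷ l) r       = ≤-trans (≤-reflexive (trans (cong (length (encL zeros l) +_) (cell-length s r))
  (trans (solve 3 (λ a x y → x :+ (a :+ y) := a :+ x :+ y) refl (2 * s + 2) (length (encL zeros l)) (length (encL zeros r)))
         (cong (_+ length (encL zeros r)) (sym (cell-length s l)))))) (m≤m+n _ 6)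
  where open +-*-Solver

apply-cells : ∀ r c → cells (applyRule r c) ≤ cells c + (2 * length (enc tR r) + 8)
apply-cells r@(rule q a q' b m) (cfg s lt rt) = begin
  cells (setState q' (moveHead m lt (writeSym b rt)))                             ≤⟨ move-cells m q' lt (writeSym b rt) ⟩
  L + length (encL zeros (writeSym b rt)) + 6                                     ≤⟨ +-monoˡ-≤ 6 (+-monoʳ-≤ L (write-length b rt)) ⟩
  L + (R + (2 * b + 2)) + 6                                                       ≡⟨ solve 3 (λ l r b → l :+ (r :+ (b :+ con 2)) :+ con 6 := l :+ r :+ (b :+ con 8)) refl L R (2 * b) ⟩
  L + R + (2 * b + 8)                                                             ≤⟨ +-monoʳ-≤ (L + R) (+-monoˡ-≤ 8 (*-monoʳ-≤ 2 (rule-b r))) ⟩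
  L + R + (2 * length (enc tR r) + 8)                                             ∎
  where
    open ≤-Reasoning
    open +-*-Solver
    L = length (encL zeros lt)
    R = length (encL zeros rt)

apply-state : ∀ r c → Config.state (applyRule r c) ≡ Rule.q' r
apply-state (rule q a q' b m) (cfg s l r) = refl

rules-head : ∀ r M → length (enc tR r) ≤ length (encL (enc tR) (r ∷ M))
rules-head r M = ≤-trans (≤-trans (m≤m+n (length (enc tR r)) _) (≤-trans (m≤m+n _ 2) (m≤m+n _ (length (encL (enc tR) M)))))
  (≤-reflexive (sym (pair-length (enc tR r) (encL (enc tR) M))))

pick-cells : ∀ M k c → cells (pickM M k c) ≤ cells c + (2 * length (encL (enc tR) M) + 8)
pick-cells []      k       c = m≤m+n _ 8
pick-cells (r ∷ M) k       c with matches r c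
pick-cells (r ∷ M) k       c | false = ≤-trans (pick-cells M k c) (+-monoʳ-≤ (cells c) (+-monoˡ-≤ 8 (*-monoʳ-≤ 2 (ltail-length (enc tR) (r ∷ M)))))
pick-cells (r ∷ M) zero    c | true  = ≤-trans (apply-cells r c) (+-monoʳ-≤ (cells c) (+-monoˡ-≤ 8 (*-monoʳ-≤ 2 (rules-head r M))))
pick-cells (r ∷ M) (suc k) c | true  = ≤-trans (pick-cells M k c) (+-monoʳ-≤ (cells c) (+-monoˡ-≤ 8 (*-monoʳ-≤ 2 (ltail-length (enc tR) (r ∷ M)))))

pick-state : ∀ M k c {b} → Config.state c ≤ b → length (encL (enc tR) M) ≤ b → Config.state (pickM M k c) ≤ b
pick-state []      k       c h h' = h
pick-state (r ∷ M) k       c h h' with matches r c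
pick-state (r ∷ M) k       c h h' | false = pick-state M k c h (≤-trans (ltail-length (enc tR) (r ∷ M)) h')
pick-state (r ∷ M) zero    c h h' | true  = ≤-trans (≤-reflexive (apply-state r c)) (≤-trans (rule-q' r) (≤-trans (rules-head r M) h'))
pick-state (r ∷ M) (suc k) c h h' | true  = pick-state M k c h (≤-trans (ltail-length (enc tR) (r ∷ M)) h')

execBound : ℕ → ℕ → ℕ → ℕ → ℕ → ℕ
execBound M u s w n = 2 * M + 2 + (2 * u + 2 + (2 * (s + M) + 4 + 2 * (w + n * (2 * M + 8))))

config-length : ∀ c → length (enc tC c) ≤ 2 * Config.state c + 4 + 2 * cells c
config-length (cfg s l r) = ≤-trans (≤-reflexive (trans (pair-length (zeros s) _) (cong₂ (λ x y → 2 * x + 2 + y) (zeros-length s) (pair-length (encL zeros l) (encL zeros r)))))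
  (≤-trans (m≤m+n _ (length (encL zeros r))) (≤-reflexive (solve 3 (λ s l r → con 2 :* s :+ con 2 :+ (con 2 :* l :+ con 2 :+ r) :+ r := con 2 :* s :+ con 4 :+ con 2 :* (l :+ r)) refl s (length (encL zeros l)) (length (encL zeros r)))))
  where open +-*-Solver

exec-size : ∀ n M u c {b w} → Config.state c ≤ b → length (encL (enc tR) M) ≤ b → cells c ≤ w → let (M' , u' , c') = itr execStep n (M , u , c) in
            M' ≡ M × length u' ≤ length u × Config.state c' ≤ b × cells c' ≤ w + n * (2 * length (encL (enc tR) M) + 8)
exec-size zero    M u c h h' h'' = refl , ≤-refl , h , ≤-trans h'' (m≤m+n _ 0)
exec-size (suc n) M u c {b} {w} h h' h'' =
  let e₁ , e₂ , e₃ , e₄ = exec-size n M (proj₂ (readU u)) (pickM M (proj₁ (readU u)) c) {b} {w + (2 * length (encL (enc tR) M) + 8)}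
                            (pick-state M (proj₁ (readU u)) c h h') h' (≤-trans (pick-cells M (proj₁ (readU u)) c) (+-monoˡ-≤ _ h''))
  in e₁ , ≤-trans e₂ (≤-trans (m≤n+m _ (proj₁ (readU u))) (readU-size u)) , e₃ , ≤-trans e₄ (≤-reflexive (+-assoc w _ _))

module _ {X : Set} {i : X → Word} where
  j-exec : ∀ {M n u c} → J i (tL tR) M → J i tN n → J i tW u → J i tC c → J i tC (λ x → exec (M x) (n x) (u x) (c x))
  j-exec {M} {n} {u} {c} Mj N U C = j-snd {σ = tW} (j-snd {σ = tL tR} (j-iterN {σ = tE} bnd execStep-poly N (j-pair Mj (j-pair U C)) bnd-pb bounded))
    where
      lM lu : X → ℕ
      lM x = length (encL (enc tR) (M x))
      lu x = length (u x)
      bnd : X → ℕ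
      bnd x = execBound (lM x) (lu x) (Config.state (c x)) (cells (c x)) (n x)
      cells-pb : PB (λ x → length (i x)) (λ x → cells (c x))
      cells-pb = pb-+ (j-size (j-left C)) (j-size (j-right C))
      two : ∀ {d : X → ℕ} → PB (λ x → length (i x)) d → PB (λ x → length (i x)) (λ x → 2 * d x)
      two = pb-* (pb-const 2)
      bnd-pb : PB (λ x → length (i x)) bnd
      bnd-pb = pb-+ (pb-+ (two (j-size Mj)) (pb-const 2)) (pb-+ (pb-+ (two (j-size U)) (pb-const 2))
        (pb-+ (pb-+ (two (pb-+ (j-sizeN (j-state C)) (j-size Mj))) (pb-const 4)) (two (pb-+ cells-pb (pb-* (j-sizeN N) (pb-+ (two (j-size Mj)) (pb-const 8)))))))
      bounded : ∀ x m → m ≤ n x → length (enc tE (itr execStep m (M x , u x , c x))) ≤ bnd x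
      bounded x m m≤ =
        let e₁ , e₂ , e₃ , e₄ = exec-size m (M x) (u x) (c x) {Config.state (c x) + lM x} {cells (c x)} (m≤m+n _ _) (m≤n+m (lM x) _) ≤-refl
        in go (itr execStep m (M x , u x , c x)) e₁ e₂ e₃ (≤-trans e₄ (+-monoʳ-≤ (cells (c x)) (*-monoˡ-≤ (2 * lM x + 8) m≤)))
        where
          go : ∀ s → proj₁ s ≡ M x → length (proj₁ (proj₂ s)) ≤ lu x → Config.state (proj₂ (proj₂ s)) ≤ Config.state (c x) + lM x →
               cells (proj₂ (proj₂ s)) ≤ cells (c x) + n x * (2 * lM x + 8) → length (enc tE s) ≤ bnd x
          go (_ , u' , c') refl h₁ h₂ h₃ = ≤-trans (≤-reflexive (trans (pair-length (encL (enc tR) (M x)) _) (cong (2 * lM x + 2 +_) (pair-length u' (enc tC c')))))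
            (+-monoʳ-≤ (2 * lM x + 2) (+-mono-≤ (+-monoˡ-≤ 2 (*-monoʳ-≤ 2 h₁)) (≤-trans (config-length c') (+-mono-≤ (+-monoˡ-≤ 4 (*-monoʳ-≤ 2 h₂)) (*-monoʳ-≤ 2 h₃)))))

pick-nothing : ∀ M c → stepD M c ≡ nothing → pickM M 0 c ≡ c
pick-nothing []      c e = refl
pick-nothing (r ∷ M) c e with matches r c
... | false = pick-nothing M c e

pick-just : ∀ M c {c'} → stepD M c ≡ just c' → pickM M 0 c ≡ c'
pick-just (r ∷ M) c e with matches r c
pick-just (r ∷ M) c refl | true = refl
... | false = pick-just M c e

-- `readU` yields 0 on the empty word, which selects the first matching rule, the one that `stepD`
-- takes. The interpreter of nondeterministic machines thus also serves as a universal deterministic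
-- one.
exec-runD : ∀ M n c → exec M n [] c ≡ runD M n c
exec-runD M zero    c = refl
exec-runD M (suc n) c with stepD M c in e
... | just c' = trans (cong (exec M n []) (pick-just M c e)) (exec-runD M n c')
... | nothing = trans (cong (exec M n []) (pick-nothing M c e)) (trans (exec-runD M n c) (stuck n))
  where stuck : ∀ n → runD M n c ≡ c
        stuck zero = refl
        stuck (suc n) rewrite e = refl

pick-cases : ∀ M k c → pickM M k c ≡ c ⊎ pickM M k c ∈ successors M c
pick-cases []      k       c = inj₁ refl
pick-cases (r ∷ M) k       c with matches r c
pick-cases (r ∷ M) k       c | false = pick-cases M k c
pick-cases (r ∷ M) zero    c | true  = inj₂ (here refl)
pick-cases (r ∷ M) (suc k) c | true with pick-cases M k c
... | inj₁ e = inj₁ e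
... | inj₂ h = inj₂ (there h)

pick-stays : ∀ M c → pickM M (length M) c ≡ c
pick-stays M c = go M (length M) ≤-refl
  where
    go : ∀ M k → length M ≤ k → pickM M k c ≡ c
    go []      k       h = refl
    go (r ∷ M) (suc k) (s≤s h) with matches r c
    ... | false = go M (suc k) (≤-trans h (n≤1+n k))
    ... | true  = go M k h

pick-onto : ∀ M c {c'} → c' ∈ successors M c → ∃ λ k → k ≤ length M × pickM M k c ≡ c'
pick-onto (r ∷ M) c h with matches r c
pick-onto (r ∷ M) c h           | false = let k , k≤ , e = pick-onto M c h in k , ≤-trans k≤ (n≤1+n _) , e
pick-onto (r ∷ M) c (here refl) | true  = 0 , z≤n , refl
pick-onto (r ∷ M) c (there h)   | true  = let k , k≤ , e = pick-onto M c h in suc k , s≤s k≤ , e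

exec-sound : ∀ M n u c → Config.state (exec M n u c) ≡ 1 → AccPath M n c
exec-sound M zero    u c e = now e
exec-sound M (suc n) u c e with pick-cases M (proj₁ (readU u)) c
... | inj₁ stay = accPath-mono (n≤1+n n) (subst (AccPath M n) stay (exec-sound M n (proj₂ (readU u)) _ e))
... | inj₂ h    = next h (exec-sound M n (proj₂ (readU u)) _ e)

exec-choose : ∀ M n k u c → exec M (suc n) (unary k u) c ≡ exec M n u (pickM M k c)
exec-choose M n k u c rewrite readU-unary k u = refl

-- `exec` makes all `n` steps, so an early accepting path is prolonged by the choice `length M`, on
-- which `pickM` stays put.
exec-complete : ∀ {M n c} → AccPath M n c → ∃ λ u → length u ≤ n * suc (length M) × Config.state (exec M n u c) ≡ 1
exec-complete {M} {zero}  (now e) = [] , z≤n , e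
exec-complete {M} {suc n} {c} (now e) =
  let u , u≤ , e' = exec-complete {M} {n} (now e)
  in unary (length M) u , ≤-trans (≤-reflexive (length-unary (length M) u)) (+-monoʳ-≤ (suc (length M)) u≤) ,
     trans (cong Config.state (trans (exec-choose M n (length M) u c) (cong (exec M n u) (pick-stays M c)))) e'
exec-complete {M} {suc n} {c} (next h a) =
  let u , u≤ , e' = exec-complete a
      k , k≤ , e = pick-onto M c h
  in unary k u , ≤-trans (≤-reflexive (length-unary k u)) (+-mono-≤ (s≤s k≤) u≤) ,
     trans (cong Config.state (trans (exec-choose M n k u c) (cong (exec M n u) e))) e'

-- Clocks and the verification of acceptance

tT : Ty
tT = tN ⊗ (tN ⊗ tN)

-- The exponent in p_k is the input `k`, so the full power may be exponentially large. Truncating at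
-- the time bound `t` after each factor keeps all values small and agrees with truncating once at
-- the end.
powStep : ⟦ tT ⟧ → ⟦ tT ⟧
powStep (t , b , a) = t , b , t ⊓ (a * b)

powStep-poly : Poly tT tT powStep
powStep-poly = j-pair t (j-pair b (j-min t (j-mul a b)))
  where
    t : J (enc tT) tN proj₁
    t = j-fst {τ = tN ⊗ tN} self
    b : J (enc tT) tN (λ x → proj₁ (proj₂ x))
    b = j-fst {τ = tN} (j-snd {σ = tN} self)
    a : J (enc tT) tN (λ x → proj₂ (proj₂ x))
    a = j-snd {σ = tN} (j-snd {σ = tN} self)

-- If `t ≤ a`, both sides are `t` for a positive factor and 0 for the factor 0.
⊓-trunc-* : ∀ t a b → t ⊓ ((t ⊓ a) * b) ≡ t ⊓ (a * b)
⊓-trunc-* t a b with ≤-total a t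
... | inj₁ a≤t = cong (λ y → t ⊓ (y * b)) (m≥n⇒m⊓n≡n a≤t)
⊓-trunc-* t a zero    | inj₂ t≤a = cong (t ⊓_) (trans (*-zeroʳ (t ⊓ a)) (sym (*-zeroʳ a)))
⊓-trunc-* t a (suc b) | inj₂ t≤a = trans (cong (λ y → t ⊓ (y * suc b)) (m≤n⇒m⊓n≡m t≤a))
  (trans (m≤n⇒m⊓n≡m (m≤m*n t (suc b))) (sym (m≤n⇒m⊓n≡m (≤-trans t≤a (m≤m*n a (suc b))))))

⊓-trunc-+ : ∀ t a b → t ⊓ ((t ⊓ a) + b) ≡ t ⊓ (a + b)
⊓-trunc-+ t a b with ≤-total a t
... | inj₁ a≤t = cong (λ y → t ⊓ (y + b)) (m≥n⇒m⊓n≡n a≤t)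
... | inj₂ t≤a = trans (cong (λ y → t ⊓ (y + b)) (m≤n⇒m⊓n≡m t≤a))
  (trans (m≤n⇒m⊓n≡m (m≤m+n t b)) (sym (m≤n⇒m⊓n≡m (≤-trans t≤a (m≤m+n a b)))))

itr-powStep : ∀ m t b a → itr powStep m (t , b , t ⊓ a) ≡ (t , b , t ⊓ (a * b ^ m))
itr-powStep zero    t b a = cong (λ y → t , b , t ⊓ y) (sym (*-identityʳ a))
itr-powStep (suc m) t b a = trans (cong (λ y → itr powStep m (t , b , y)) (⊓-trunc-* t a b))
  (trans (itr-powStep m t b (a * b)) (cong (λ y → t , b , t ⊓ y) (*-assoc a b (b ^ m))))

module _ {X : Set} {i : X → Word} where
  j-clock : ∀ {k t n} → J i tN k → J i tN t → J i tN n → J i tN (λ x → t x ⊓ p (k x) (n x))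
  j-clock {k} {t} {n} K Tj N = j-ext {τ = tN}
    (λ x → trans (cong (λ s → t x ⊓ (proj₂ (proj₂ s) + k x)) (itr-powStep (k x) (t x) (n x) 1))
             (trans (⊓-trunc-+ (t x) (1 * n x ^ k x) (k x)) (cong (λ y → t x ⊓ (y + k x)) (*-identityˡ (n x ^ k x)))))
    (j-min Tj (j-add (j-snd {σ = tN} (j-snd {σ = tN} (j-iterN {σ = tT} (λ x → 2 * t x + 2 + (2 * n x + 2 + t x)) powStep-poly K
      (j-pair Tj (j-pair N (j-min Tj (j-const tN 1))))
      (pb-+ (pb-+ (pb-* (pb-const 2) (j-sizeN Tj)) (pb-const 2)) (pb-+ (pb-+ (pb-* (pb-const 2) (j-sizeN N)) (pb-const 2)) (j-sizeN Tj)))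
      (λ x m _ → ≤-trans (≤-reflexive (trans (cong (λ s → length (enc tT s)) (itr-powStep m (t x) (n x) 1))
          (trans (pair-length (zeros (t x)) _) (cong₂ (λ a b → 2 * a + 2 + b) (zeros-length (t x))
            (trans (pair-length (zeros (n x)) _) (cong₂ (λ a b → 2 * a + 2 + b) (zeros-length (n x)) (zeros-length (t x ⊓ (1 * n x ^ m)))))))))
        (+-monoʳ-≤ (2 * t x + 2) (+-monoʳ-≤ (2 * n x + 2) (m⊓n≤m (t x) _))))))) K))

  j-initial : ∀ {w} → J i tW w → J i tC (λ x → initial (w x))
  j-initial W = j-cfg (j-const tN 0) (j-const (tL tN) []) (j-tape W)

acc : ℕ → ℕ → Word → Word → Bool
acc i t x u = if i ≡ᵇ 0 then false else if i ≡ᵇ 1 then true else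
              (Config.state (exec (decodeMachine i) (t ⊓ p i (length x)) u (initial x)) ≡ᵇ 1)

module _ {X : Set} {i : X → Word} where
  j-acc : ∀ {k t x u} → J i tN k → J i tN t → J i tW x → J i tW u → J i tB (λ y → acc (k y) (t y) (x y) (u y))
  j-acc K Tj W U = j-if (j-isZero K) (j-const tB false) (j-if (j-eqN K (j-const tN 1)) (j-const tB true)
    (j-eqN (j-state (j-exec (j-decode K) (j-clock K Tj (j-length W)) U (j-initial W))) (j-const tN 1)))

acc-sound : ∀ i t x u → acc i t x u ≡ true → InL i t x
acc-sound (suc zero)      t x u e = tt
acc-sound i@(suc (suc _)) t x u e = subst T (sym (accPath-sound (decodeMachine i) _ (initial x)
  (exec-sound (decodeMachine i) (t ⊓ p i (length x)) u (initial x) (≡ᵇ-sound _ 1 e)))) tt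

parseRules-length : ∀ f w → length (parseRules f w) ≤ f
parseRules-length zero    w       = z≤n
parseRules-length (suc f) []      = z≤n
parseRules-length (suc f) (b ∷ w) = ≤-trans (≤-reflexive (cong length (parseRules-cons f b w))) (s≤s (parseRules-length f _))

-- There are at most `t` steps, and each choice is a unary number up to the number of rules, which
-- is at most `i`.
acc-complete : ∀ i t x → InL i t x → ∃ λ u → length u ≤ t * suc i × acc i t x u ≡ true
acc-complete (suc zero)      t x h = [] , z≤n , refl
acc-complete i@(suc (suc _)) t x h =
  let u , u≤ , e = exec-complete (accPath-complete (decodeMachine i) (t ⊓ p i (length x)) (initial x) (Equivalence.to T-≡ h))
  in u , ≤-trans u≤ (*-mono-≤ (m⊓n≤m t _) (s≤s (≤-trans (parseRules-length (length (natToWord i)) (natToWord i)) (natToWord-length i)))) ,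
     trans (cong (_≡ᵇ 1) e) refl

InL? : ∀ i t x → Dec (InL i t x)
InL? zero            t x = no (λ ())
InL? (suc zero)      t x = yes tt
InL? (suc (suc _))   t x = T? _

-- The proof system for the complement of D'

indexI indexJ timeOf : Word → ℕ
inputOf : Word → Word
indexI w  = length (proj₁ (split w))
indexJ w  = length (proj₁ (split (proj₂ (split w))))
inputOf w = proj₁ (split (proj₂ (split (proj₂ (split w)))))
timeOf w  = length (proj₁ (split (proj₂ (split (proj₂ (split (proj₂ (split w))))))))

-- The projections are total, so being a tuple can be decided by comparing a word with its `normal`
-- form.
normal : Word → Word
normal w = tuple4 (indexI w) (indexJ w) (inputOf w) (timeOf w)

module _ (i j : ℕ) (x : Word) (t : ℕ) where
  private
    w w₁ w₂ w₃ : Word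
    w₃ = pair (zeros t) []
    w₂ = pair x w₃
    w₁ = pair (zeros j) w₂
    w  = tuple4 i j x t
    rest₁ : proj₂ (split w) ≡ w₁
    rest₁ = cong proj₂ (split-pair (zeros i) w₁)
    rest₂ : proj₂ (split (proj₂ (split w))) ≡ w₂
    rest₂ = trans (cong (λ v → proj₂ (split v)) rest₁) (cong proj₂ (split-pair (zeros j) w₂))
    rest₃ : proj₂ (split (proj₂ (split (proj₂ (split w))))) ≡ w₃
    rest₃ = trans (cong (λ v → proj₂ (split v)) rest₂) (cong proj₂ (split-pair x w₃))

  indexI-tuple4 : indexI (tuple4 i j x t) ≡ i
  indexI-tuple4 = trans (cong (λ s → length (proj₁ s)) (split-pair (zeros i) w₁)) (zeros-length i)

  indexJ-tuple4 : indexJ (tuple4 i j x t) ≡ j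
  indexJ-tuple4 = trans (cong (λ v → length (proj₁ (split v))) rest₁)
    (trans (cong (λ s → length (proj₁ s)) (split-pair (zeros j) w₂)) (zeros-length j))

  inputOf-tuple4 : inputOf (tuple4 i j x t) ≡ x
  inputOf-tuple4 = trans (cong (λ v → proj₁ (split v)) rest₂) (cong proj₁ (split-pair x w₃))

  timeOf-tuple4 : timeOf (tuple4 i j x t) ≡ t
  timeOf-tuple4 = trans (cong (λ v → length (proj₁ (split v))) rest₃)
    (trans (cong (λ s → length (proj₁ s)) (split-pair (zeros t) [])) (zeros-length t))

tuple4-cong : ∀ {i i' j j' x x' t t'} → i ≡ i' → j ≡ j' → x ≡ x' → t ≡ t' → tuple4 i j x t ≡ tuple4 i' j' x' t'
tuple4-cong refl refl refl refl = refl

normal-tuple4 : ∀ i j x t → normal (tuple4 i j x t) ≡ tuple4 i j x t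
normal-tuple4 i j x t = tuple4-cong (indexI-tuple4 i j x t) (indexJ-tuple4 i j x t) (inputOf-tuple4 i j x t) (timeOf-tuple4 i j x t)

D-tuple4 : ∀ {i j x t} → D (tuple4 i j x t) → InL i t x × ¬ InL j t x
D-tuple4 {i} {j} {x} {t} (i' , j' , x' , t' , e , a , r) =
  go (trans (sym (indexI-tuple4 i j x t)) (trans (cong indexI e) (indexI-tuple4 i' j' x' t')))
     (trans (sym (indexJ-tuple4 i j x t)) (trans (cong indexJ e) (indexJ-tuple4 i' j' x' t')))
     (trans (sym (inputOf-tuple4 i j x t)) (trans (cong inputOf e) (inputOf-tuple4 i' j' x' t')))
     (trans (sym (timeOf-tuple4 i j x t)) (trans (cong timeOf e) (timeOf-tuple4 i' j' x' t')))
  where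
    go : i ≡ i' → j ≡ j' → x ≡ x' → t ≡ t' → InL i t x × ¬ InL j t x
    go refl refl refl refl = a , r

tuple4-length : ∀ i j x t → length (tuple4 i j x t) ≡ 2 * i + 2 + (2 * j + 2 + (2 * length x + 2 + (2 * t + 2 + 0)))
tuple4-length i j x t = trans (pair-length (zeros i) _) (cong₂ (λ a b → 2 * a + 2 + b) (zeros-length i)
  (trans (pair-length (zeros j) _) (cong₂ (λ a b → 2 * a + 2 + b) (zeros-length j)
  (trans (pair-length x _) (cong (2 * length x + 2 +_) (trans (pair-length (zeros t) []) (cong (λ a → 2 * a + 2 + 0) (zeros-length t))))))))

i<tuple4 : ∀ i j x t → suc i ≤ length (tuple4 i j x t)
i<tuple4 i j x t = ≤-trans (≤-trans (≤-trans (s≤s (m≤m+n i (i + 0))) (≤-trans (≤-reflexive (+-comm 1 (2 * i))) (+-monoʳ-≤ (2 * i) (n≤1+n 1)))) (m≤m+n (2 * i + 2) _))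
  (≤-reflexive (sym (tuple4-length i j x t)))

t≤tuple4 : ∀ i j x t → t ≤ length (tuple4 i j x t)
t≤tuple4 i j x t = ≤-trans (≤-trans (m≤m+n t (t + 0)) (≤-trans (m≤m+n (2 * t) 2) (≤-trans (m≤m+n (2 * t + 2) 0)
  (≤-trans (m≤n+m _ (2 * length x + 2)) (≤-trans (m≤n+m _ (2 * j + 2)) (m≤n+m _ (2 * i + 2))))))) (≤-reflexive (sym (tuple4-length i j x t)))

module _ {X : Set} {i : X → Word} where
  j-tuple4 : ∀ {a b x t} → J i tN a → J i tN b → J i tW x → J i tN t → J i tW (λ y → tuple4 (a y) (b y) (x y) (t y))
  j-tuple4 A B W Tj = j-cast {σ = tN ⊗ (tN ⊗ (tW ⊗ (tN ⊗ tW)))} {τ = tW} (λ _ → refl)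
    (j-pair A (j-pair B (j-pair W (j-pair Tj (j-const tW [])))))

  j-wpair : ∀ {u v} → J i tW u → J i tW v → J i tW (λ x → pair (u x) (v x))
  j-wpair U V = j-cast {σ = tW ⊗ tW} {τ = tW} (λ _ → refl) (j-pair U V)

  j-zeros : ∀ {n} → J i tN n → J i tW (λ x → zeros (n x))
  j-zeros = j-cast {σ = tN} {τ = tW} (λ _ → refl)

  j-indexI : ∀ {w} → J i tW w → J i tN (λ x → indexI (w x))
  j-indexI W = j-length (j-wfst W)
  j-indexJ : ∀ {w} → J i tW w → J i tN (λ x → indexJ (w x))
  j-indexJ W = j-length (j-wfst (j-wsnd W))
  j-inputOf : ∀ {w} → J i tW w → J i tW (λ x → inputOf (w x))
  j-inputOf W = j-wfst (j-wsnd (j-wsnd W))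
  j-timeOf : ∀ {w} → J i tW w → J i tN (λ x → timeOf (w x))
  j-timeOf W = j-length (j-wfst (j-wsnd (j-wsnd (j-wsnd W))))

InL-true : ∀ {c} t x → 2 ≤ c → acceptsWithin (decodeMachine c) (t ⊓ p c (length x)) (initial x) ≡ true → InL c t x
InL-true {suc zero}    t x (s≤s ()) e
InL-true {suc (suc c)} t x _ e = subst T (sym e) tt

InL-false : ∀ {c} t x → 2 ≤ c → acceptsWithin (decodeMachine c) (t ⊓ p c (length x)) (initial x) ≡ false → ¬ InL c t x
InL-false {suc zero}    t x (s≤s ()) e h
InL-false {suc (suc c)} t x _ e h = subst T e h

InL-false⁻¹ : ∀ {c} t x → 2 ≤ c → ¬ InL c t x → ¬ (acceptsWithin (decodeMachine c) (t ⊓ p c (length x)) (initial x) ≡ true)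
InL-false⁻¹ t x h ¬L e = ¬L (InL-true t x h e)

runD-stable : ∀ M n m c → stepD M (runD M n c) ≡ nothing → n ≤ m → runD M m c ≡ runD M n c
runD-stable M zero    zero    c e h = refl
runD-stable M zero    (suc m) c e h rewrite e = refl
runD-stable M (suc n) (suc m) c e (s≤s h) with stepD M c in eq
... | nothing = refl
... | just c' = runD-stable M n m c' e h

witnessed : Word → Word → Bool
witnessed w u = acc (indexI w) (timeOf w) (inputOf w) u

-- N_0 rejects everything, so this tuple is in `D` precisely when N_j accepts the input in time.
accepted : Word → Word
accepted w = tuple4 (indexJ w) 0 (inputOf w) (timeOf w)

witnessed-complete : ∀ i j x t → InL i t x → let w = tuple4 i j x t in
                     ∃ λ u → length u ≤ length w * length w × witnessed w u ≡ true
witnessed-complete i j x t L =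
  let u , u≤ , e = acc-complete i t x L
  in u , ≤-trans u≤ (*-mono-≤ (t≤tuple4 i j x t) (i<tuple4 i j x t)) ,
     trans (cong₂ (λ f z → f z) (cong₂ (λ a b y → acc a b y u) (indexI-tuple4 i j x t) (timeOf-tuple4 i j x t)) (inputOf-tuple4 i j x t)) e

witnessed-sound : ∀ i j x t u → witnessed (tuple4 i j x t) u ≡ true → InL i t x
witnessed-sound i j x t u e = acc-sound i t x u
  (trans (sym (cong₂ (λ f z → f z) (cong₂ (λ a b y → acc a b y u) (indexI-tuple4 i j x t) (timeOf-tuple4 i j x t)) (inputOf-tuple4 i j x t))) e)

accepted-tuple4 : ∀ i j x t → accepted (tuple4 i j x t) ≡ tuple4 j 0 x t
accepted-tuple4 i j x t = tuple4-cong {j = 0} {j' = 0} (indexJ-tuple4 i j x t) refl (inputOf-tuple4 i j x t) (timeOf-tuple4 i j x t)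

-- `coD'` is a negation; positive information is extracted from it by decisions, with `eqW` for the
-- form of the word and `InL?` for acceptance.
coD'-tuple4 : ∀ w → coD' w → ∃ λ i → ∃ λ j → ∃ λ x → ∃ λ t → w ≡ tuple4 i j x t × (InL i t x → InL j t x)
coD'-tuple4 w co with eqW w (normal w) in e
... | false = ⊥-elim (co (inj₂ λ (i , j , x , t , w≡) → false≢true (trans (sym e)
                (trans (cong₂ eqW w≡ (trans (cong normal w≡) (normal-tuple4 i j x t))) (eqW-refl (tuple4 i j x t))))))
  where false≢true : ¬ (false ≡ true)
        false≢true ()
... | true  = indexI w , indexJ w , inputOf w , timeOf w , w≡ , implies
  where
    w≡ = eqW-sound w (normal w) e
    implies : InL (indexI w) (timeOf w) (inputOf w) → InL (indexJ w) (timeOf w) (inputOf w)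
    implies a with InL? (indexJ w) (timeOf w) (inputOf w)
    ... | yes b = b
    ... | no ¬b = ⊥-elim (co (inj₁ (indexI w , indexJ w , inputOf w , timeOf w , w≡ , a , ¬b)))

default default' : Word
default  = tuple4 1 0 [] 0
default' = tuple4 0 0 [] 0

D-default : D default
D-default = 1 , 0 , [] , 0 , refl , tt , λ ()

coD'-default' : coD' default'
coD'-default' (inj₁ d) = proj₁ (D-tuple4 {0} {0} {[]} {0} d)
coD'-default' (inj₂ ¬wf) = ¬wf (0 , 0 , [] , 0 , refl)

-- The word `aux` consists of a machine code, a word `y` and a clock in unary. The bit `true` is the
-- tag under which the extended proof system `g₁` receives the pair of `y` and `u`.
simulated : Word → Word → Word
simulated aux u = let y,m = proj₂ (split aux) in
  outBits (Config.right (exec (parseRules (length (proj₁ (split aux))) (proj₁ (split aux))) (length (proj₂ (split y,m))) []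
    (initial (true ∷ pair (proj₁ (split y,m)) u))))

-- The zeros make the input of N_c at least as long as any `u` that matters, so that its clock
-- leaves time to guess `u`.
question : Word → Word → Word
question w aux = pair w (pair aux (zeros (length w * length w)))

-- The new proof system, its soundness and its completeness

module Construction (f : Word → Word) (poly : PolyTime f) (sound : ∀ x → D (f x)) (onto : ∀ y → D y → ∃ λ x → f x ≡ y) where

  -- u is a counterexample to the question (w , aux) if it witnesses N_i accepting x, while the machine
  -- described by aux does not produce an f-proof of x ∈ L(N_j) from it.
  refutes : Word × Word → Bool
  refutes (q , u) = let w = proj₁ (split q) in
    -- Longer words do not count as counterexamples, since the clock within `aux` is computed for
    -- words up to this length; accepting words within it exist by `witnessed-complete`.
    (((length u ∸ length w * length w) ≡ᵇ 0) ∧ witnessed w u) ∧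
    not (eqW (f (simulated (proj₁ (split (proj₂ (split q)))) u)) (accepted w))

  module _ {X : Set} {i : X → Word} where
    j-f : ∀ {w} → J i tW w → J i tW (λ x → f (w x))
    j-f W = j-app {σ = tW} (polyTime⇒poly poly) W

    j-witnessed : ∀ {w u} → J i tW w → J i tW u → J i tB (λ x → witnessed (w x) (u x))
    j-witnessed W U = j-acc (j-indexI W) (j-timeOf W) (j-inputOf W) U

    j-accepted : ∀ {w} → J i tW w → J i tW (λ x → accepted (w x))
    j-accepted W = j-tuple4 (j-indexJ W) (j-const tN 0) (j-inputOf W) (j-timeOf W)

    j-simulated : ∀ {a u} → J i tW a → J i tW u → J i tW (λ x → simulated (a x) (u x))
    j-simulated A U = j-outBits (j-right (j-exec (j-parse (j-wfst A)) (j-length (j-wsnd (j-wsnd A))) (j-const tW [])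
      (j-initial (j-cons true (j-wpair (j-wfst (j-wsnd A)) U)))))

    j-question : ∀ {w a} → J i tW w → J i tW a → J i tW (λ x → question (w x) (a x))
    j-question W A = j-wpair W (j-wpair A (j-zeros (j-mul (j-length W) (j-length W))))

  opaque
    refutes-j : J {Word} id tB (λ x → refutes (split x))
    refutes-j = j-and (j-and (j-leq (j-length u) (j-mul (j-length w) (j-length w))) (j-witnessed w u))
        (j-not (j-eqW (j-f (j-simulated (j-wfst (j-wsnd q)) u)) (j-accepted w)))
      where
        x : J {Word} id tW id
        x = j-input (λ _ → refl)
        q : J {Word} id tW (λ x → proj₁ (split x))
        q = j-wfst x
        u : J {Word} id tW (λ x → proj₂ (split x))
        u = j-wsnd x
        w : J {Word} id tW (λ x → proj₁ (split (proj₁ (split x))))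
        w = j-wfst q

  opaque
    verifier : ∃₂ λ c k → 2 ≤ c ×
      (∀ z → (∀ u → refutes (split (z ++ u)) ≡ false) → ∀ n → acceptsWithin (decodeMachine c) n (initial z) ≡ false) ×
      (∀ z u → length u ≤ length z → refutes (split (z ++ u)) ≡ true →
         acceptsWithin (decodeMachine c) ((length z ^ k + k) ⊓ p c (length z)) (initial z) ≡ true)
    verifier = poly-verifier refutes refutes-j

  c k : ℕ
  c = proj₁ verifier
  k = proj₁ (proj₂ verifier)

  -- The word ends with the separator of the first component, so a guess `u` appended to it on the
  -- tape makes it `pair q u`.
  input : Word → Word
  input q = pair q []

  clock : Word → ℕ
  clock q = length (input q) ^ k + k

  statement : Word → Word
  statement q = tuple4 1 c (input q) (clock q)

  split-input : ∀ q u → split (input q ++ u) ≡ (q , u)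
  split-input q u = trans (cong split (trans (++-assoc (encComp q) [] u) refl)) (split-pair q u)

  statement-sound : ∀ q u → D (statement q) → length u ≤ length (input q) → refutes (q , u) ≡ false
  statement-sound q u d u≤ with refutes (q , u) in e
  ... | false = refl
  ... | true  = ⊥-elim (InL-false⁻¹ (clock q) (input q) (proj₁ (proj₂ (proj₂ verifier))) (proj₂ (D-tuple4 {1} {c} {input q} {clock q} d))
                  (proj₂ (proj₂ (proj₂ (proj₂ verifier))) (input q) u u≤ (trans (cong refutes (split-input q u)) e)))

  statement-complete : ∀ q → (∀ u → refutes (q , u) ≡ false) → D (statement q)
  statement-complete q all = 1 , c , input q , clock q , refl , tt ,
    InL-false (clock q) (input q) (proj₁ (proj₂ (proj₂ verifier)))
      (proj₁ (proj₂ (proj₂ (proj₂ verifier))) (input q) (λ u → trans (cong refutes (split-input q u)) (all u)) (clock q ⊓ p c (length (input q))))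

  -- The second test keeps out words that are not tuples, which belong to `D'`.
  F : Word → Word
  F e = let v = proj₁ (split e) ; w = proj₁ (split (proj₂ (split e))) ; a = proj₂ (split (proj₂ (split e))) in
    if eqW (f v) (statement (question w a)) ∧ eqW w (normal w) then w else default'

  F-value : ∀ v w a → f v ≡ statement (question w a) → w ≡ normal w → F (pair v (pair w a)) ≡ w
  F-value v w a e e' = trans (cong₂ (λ s s' → if eqW (f (proj₁ s)) (statement (question (proj₁ s') (proj₂ s'))) ∧ eqW (proj₁ s') (normal (proj₁ s')) then proj₁ s' else default')
      (split-pair v (pair w a)) (trans (cong (λ s → split (proj₂ s)) (split-pair v (pair w a))) (split-pair w a)))
    (if-true (cong₂ _∧_ (trans (cong (λ y → eqW y (statement (question w a))) e) (eqW-refl (statement (question w a))))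
                        (trans (cong (eqW w) (sym e')) (eqW-refl w))))

  module _ {X : Set} {i : X → Word} where
    j-statement : ∀ {q} → J i tW q → J i tW (λ x → statement (q x))
    j-statement Q = j-tuple4 (j-const tN 1) (j-const tN c) z (j-add (j-pow k (j-length z)) (j-const tN k))
      where z = j-wpair Q (j-const tW [])

  F-poly : PolyTime F
  F-poly = poly⇒polyTime (j-if (j-and (j-eqW (j-f (j-wfst e)) (j-statement (j-question w (j-wsnd (j-wsnd e)))))
      (j-eqW w (j-tuple4 (j-indexI w) (j-indexJ w) (j-inputOf w) (j-timeOf w)))) w (j-const tW default'))
    where
      e : J {Word} id tW id
      e = j-input (λ _ → refl)
      w : J {Word} id tW (λ e → proj₁ (split (proj₂ (split e))))
      w = j-wfst (j-wsnd e)

  question-length : ∀ w a → length w * length w ≤ length (input (question w a))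
  question-length w a = begin
    n                                                  ≡⟨ sym (zeros-length n) ⟩
    length (zeros n)                                   ≤⟨ m≤n+m _ (2 * length a + 2) ⟩
    2 * length a + 2 + length (zeros n)                ≡⟨ sym (pair-length a (zeros n)) ⟩
    length (pair a (zeros n))                          ≤⟨ m≤n+m _ (2 * length w + 2) ⟩
    2 * length w + 2 + length (pair a (zeros n))       ≡⟨ sym (pair-length w (pair a (zeros n))) ⟩
    length (question w a)                              ≤⟨ m≤m+n _ _ ⟩
    2 * length (question w a)                          ≤⟨ m≤m+n _ 2 ⟩
    2 * length (question w a) + 2                      ≤⟨ m≤m+n _ 0 ⟩
    2 * length (question w a) + 2 + 0                  ≡⟨ sym (pair-length (question w a) []) ⟩
    length (input (question w a))                      ∎
    where
      open ≤-Reasoning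
      n : ℕ
      n = length w * length w

  refutes-question : ∀ w a u → refutes (question w a , u) ≡
    (((length u ∸ length w * length w) ≡ᵇ 0) ∧ witnessed w u) ∧ not (eqW (f (simulated a u)) (accepted w))
  refutes-question w a u = cong₂ (λ w' a' → (((length u ∸ length w' * length w') ≡ᵇ 0) ∧ witnessed w' u) ∧ not (eqW (f (simulated a' u)) (accepted w')))
    (cong proj₁ (split-pair w r)) (trans (cong (λ s → proj₁ (split (proj₂ s))) (split-pair w r)) (cong proj₁ (split-pair a (zeros (length w * length w)))))
    where r = pair a (zeros (length w * length w))

  -- The word `a` is not trusted. Whatever machine it describes, the output is only read as an
  -- `f`-proof, so soundness of `f` forces acceptance by N_j as soon as N_i has an accepting `u`.
  F-sound-core : ∀ w a → D (statement (question w a)) → ¬ D w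
  F-sound-core w a d (i , j , x , t , refl , Li , ¬Lj) =
    let u , u≤ , wit = witnessed-complete i j x t Li
        safe = trans (sym (refutes-question w a u)) (statement-sound (question w a) u d (≤-trans u≤ (question-length w a)))
        checked = unrefuted (cong₂ _∧_ (cong (_≡ᵇ 0) (m≤n⇒m∸n≡0 u≤)) wit) safe
        f≡ = trans (eqW-sound (f (simulated a u)) (accepted (tuple4 i j x t)) checked) (accepted-tuple4 i j x t)
    in ¬Lj (proj₁ (D-tuple4 {j} {0} {x} {t} (subst D f≡ (sound (simulated a u)))))
    where
      unrefuted : ∀ {x y} → x ≡ true → x ∧ not y ≡ false → y ≡ true
      unrefuted {true} {true} _ _ = refl

  F-sound : ∀ e → coD' (F e)
  F-sound e = go (proj₁ (split e)) (proj₁ (split (proj₂ (split e)))) (proj₂ (split (proj₂ (split e))))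
    where
      go : ∀ v w a → coD' (if eqW (f v) (statement (question w a)) ∧ eqW w (normal w) then w else default')
      go v w a = by-cases (eqW (f v) (statement (question w a)) ∧ eqW w (normal w)) refl
        where
          by-cases : ∀ b → eqW (f v) (statement (question w a)) ∧ eqW w (normal w) ≡ b → coD' (if b then w else default')
          by-cases false _ = coD'-default'
          by-cases true  e (inj₁ d)   = F-sound-core w a (subst D (eqW-sound (f v) _ (proj₁ (∧-true e))) (sound v)) d
          by-cases true  e (inj₂ ¬wf) = ¬wf (indexI w , indexJ w , inputOf w , timeOf w , eqW-sound w (normal w) (proj₂ (∧-true {eqW (f v) (statement (question w a))} e)))

  -- True statements about a given polynomial-time machine

  module Certificate {π : Word → Word} (polyπ : PolyTime π) where
    M : Machine
    M = proj₁ polyπ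
    kπ : ℕ
    kπ = proj₁ (proj₂ polyπ)

    -- The base bounds the length of `true ∷ pair y u`: 1 for the tag, `2 * length y + 2` for the
    -- code of `y`, and `length w * length w` for an admissible `u`.
    steps : Word → Word → ℕ
    steps w y = (3 + 2 * length y + length w * length w) ^ kπ + kπ

    advice : Word → Word → Word
    advice w y = pair (encRules M) (pair y (zeros (steps w y)))

    simulated-advice : ∀ w y u → length u ≤ length w * length w → simulated (advice w y) u ≡ π (true ∷ pair y u)
    simulated-advice w y u u≤ = trans (unfold w y u) (trans (cong output (trans (exec-runD M (steps w y) (initial z))
        (runD-stable M (length z ^ kπ + kπ) (steps w y) (initial z) (proj₁ (proj₂ (proj₂ polyπ) z)) enough))) (proj₂ (proj₂ (proj₂ polyπ) z)))
      where
        z : Word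
        z = true ∷ pair y u
        enough : length z ^ kπ + kπ ≤ steps w y
        enough = +-monoˡ-≤ kπ (^-monoˡ-≤ kπ (≤-trans (s≤s (≤-trans (≤-reflexive (trans (pair-length y u)
            (trans (cong (_+ length u) (+-comm (2 * length y) 2)) refl))) (+-monoʳ-≤ (2 + 2 * length y) u≤))) ≤-refl))
        unfold : ∀ w y u → simulated (advice w y) u ≡ output (exec M (steps w y) [] (initial (true ∷ pair y u)))
        unfold w y u = cong₂ (λ code ym → output (exec (parseRules (length code) code) (length (proj₂ (split ym))) [] (initial (true ∷ pair (proj₁ (split ym)) u))))
            (cong proj₁ (split-pair (encRules M) rest')) (cong proj₂ (split-pair (encRules M) rest'))
          ⟨trans⟩ (cong₂ (λ M' s → output (exec M' (length (proj₂ s)) [] (initial (true ∷ pair (proj₁ s) u))))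
            (parse-encRules (length (encRules M)) M (length-encRules M)) (split-pair y (zeros (steps w y)))
          ⟨trans⟩ cong (λ n → output (exec M n [] (initial (true ∷ pair y u)))) (zeros-length (steps w y)))
          where
            rest' : Word
            rest' = pair y (zeros (steps w y))
            infixr 5 _⟨trans⟩_
            _⟨trans⟩_ : ∀ {A : Set} {a b c : A} → a ≡ b → b ≡ c → a ≡ c
            _⟨trans⟩_ = trans

    certified : ∀ w y → (∀ u → witnessed w u ≡ true → f (π (true ∷ pair y u)) ≡ accepted w) → D (statement (question w (advice w y)))
    certified w y good = statement-complete (question w (advice w y)) (λ u → trans (refutes-question w (advice w y) u) (harmless u))
      where
        harmless : ∀ u → (((length u ∸ length w * length w) ≡ᵇ 0) ∧ witnessed w u) ∧ not (eqW (f (simulated (advice w y) u)) (accepted w)) ≡ false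
        harmless u with ((length u ∸ length w * length w) ≡ᵇ 0) ∧ witnessed w u in e
        ... | false = refl
        ... | true  = let e₁ , e₂ = ∧-true {(length u ∸ length w * length w) ≡ᵇ 0} e in
          cong not (trans (cong (λ v → eqW v (accepted w))
            (trans (cong f (simulated-advice w y u (m∸n≡0⇒m≤n (≡ᵇ-sound _ 0 e₁)))) (good u e₂))) (eqW-refl (accepted w)))

    module _ {X : Set} {i : X → Word} where
      j-advice : ∀ {w y} → J i tW w → J i tW y → J i tW (λ x → advice (w x) (y x))
      j-advice W Y = j-wpair (j-const tW (encRules M)) (j-wpair Y (j-zeros
        (j-add (j-pow kπ (j-add (j-add (j-const tN 3) (j-mul (j-const tN 2) (j-length Y))) (j-mul (j-length W) (j-length W)))) (j-const tN kπ))))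

  -- If N_j does not accept, neither does N_i; then no `u` ever calls for the proof, and the empty
  -- word will do.
  accepted-proof : ∀ i j x t → (InL i t x → InL j t x) → ∃ λ v → InL i t x → f v ≡ tuple4 j 0 x t
  accepted-proof i j x t imp with InL? j t x
  ... | yes Lj = let v , e = onto (tuple4 j 0 x t) (j , 0 , x , t , refl , Lj , λ ()) in v , λ _ → e
  ... | no ¬Lj = [] , λ Li → ⊥-elim (¬Lj (imp Li))

  F-onto : ∀ w → coD' w → ∃ λ e → F e ≡ w
  F-onto w co =
    let i , j , x , t , w≡ , imp = coD'-tuple4 w co
        v , good = accepted-proof i j x t imp
        constant = poly⇒polyTime {λ _ → v} (j-const tW v)
        v' , e = onto _ (Certificate.certified constant w [] (λ u wit → trans (good (witnessed-sound i j x t u (subst (λ w → witnessed w u ≡ true) w≡ wit)))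
                   (sym (trans (cong accepted w≡) (accepted-tuple4 i j x t)))))
    in pair v' (pair w (Certificate.advice constant w [])) , F-value v' w (Certificate.advice constant w []) e (trans w≡ (sym (trans (cong normal w≡) (normal-tuple4 i j x t))))

  -- Simulation of an arbitrary proof system

  module Simulate (optimal : ∀ g → IsProofSystem D g → PSimulates f g)
                  (g : Word → Word) (polyg : PolyTime g) (soundg : ∀ x → coD' (g x)) where
    -- Inputs tagged `false` reproduce `f`, which gives all of `D` as image. A word `u` that does
    -- not witness acceptance carries no information about N_j and is sent to the fixed element
    -- `default`.
    g₁ : Word → Word
    g₁ e = if isT e then (let w = g (proj₁ (split (drop 1 e))) in
                          if witnessed w (proj₂ (split (drop 1 e))) then accepted w else default)
                    else f (drop 1 e)

    module _ {X : Set} {i : X → Word} where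
      j-g : ∀ {w} → J i tW w → J i tW (λ x → g (w x))
      j-g W = j-app {σ = tW} (polyTime⇒poly polyg) W

    g₁-poly : PolyTime g₁
    g₁-poly = poly⇒polyTime (j-if (j-isT e) (j-if (j-witnessed w (j-wsnd (j-tail e))) (j-accepted w) (j-const tW default)) (j-f (j-tail e)))
      where
        e : J {Word} id tW id
        e = j-input (λ _ → refl)
        w : J {Word} id tW (λ e → g (proj₁ (split (drop 1 e))))
        w = j-g (j-wfst (j-tail e))

    good-case : ∀ w u → coD' w → D (if witnessed w u then accepted w else default)
    good-case w u co = by-cases (witnessed w u) refl
      where
        by-cases : ∀ b → witnessed w u ≡ b → D (if b then accepted w else default)
        by-cases false _ = D-default
        by-cases true wit =
          let i , j , x , t , w≡ , imp = coD'-tuple4 w co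
              Lj = imp (witnessed-sound i j x t u (subst (λ w → witnessed w u ≡ true) w≡ wit))
          in j , 0 , x , t , trans (cong accepted w≡) (accepted-tuple4 i j x t) , Lj , λ ()

    g₁-sound : ∀ e → D (g₁ e)
    g₁-sound []          = sound []
    g₁-sound (false ∷ e) = sound e
    g₁-sound (true ∷ e)  = good-case (g (proj₁ (split e))) (proj₂ (split e)) (soundg (proj₁ (split e)))

    sim₁ : PSimulates f g₁
    sim₁ = optimal g₁ (g₁-poly , g₁-sound , λ y d → let x , e = onto y d in false ∷ x , e)

    open Certificate (proj₁ (proj₂ sim₁))

    certificate : ∀ y → D (statement (question (g y) (advice (g y) y)))
    certificate y = certified (g y) y (λ u wit → trans (proj₂ (proj₂ sim₁) (true ∷ pair y u)) (g₁-value u wit))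
      where
        g₁-value : ∀ u → witnessed (g y) u ≡ true → g₁ (true ∷ pair y u) ≡ accepted (g y)
        g₁-value u wit = trans (cong (λ s → if witnessed (g (proj₁ s)) (proj₂ s) then accepted (g (proj₁ s)) else default) (split-pair y u)) (if-true wit)

    -- The statements for `g y` are polynomial-time computable from `y`, but their `f`-proofs are
    -- known only to exist. Making the statements values of a proof system lets the simulation
    -- deliver these proofs.
    g₂ : Word → Word
    g₂ e = if isT e then (let y = drop 1 e in statement (question (g y) (advice (g y) y))) else f (drop 1 e)

    g₂-poly : PolyTime g₂
    g₂-poly = poly⇒polyTime (j-if (j-isT e) (j-statement (j-question (j-g y) (j-advice (j-g y) y))) (j-f y))
      where
        e : J {Word} id tW id
        e = j-input (λ _ → refl)
        y : J {Word} id tW (drop 1)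
        y = j-tail e

    g₂-sound : ∀ e → D (g₂ e)
    g₂-sound []          = sound []
    g₂-sound (false ∷ e) = sound e
    g₂-sound (true ∷ e)  = certificate e

    sim₂ : PSimulates f g₂
    sim₂ = optimal g₂ (g₂-poly , g₂-sound , λ y d → let x , e = onto y d in false ∷ x , e)

    ψ : Word → Word
    ψ y = pair (proj₁ sim₂ (true ∷ y)) (pair (g y) (advice (g y) y))

    ψ-poly : PolyTime ψ
    ψ-poly = poly⇒polyTime (j-wpair (j-app {σ = tW} (polyTime⇒poly (proj₁ (proj₂ sim₂))) (j-cons true y)) (j-wpair (j-g y) (j-advice (j-g y) y)))
      where
        y : J {Word} id tW id
        y = j-input (λ _ → refl)

    F-simulates : PSimulates F g
    F-simulates = ψ , ψ-poly , λ y →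
      let i , j , x , t , w≡ , _ = coD'-tuple4 (g y) (soundg y)
      in F-value (proj₁ sim₂ (true ∷ y)) (g y) (advice (g y) y) (proj₂ (proj₂ sim₂) (true ∷ y))
           (trans w≡ (sym (trans (cong normal w≡) (normal-tuple4 i j x t))))

theorem7 : (∃ λ f → IsPOptimal D f) → ∃ λ f → IsPOptimal coD' f
theorem7 (f , (poly , sound , onto) , optimal) = F , (F-poly , F-sound , F-onto) ,
  λ g (polyg , soundg , _) → Simulate.F-simulates optimal g polyg soundg
  where open Construction f poly sound onto
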